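{- Let $G$ be a connected plane bipartite graph with a perfect matching. Suppose that for every nice cycle $C$ of $G$ and every maximum resonant set $K$ of $I[C]$, the graph $I[C]-K$ has a unique perfect matching. Then $Cl(G)=F(G)$.
   Context: For a perfect matching $M$ of a graph, a cycle is $M$-alternating if its edges alternate between edges in $M$ and not in $M$; a finite face is $M$-resonant if its boundary is $M$-alternating. A resonant set of a plane graph is a set of pairwise vertex-disjoint finite faces all $M$-resonant for a common perfect matching $M$; a maximum resonant set is one of largest size, and the Clar number $Cl(G)$ is the size of a maximum resonant set of $G$. A cycle $C$ of $G$ is nice if $G$ has a perfect matching $M$ for which $C$ is $M$-alternating. $I[C]$ is the subgraph of $G$ consisting of $C$ together with its interior (a plane graph whose finite faces are the faces of $G$ inside $C$). $I[C]-K$ is obtained by deleting all vertices on boundaries of faces in $K$ (the empty graph has exactly one perfect matching). A forcing set of a perfect matching $M$ is a subset $S\subseteq M$ contained in no other perfect matching; the forcing number $f(G,M)$ is the minimum size of a forcing set of $M$, and the maximum forcing number is $F(G)=\max_M f(G,M)$ over all perfect matchings $M$ of $G$. -}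

module Defs where

open import Data.Nat using (ℕ; zero; suc; _+_; _*_; _≤_; _<_; _≤ᵇ_)
open import Data.Fin using (Fin; toℕ)
open import Data.Bool using (Bool; true; false; not; _∧_; if_then_else_)
open import Data.List using (List; length; lookup; allFin; map)
open import Data.Nat.ListAction using (sum)
open import Data.Product using (Σ; ∃; _×_; _,_)
open import Data.Sum using (_⊎_)
open import Data.Unit using (⊤)
open import Relation.Nullary using (¬_)
open import Relation.Binary.PropositionalEquality using (_≡_; _≢_)

iter : {A : Set} → (A → A) → ℕ → A → A
iter f zero    a = a
iter f (suc k) a = f (iter f k a)

allBelow : ℕ → (ℕ → Bool) → Bool
allBelow zero    p = true
allBelow (suc m) p = allBelow m p ∧ p m

countFin : (d : ℕ) → (Fin d → Bool) → ℕ
countFin d b = sum (map (λ x → if b x then 1 else 0) (allFin d))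

-- number of orbits of a permutation φ of Fin d: count the darts that are
-- the (toℕ-)least element of their orbit {φ^k x | k < d}
orbitCount : (d : ℕ) → (Fin d → Fin d) → ℕ
orbitCount d φ =
  countFin d (λ x → allBelow d (λ k → toℕ x ≤ᵇ toℕ (iter φ k x)))

data Walk {n d : ℕ} (tl : Fin d → Fin n) (rv : Fin d → Fin d)
          : Fin n → Fin n → Set where
  here : ∀ {u} → Walk tl rv u u
  step : ∀ x {v} → Walk tl rv (tl (rv x)) v → Walk tl rv (tl x) v

-- Connected simple plane graphs with at least one edge, as genus-0
-- rotation systems (combinatorial maps) with a designated outer face.
-- Darts: Fin d; each edge = two darts x, rev x; tail x is the vertex x
-- leaves; next x is the next dart around tail x in the rotation.
-- Faces = orbits of φ = next ∘ rev.  The outer face is the orbit of 'outer'.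

record PlaneGraph : Set where
  field
    n d       : ℕ
    tail      : Fin d → Fin n
    rev       : Fin d → Fin d
    next      : Fin d → Fin d
    outer     : Fin d
    rev-invol : ∀ x → rev (rev x) ≡ x
    no-loop   : ∀ x → tail (rev x) ≢ tail x
    simple    : ∀ x y → tail x ≡ tail y → tail (rev x) ≡ tail (rev y) → x ≡ y
    next-inj  : ∀ x y → next x ≡ next y → x ≡ y
    next-tail : ∀ x → tail (next x) ≡ tail x
    next-cyc  : ∀ x y → tail x ≡ tail y → ∃ λ k → iter next k x ≡ y
    connected : ∀ u v → Walk tail rev u v
    -- Euler: n - e + f = 2 with e = d/2 edges and f faces (genus 0)
    euler     : 2 * n + 2 * orbitCount d (λ x → next (rev x)) ≡ d + 4

module _ (G : PlaneGraph) where
  open PlaneGraph G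

  φ : Fin d → Fin d
  φ x = next (rev x)

  SameFace : Fin d → Fin d → Set
  SameFace x y = ∃ λ k → iter φ k x ≡ y

  OnFace : Fin n → Fin d → Set
  OnFace v x = ∃ λ k → tail (iter φ k x) ≡ v

  Bipartite : Set
  Bipartite = Σ (Fin n → Bool) λ col → ∀ x → col (tail (rev x)) ≡ not (col (tail x))

  -- a subgraph: vertex set and (rev-closed) dart set
  record Subgraph : Set₁ where
    field
      inV : Fin n → Set
      inE : Fin d → Set

  open Subgraph public

  IsPM : Subgraph → (Fin d → Bool) → Set
  IsPM H M =
    (∀ x → M x ≡ true → inE H x) ×
    (∀ x → M (rev x) ≡ M x) ×
    (∀ v → inV H v → ∃ λ x → tail x ≡ v × M x ≡ true ×
                              (∀ y → tail y ≡ v → M y ≡ true → y ≡ x)) ×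
    (∀ v → ¬ inV H v → ∀ x → tail x ≡ v → M x ≡ false)

  UniquePM : Subgraph → Set
  UniquePM H = ∃ λ M → IsPM H M × (∀ M' → IsPM H M' → ∀ x → M' x ≡ M x)

  Whole : Subgraph
  Whole = record { inV = λ _ → ⊤ ; inE = λ _ → ⊤ }

  HasPM : Set
  HasPM = ∃ λ M → IsPM Whole M

  -- the face of x is M-resonant: its boundary is a cycle (no repeated
  -- vertex) whose edges alternate in/out of M
  Resonant : Fin d → (Fin d → Bool) → Set
  Resonant x M =
    (∀ i j → tail (iter φ i x) ≡ tail (iter φ j x) → iter φ i x ≡ iter φ j x) ×
    (∀ k → M (iter φ (suc k) x) ≡ not (M (iter φ k x)))

  -- K (list of faces, given by darts) is a resonant set of H, whose finite
  -- faces are the faces of darts satisfying inF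
  ResonantSet : Subgraph → (Fin d → Set) → List (Fin d) → Set
  ResonantSet H inF K =
    (∀ i → inF (lookup K i)) ×
    (∀ i j → i ≢ j → ∀ v → OnFace v (lookup K i) → ¬ OnFace v (lookup K j)) ×
    (∃ λ M → IsPM H M × (∀ i → Resonant (lookup K i) M))

  MaxResonant : Subgraph → (Fin d → Set) → List (Fin d) → Set
  MaxResonant H inF K =
    ResonantSet H inF K × (∀ K' → ResonantSet H inF K' → length K' ≤ length K)

  FinFace : Fin d → Set
  FinFace x = ¬ SameFace outer x

  IsClar : ℕ → Set
  IsClar c = ∃ λ K → MaxResonant Whole FinFace K × length K ≡ c

  Forcing : (Fin d → Bool) → List (Fin d) → Set
  Forcing M S =
    (∀ i → M (lookup S i) ≡ true) ×
    (∀ M' → IsPM Whole M' → (∀ i → M' (lookup S i) ≡ true) → ∀ x → M' x ≡ M x)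

  IsForcingNum : (Fin d → Bool) → ℕ → Set
  IsForcingNum M k =
    (∃ λ S → Forcing M S × length S ≡ k) × (∀ S → Forcing M S → k ≤ length S)

  IsMaxForcing : ℕ → Set
  IsMaxForcing k =
    (∃ λ M → IsPM Whole M × IsForcingNum M k) ×
    (∀ M j → IsPM Whole M → IsForcingNum M j → j ≤ k)

  record Cycle : Set where
    field
      len      : ℕ
      dart     : ℕ → Fin d
      len≥3    : 3 ≤ len
      periodic : ∀ i → dart (i + len) ≡ dart i
      consec   : ∀ i → tail (dart (suc i)) ≡ tail (rev (dart i))
      distinct : ∀ i j → i < len → j < len → tail (dart i) ≡ tail (dart j) → i ≡ j

  open Cycle public

  OnCycle : Cycle → Fin d → Set
  OnCycle C x = ∃ λ i → (x ≡ dart C i) ⊎ (rev x ≡ dart C i)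

  Alternating : Cycle → (Fin d → Bool) → Set
  Alternating C M = ∀ i → M (dart C (suc i)) ≡ not (M (dart C i))

  Nice : Cycle → Set
  Nice C = ∃ λ M → IsPM Whole M × Alternating C M

  -- darts whose face is outside C: reachable from the outer face in the
  -- dual graph without crossing an edge of C
  data Outside (C : Cycle) : Fin d → Set where
    out-base  : Outside C outer
    out-face  : ∀ {x} → Outside C x → Outside C (φ x)
    out-cross : ∀ {x} → Outside C x → ¬ OnCycle C x → Outside C (rev x)

  Inside : Cycle → Fin d → Set
  Inside C x = ¬ Outside C x

  IC : Cycle → Subgraph
  IC C = record
    { inV = λ v → ∃ λ x → tail x ≡ v × (Inside C x ⊎ Inside C (rev x))
    ; inE = λ x → Inside C x ⊎ Inside C (rev x) }

  Minus : Subgraph → List (Fin d) → Subgraph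
  Minus H K = record
    { inV = V'
    ; inE = λ x → inE H x × V' (tail x) × V' (tail (rev x)) }
    where
      V' : Fin n → Set
      V' v = inV H v × (∀ i → ¬ OnFace v (lookup K i))

{-# OPTIONS --safe #-}
module Submission where

-- Cl(G) ≤ F(G): the faces of a resonant set are disjoint M-alternating cycles,
-- and a forcing set of M meets each of them, since otherwise M can be flipped
-- along it.
--
-- F(G) ≤ Cl(G): orient the edges so that M-alternating cycles are the directed
-- cycles. On the sphere every circulation is the coboundary of a function on the
-- faces (a spanning tree and the complementary cotree together with Euler's
-- formula), so directed cycles become dicuts of the dual digraph, forcing sets
-- become dijoins, and the Lucchesi–Younger theorem (Lovász's uncrossing proof)
-- yields a forcing set of M and equally many disjoint M-alternating cycles. Each
-- of these cycles can be exchanged for a resonant face: if C is innermost among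
-- those not yet exchanged and K consists of the faces already obtained inside C,
-- then I[C] - K has two perfect matchings, M and M flipped along C, so by
-- hypothesis K is not a maximum resonant set of I[C], and a larger one replaces
-- K and C.
--
-- Existence statements about non-decidable data are proved doubly negated; the
-- witnesses of the theorem come from finite searches.

open import Defs
open import Data.Bool using (Bool; true; false; not; _∧_; _∨_; if_then_else_; _xor_)
import Data.Bool.Properties as Boolₚ
open import Data.Empty using (⊥; ⊥-elim)
open import Data.Fin using (Fin; zero; suc; toℕ; fromℕ<; splitAt; _≟_)
import Data.Fin.Properties as Finₚ
open import Data.Fin.Permutation using (Permutation′; permutation)
open import Data.Integer as ℤ using (ℤ; 0ℤ; 1ℤ)
import Data.Integer.Properties as ℤₚ
import Data.Integer.Tactic.RingSolver as ℤRing
open import Data.List using (List; []; _∷_; length; lookup; allFin; map; filter; _++_; tabulate)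
import Data.List.Properties as Listₚ
open import Data.List.Membership.Propositional using (_∈_)
import Data.List.Membership.Propositional.Properties as ∈ₚ
open import Data.List.Relation.Unary.All as All using (All; []; _∷_)
import Data.List.Relation.Unary.All.Properties as Allₚ
open import Data.List.Relation.Unary.AllPairs using (AllPairs; []; _∷_)
import Data.List.Relation.Unary.AllPairs.Properties as AllPairsₚ
open import Data.List.Relation.Unary.Any using (here; there)
open import Data.List.Relation.Binary.Permutation.Propositional as ↭ using (_↭_)
import Data.List.Relation.Binary.Permutation.Propositional.Properties as ↭ₚ
import Data.Nat.ListAction as ListAction
open import Data.Nat using (ℕ; zero; suc; _+_; _*_; _∸_; _≤_; _<_; z≤n; s≤s; ⌊_/2⌋; ⌈_/2⌉; _≤ᵇ_; _/_; _%_; pred; NonZero; >-nonZero)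
open import Data.Nat.DivMod using (m%n<n; m≡m%n+[m/n]*n; %-distribˡ-+)
import Data.Nat.Properties as ℕₚ
import Data.Nat.Tactic.RingSolver as ℕRing
open import Data.Product using (∃; ∃₂; _×_; _,_; proj₁; proj₂)
open import Data.Sum using (_⊎_; inj₁; inj₂; [_,_]′)
import Data.Sum
open import Data.Unit using (tt)
import Data.Vec.Functional as Vector
open import Function using (_∘_; id; const)
open import Relation.Binary.PropositionalEquality using (_≡_; _≢_; _≗_; refl; sym; trans; cong; cong₂; subst; module ≡-Reasoning)
open import Relation.Binary.Definitions using (tri<; tri≈; tri>)
open import Relation.Nullary using (¬_; Dec; yes; no; does; contradiction)
open import Relation.Nullary.Decidable using (map′; _×-dec_; _⊎-dec_; _→-dec_; ¬?; dec-true; dec-false; decidable-stable; ¬¬-excluded-middle)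
import Algebra.Properties.Semiring.Sum as SemiringSum

-- Exchanging a cycle C rewrites the matching inside I[C], which could spoil the cycles still
-- waiting. Hence the choice of an innermost one: by disjointness the other cycles then avoid I[C]
-- altogether and stay alternating. Inside and outside are defined by reachability in the dual, and
-- no Jordan curve theorem is available for them. Genus 0 enters only through Euler's formula, in
-- the proof that circulations are coboundaries. That C separates its two sides is derived from
-- this: the difference of M and its flip along C is a circulation, and its potential would be
-- constant if both sides could be reached from the outer face. Lucchesi-Younger yields dicuts
-- without common arcs, while the cycles must have no common vertices. Bipartiteness and M bridge
-- the gap: every directed cycle through a vertex v uses the matching edge at v, always in the same
-- direction. Faces are never formed as objects. A function on the faces is a function on the darts
-- that is invariant under `ϕ`, and the dual digraph has the darts as its vertices.

module ∑ℕ = SemiringSum ℕₚ.+-*-semiring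
module ∑ℤ = SemiringSum ℤₚ.+-*-semiring

variable
  k m N : ℕ

Sub : ℕ → Set
Sub N = Fin N → Bool

true≢false : true ≢ false
true≢false ()

≢true⇒≡false : ∀ {b} → b ≢ true → b ≡ false
≢true⇒≡false = Boolₚ.¬-not

does⇒ : ∀ {A : Set} (a? : Dec A) → does a? ≡ true → A
does⇒ (yes a) _ = a

does⇏ : ∀ {A : Set} (a? : Dec A) → does a? ≡ false → ¬ A
does⇏ (no ¬a) _ = ¬a

∧-true : ∀ {b c} → b ∧ c ≡ true → b ≡ true × c ≡ true
∧-true {true} {true} _ = refl , refl

¬¬-∀Fin : {P : Fin k → Set} → (∀ i → ¬ ¬ P i) → ¬ ¬ (∀ i → P i)
¬¬-∀Fin {zero}  _   ¬∀ = ¬∀ λ ()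
¬¬-∀Fin {suc k} ¬¬P ¬∀ =
  ¬¬P zero λ p → ¬¬-∀Fin (¬¬P ∘ suc) λ ps → ¬∀ λ { zero → p ; (suc i) → ps i }

-- Finite sums and counting

𝟙 : Bool → ℕ
𝟙 true  = 1
𝟙 false = 0

count : Sub k → ℕ
count p = ∑ℕ.sum (𝟙 ∘ p)

𝟙-mono : ∀ {b c} → (b ≡ true → c ≡ true) → 𝟙 b ≤ 𝟙 c
𝟙-mono {false}        _   = z≤n
𝟙-mono {true} {true}  _   = s≤s z≤n
𝟙-mono {true} {false} b⇒c = contradiction (sym (b⇒c refl)) true≢false

sum-mono : {f g : Fin k → ℕ} → (∀ i → f i ≤ g i) → ∑ℕ.sum f ≤ ∑ℕ.sum g
sum-mono {zero}  f≤g = z≤n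
sum-mono {suc k} f≤g = ℕₚ.+-mono-≤ (f≤g zero) (sum-mono (f≤g ∘ suc))

sum-mono-< : {f g : Fin k → ℕ} → (∀ i → f i ≤ g i) → ∀ i → f i < g i → ∑ℕ.sum f < ∑ℕ.sum g
sum-mono-< f≤g zero    f<g = ℕₚ.+-mono-<-≤ f<g (sum-mono (f≤g ∘ suc))
sum-mono-< f≤g (suc i) f<g = ℕₚ.+-mono-≤-< (f≤g zero) (sum-mono-< (f≤g ∘ suc) i f<g)

sum-const : ∀ k c → ∑ℕ.sum {k} (const c) ≡ k * c
sum-const zero    c = refl
sum-const (suc k) c = cong (c +_) (sum-const k c)

term≤sum : (f : Fin k → ℕ) → ∀ i → f i ≤ ∑ℕ.sum f
term≤sum f zero    = ℕₚ.m≤m+n _ _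
term≤sum f (suc i) = ℕₚ.m≤n⇒m≤o+n (f zero) (term≤sum (f ∘ suc) i)

two-terms≤sum : (f : Fin k → ℕ) → ∀ {i j} → i ≢ j → f i + f j ≤ ∑ℕ.sum f
two-terms≤sum f {zero}  {zero}  i≢j = contradiction refl i≢j
two-terms≤sum f {zero}  {suc j} _   = ℕₚ.+-monoʳ-≤ (f zero) (term≤sum (f ∘ suc) j)
two-terms≤sum f {suc i} {zero}  _   =
  subst (_≤ ∑ℕ.sum f) (ℕₚ.+-comm (f zero) _) (ℕₚ.+-monoʳ-≤ (f zero) (term≤sum (f ∘ suc) i))
two-terms≤sum f {suc i} {suc j} i≢j =
  ℕₚ.m≤n⇒m≤o+n (f zero) (two-terms≤sum (f ∘ suc) (i≢j ∘ cong suc))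

sum-++ : (f : Fin k → ℕ) (g : Fin m → ℕ) → ∑ℕ.sum (f Vector.++ g) ≡ ∑ℕ.sum f + ∑ℕ.sum g
sum-++ {zero}  f g = refl
sum-++ {suc k} f g = begin
  f zero + ∑ℕ.sum ((f Vector.++ g) ∘ suc)      ≡⟨ cong (f zero +_) (∑ℕ.sum-cong-≗ (λ i → shift (splitAt k i))) ⟩
  f zero + ∑ℕ.sum ((f ∘ suc) Vector.++ g)      ≡⟨ cong (f zero +_) (sum-++ (f ∘ suc) g) ⟩
  f zero + (∑ℕ.sum (f ∘ suc) + ∑ℕ.sum g)       ≡⟨ ℕₚ.+-assoc (f zero) _ _ ⟨
  f zero + ∑ℕ.sum (f ∘ suc) + ∑ℕ.sum g         ∎
  where
  open ≡-Reasoning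
  shift : ∀ s → [ f , g ]′ (Data.Sum.map suc id s) ≡ [ f ∘ suc , g ]′ s
  shift (inj₁ _) = refl
  shift (inj₂ _) = refl

++-elim : {A : Set} {P : A → Set} (f : Fin k → A) (g : Fin m → A) →
          (∀ i → P (f i)) → (∀ i → P (g i)) → ∀ i → P ((f Vector.++ g) i)
++-elim {k} f g pf pg i with splitAt k i
... | inj₁ j = pf j
... | inj₂ j = pg j

map-++ : {A B : Set} (h : A → B) (f : Fin k → A) (g : Fin m → A) →
         h ∘ (f Vector.++ g) ≗ (h ∘ f) Vector.++ (h ∘ g)
map-++ {k} h f g i with splitAt k i
... | inj₁ _ = refl
... | inj₂ _ = refl

sum-updateAt : {A : Set} (g : A → ℕ) (F : Fin k → A) (i : Fin k) (a : A) →
               ∑ℕ.sum (g ∘ Vector.updateAt F i (const a)) + g (F i) ≡ ∑ℕ.sum (g ∘ F) + g a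
sum-updateAt g F zero a =
  swap (g a) (∑ℕ.sum (g ∘ F ∘ suc)) (g (F zero))
  where
  swap : ∀ x y z → x + y + z ≡ z + y + x
  swap = ℕRing.solve-∀
sum-updateAt g F (suc i) a = begin
  g (F zero) + ∑ℕ.sum (g ∘ Vector.updateAt (F ∘ suc) i (const a)) + g (F (suc i))
    ≡⟨ ℕₚ.+-assoc (g (F zero)) _ _ ⟩
  g (F zero) + (∑ℕ.sum (g ∘ Vector.updateAt (F ∘ suc) i (const a)) + g (F (suc i)))
    ≡⟨ cong (g (F zero) +_) (sum-updateAt g (F ∘ suc) i a) ⟩
  g (F zero) + (∑ℕ.sum (g ∘ F ∘ suc) + g a)
    ≡⟨ ℕₚ.+-assoc (g (F zero)) _ _ ⟨
  g (F zero) + ∑ℕ.sum (g ∘ F ∘ suc) + g a ∎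
  where open ≡-Reasoning

updateAt-elim : {A : Set} {P : A → Set} (F : Fin k → A) (i : Fin k) {a : A} →
                P a → (∀ j → P (F j)) → ∀ j → P (Vector.updateAt F i (const a) j)
updateAt-elim F zero    pa pF zero    = pa
updateAt-elim F zero    pa pF (suc j) = pF (suc j)
updateAt-elim F (suc i) pa pF zero    = pF zero
updateAt-elim {P = P} F (suc i) pa pF (suc j) = updateAt-elim {P = P} (F ∘ suc) i pa (pF ∘ suc) j

updateAt-other : {A : Set} (F : Fin k → A) {i j : Fin k} {a : A} → i ≢ j →
                 Vector.updateAt F i (const a) j ≡ F j
updateAt-other F {zero}  {zero}  i≢j = contradiction refl i≢j
updateAt-other F {zero}  {suc j} _   = refl
updateAt-other F {suc i} {zero}  _   = refl
updateAt-other F {suc i} {suc j} i≢j = updateAt-other (F ∘ suc) (i≢j ∘ cong suc)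

count-mono : {p q : Sub k} → (∀ i → p i ≡ true → q i ≡ true) → count p ≤ count q
count-mono p⇒q = sum-mono (λ i → 𝟙-mono (p⇒q i))

count-mono-< : {p q : Sub k} → (∀ i → p i ≡ true → q i ≡ true) →
               ∀ i → p i ≡ false → q i ≡ true → count p < count q
count-mono-< p⇒q i ¬pi qi =
  sum-mono-< (λ j → 𝟙-mono (p⇒q j)) i
    (subst (_< _) (cong 𝟙 (sym ¬pi)) (subst (0 <_) (cong 𝟙 (sym qi)) (s≤s z≤n)))

count-true : ∀ k → count {k} (const true) ≡ k
count-true k = trans (sum-const k 1) (ℕₚ.*-identityʳ k)

count≤k : (p : Sub k) → count p ≤ k
count≤k {k} p = subst (count p ≤_) (count-true k) (count-mono {p = p} {const true} (λ _ _ → refl))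

count-split : (p q : Sub k) → count p ≡ count (λ i → p i ∧ q i) + count (λ i → p i ∧ not (q i))
count-split p q = trans (∑ℕ.sum-cong-≗ (λ i → split (p i) (q i))) (∑ℕ.∑-distrib-+ (λ i → 𝟙 (p i ∧ q i)) (λ i → 𝟙 (p i ∧ not (q i))))
  where
  split : ∀ b c → 𝟙 b ≡ 𝟙 (b ∧ c) + 𝟙 (b ∧ not c)
  split true  true  = refl
  split true  false = refl
  split false _     = refl

count-positive : {p : Sub k} → ∀ i → p i ≡ true → 1 ≤ count p
count-positive {p = p} i pi = ℕₚ.≤-trans (ℕₚ.≤-reflexive (cong 𝟙 (sym pi))) (term≤sum (𝟙 ∘ p) i)

select : {A : Set} (p : Sub k) (F : Fin k → A) → Fin (count p) → A
select {suc k} p F i with p zero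
select {suc k} p F zero    | true  = F zero
select {suc k} p F (suc i) | true  = select (p ∘ suc) (F ∘ suc) i
select {suc k} p F i       | false = select (p ∘ suc) (F ∘ suc) i

select-elim : {A : Set} {P : A → Set} (p : Sub k) (F : Fin k → A) →
              (∀ i → P (F i)) → ∀ i → P (select p F i)
select-elim {suc k} p F pF i with p zero
select-elim {suc k} p F pF zero    | true  = pF zero
select-elim {suc k} {P = P} p F pF (suc i) | true  = select-elim {P = P} (p ∘ suc) (F ∘ suc) (pF ∘ suc) i
select-elim {suc k} {P = P} p F pF i       | false = select-elim {P = P} (p ∘ suc) (F ∘ suc) (pF ∘ suc) i

count-select : {A : Set} (q : A → Bool) (p : Sub k) (F : Fin k → A) →
               count (q ∘ select p F) ≡ count (λ i → p i ∧ q (F i))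
count-select {zero}  q p F = refl
count-select {suc k} q p F with p zero
... | true  = cong (𝟙 (q (F zero)) +_) (count-select q (p ∘ suc) (F ∘ suc))
... | false = count-select q (p ∘ suc) (F ∘ suc)

count-none : {p : Sub k} → (∀ i → p i ≡ false) → count p ≡ 0
count-none {k} ¬p = trans (∑ℕ.sum-cong-≗ (cong 𝟙 ∘ ¬p)) (∑ℕ.sum-replicate-zero k)

count≤1 : {p : Sub k} → (∀ i j → p i ≡ true → p j ≡ true → i ≡ j) → count p ≤ 1
count≤1 {zero}          _  = z≤n
count≤1 {suc k} {p = p} p! with p zero in p₀
... | false = count≤1 (λ i j pi pj → Finₚ.suc-injective (p! (suc i) (suc j) pi pj))
... | true  = s≤s (ℕₚ.≤-reflexive (count-none λ i → ≢true⇒≡false λ pi → Finₚ.0≢1+n (p! zero (suc i) p₀ pi)))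

-- Double counting of the pairs (i , f i).
count≤-injective : {p : Sub k} (f : Fin k → ℕ) →
                   (∀ i j → p i ≡ true → p j ≡ true → f i ≡ f j → i ≡ j) →
                   (∀ i → p i ≡ true → f i < m) → count p ≤ m
count≤-injective {k} {m} {p} f f-inj f<m = begin
  count p                             ≤⟨ sum-mono row ⟩
  ∑ℕ.sum (λ i → count (hits i))       ≡⟨ ∑ℕ.∑-comm (λ i y → 𝟙 (hits i y)) ⟩
  ∑ℕ.sum (λ y → count (λ i → hits i y)) ≤⟨ sum-mono (λ y → count≤1 (column y)) ⟩
  ∑ℕ.sum {m} (const 1)                ≡⟨ count-true m ⟩
  m                                   ∎
  where
  open ℕₚ.≤-Reasoning
  hits : Fin k → Sub m
  hits i y = p i ∧ does (toℕ y ℕₚ.≟ f i)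
  row : ∀ i → 𝟙 (p i) ≤ count (hits i)
  row i with p i in pi
  ... | false = z≤n
  ... | true  = count-positive (fromℕ< (f<m i pi)) (dec-true (_ ℕₚ.≟ _) (Finₚ.toℕ-fromℕ< (f<m i pi)))
  column : ∀ y i j → hits i y ≡ true → hits j y ≡ true → i ≡ j
  column y i j hi hj =
    let pi , yi = ∧-true hi ; pj , yj = ∧-true hj
    in f-inj i j pi pj (trans (sym (does⇒ (toℕ y ℕₚ.≟ f i) yi)) (does⇒ (toℕ y ℕₚ.≟ f j) yj))

-- The Lucchesi–Younger theorem

infixr 7 _∩_
infixr 6 _∪_

_∩_ _∪_ : Sub N → Sub N → Sub N
(U ∩ W) x = U x ∧ W x
(U ∪ W) x = U x ∨ W x

_⊆_ Disjoint Covering NonCrossing : Sub N → Sub N → Set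
U ⊆ W = ∀ x → U x ≡ true → W x ≡ true
Disjoint U W = ∀ x → U x ≡ true → W x ≡ false
Covering U W = ∀ x → U x ≡ false → W x ≡ true
NonCrossing U W = U ⊆ W ⊎ W ⊆ U ⊎ Disjoint U W ⊎ Covering U W

implies? : ∀ {a b c d : Bool} → Dec (a ≡ b → c ≡ d)
implies? {a} {b} {c} {d} = (a Boolₚ.≟ b) →-dec (c Boolₚ.≟ d)

_⊆?_ : (U W : Sub N) → Dec (U ⊆ W)
U ⊆? W = Finₚ.all? λ x → implies?

covering? : (U W : Sub N) → Dec (Covering U W)
covering? U W = Finₚ.all? λ x → implies?

nonCrossing? : (U W : Sub N) → Dec (NonCrossing U W)
nonCrossing? U W =
  (U ⊆? W) ⊎-dec (W ⊆? U) ⊎-dec (Finₚ.all? λ x → implies?) ⊎-dec covering? U W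

¬implies : ∀ {a b c d : Bool} → ¬ (a ≡ b → c ≡ d) → a ≡ b × c ≢ d
¬implies {a} {b} ¬i =
  decidable-stable (a Boolₚ.≟ b) (λ a≢b → ¬i (λ a≡b → contradiction a≡b a≢b)) , λ c≡d → ¬i (const c≡d)

counterexample : {U W : Sub N} {b c : Bool} → ¬ (∀ x → U x ≡ b → W x ≡ c) → ∃ λ x → U x ≡ b × W x ≢ c
counterexample {N} {U} {W} {b} {c} ¬∀ =
  let x , ¬i = Finₚ.¬∀⟶∃¬ N _ (λ x → implies?) ¬∀ in x , ¬implies {U x} ¬i

Nontrivial : Sub N → Set
Nontrivial U = (∃ λ x → U x ≡ true) × (∃ λ x → U x ≡ false)

square : ℕ → ℕ
square n = n * n

-- The two sides differ by exactly 2bc. With a, b, c the sizes of the intersection and of the two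
-- differences of a crossing pair, this is the gain made by one uncrossing step.
square-spread : ∀ a b c → 1 ≤ b → 1 ≤ c →
                square (a + b) + square (a + c) < square a + square (a + b + c)
square-spread a b c 1≤b 1≤c =
  ℕₚ.≤-trans (ℕₚ.m<m+n _ (ℕₚ.*-mono-≤ 1≤b (ℕₚ.≤-trans 1≤c (ℕₚ.m≤m+n c c))))
             (ℕₚ.≤-reflexive (identity a b c))
  where
  identity : ∀ a b c → (a + b) * (a + b) + (a + c) * (a + c) + b * (c + c)
                     ≡ a * a + (a + b + c) * (a + b + c)
  identity = ℕRing.solve-∀

count-∪ : (U W : Sub N) →
          count (U ∪ W) ≡ count (U ∩ W) + count (λ z → U z ∧ not (W z)) + count (λ z → W z ∧ not (U z))
count-∪ U W =
  trans (∑ℕ.sum-cong-≗ (λ z → bits (U z) (W z)))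
    (trans (∑ℕ.∑-distrib-+ (λ z → 𝟙 (U z ∧ W z) + 𝟙 (U z ∧ not (W z))) (λ z → 𝟙 (W z ∧ not (U z))))
      (cong (_+ count (λ z → W z ∧ not (U z)))
        (∑ℕ.∑-distrib-+ (λ z → 𝟙 (U z ∧ W z)) (λ z → 𝟙 (U z ∧ not (W z))))))
  where
  bits : ∀ u w → 𝟙 (u ∨ w) ≡ 𝟙 (u ∧ w) + 𝟙 (u ∧ not w) + 𝟙 (w ∧ not u)
  bits true  true  = refl
  bits true  false = refl
  bits false true  = refl
  bits false false = refl

∩-∪-squares : {U W : Sub N} → (∃ λ x → U x ≡ true × W x ≡ false) → (∃ λ x → W x ≡ true × U x ≡ false) →
              square (count U) + square (count W) < square (count (U ∩ W)) + square (count (U ∪ W))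
∩-∪-squares {U = U} {W} (x , Ux , ¬Wx) (y , Wy , ¬Uy)
  rewrite count-∪ U W
        | count-split U W
        | trans (count-split W U)
            (cong (_+ count (λ z → W z ∧ not (U z))) (∑ℕ.sum-cong-≗ (λ z → cong 𝟙 (Boolₚ.∧-comm (W z) (U z)))))
  = square-spread (count (U ∩ W)) (count (λ z → U z ∧ not (W z))) (count (λ z → W z ∧ not (U z)))
      (count-positive x (cong₂ (λ b c → b ∧ not c) Ux ¬Wx))
      (count-positive y (cong₂ (λ b c → b ∧ not c) Wy ¬Uy))

sum-updateAt₂ : {A : Set} (g : A → ℕ) (F : Fin k → A) {i j : Fin k} (a b : A) → i ≢ j →
  ∑ℕ.sum (g ∘ Vector.updateAt (Vector.updateAt F i (const a)) j (const b)) + (g (F i) + g (F j))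
    ≡ ∑ℕ.sum (g ∘ F) + (g a + g b)
sum-updateAt₂ g F {i} {j} a b i≢j = begin
  S₂ + (g (F i) + g (F j))              ≡⟨ rotate S₂ (g (F i)) (g (F j)) ⟩
  S₂ + g (F j) + g (F i)                ≡⟨ cong (λ z → S₂ + g z + g (F i)) (updateAt-other F i≢j) ⟨
  S₂ + g (F₁ j) + g (F i)               ≡⟨ cong (_+ g (F i)) (sum-updateAt g F₁ j b) ⟩
  ∑ℕ.sum (g ∘ F₁) + g b + g (F i)       ≡⟨ rotate′ (∑ℕ.sum (g ∘ F₁)) (g b) (g (F i)) ⟩
  ∑ℕ.sum (g ∘ F₁) + g (F i) + g b       ≡⟨ cong (_+ g b) (sum-updateAt g F i a) ⟩
  ∑ℕ.sum (g ∘ F) + g a + g b            ≡⟨ ℕₚ.+-assoc (∑ℕ.sum (g ∘ F)) (g a) (g b) ⟩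
  ∑ℕ.sum (g ∘ F) + (g a + g b)          ∎
  where
  open ≡-Reasoning
  F₁ = Vector.updateAt F i (const a)
  S₂ = ∑ℕ.sum (g ∘ Vector.updateAt F₁ j (const b))
  rotate : ∀ x y z → x + (y + z) ≡ x + z + y
  rotate = ℕRing.solve-∀
  rotate′ : ∀ x y z → x + y + z ≡ x + z + y
  rotate′ = ℕRing.solve-∀

parity : ℕ → Bool
parity zero    = false
parity (suc n) = not (parity n)

parity-cancelˡ : ∀ h {r r'} → parity (h + r) ≡ parity (h + r') → parity r ≡ parity r'
parity-cancelˡ zero    eq = eq
parity-cancelˡ (suc h) eq = parity-cancelˡ h (Boolₚ.not-injective eq)

parity-half-injective : ∀ r r' → parity r ≡ parity r' → ⌊ r /2⌋ ≡ ⌊ r' /2⌋ → r ≡ r'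
parity-half-injective zero          zero           _  _  = refl
parity-half-injective zero          (suc (suc _))  _  ()
parity-half-injective (suc zero)    (suc zero)     _  _  = refl
parity-half-injective (suc zero)    (suc (suc _))  _  ()
parity-half-injective (suc (suc _)) zero           _  ()
parity-half-injective (suc (suc _)) (suc zero)     _  ()
parity-half-injective (suc (suc r)) (suc (suc r')) pe he =
  cong (2 +_) (parity-half-injective r r'
    (Boolₚ.not-injective (Boolₚ.not-injective pe)) (ℕₚ.suc-injective he))

-- A discrete intermediate value principle. It is applied to the existence of packings, which is not
-- decided, hence the double negation.
last-before-jump : (P : ℕ → Set) → ∀ b → ¬ P b → P 0 → ¬ ¬ ∃ λ j → j < b × P j × ¬ P (suc j)
last-before-jump P zero    ¬Pb P0 _ = ¬Pb P0
last-before-jump P (suc b) ¬Pb P0 ¬jump =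
  ¬¬-excluded-middle {A = P b} λ where
    (yes Pb) → ¬jump (b , ℕₚ.n<1+n b , Pb , ¬Pb)
    (no ¬Pb′) → last-before-jump P b ¬Pb′ P0 λ (j , j<b , jump) → ¬jump (j , ℕₚ.m<n⇒m<1+n j<b , jump)

-- Only a lattice of sets that no arc leaves is needed, not all such sets. This allows the vertices
-- to be darts and the closed sets to be unions of faces. `crossed` expresses connectedness and
-- bounds the size of packings.
module LucchesiYounger
  {N m : ℕ} (src tgt : Fin m → Fin N) (Closed : Sub N → Set)
  (∩-closed : ∀ {U W} → Closed U → Closed W → Closed (U ∩ W))
  (∪-closed : ∀ {U W} → Closed U → Closed W → Closed (U ∪ W))
  (no-exit : ∀ {U} → Closed U → ∀ a → U (src a) ≡ true → U (tgt a) ≡ true)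
  (crossed : ∀ {U} → Closed U → Nontrivial U → ∃ λ a → U (tgt a) ∧ not (U (src a)) ≡ true)
  where

  enters : Fin m → Sub N → Bool
  enters a U = U (tgt a) ∧ not (U (src a))

  enters⇒ : ∀ a U → enters a U ≡ true → U (src a) ≡ false × U (tgt a) ≡ true
  enters⇒ a U e with U (tgt a) | U (src a)
  enters⇒ a U e | true | false = refl , refl

  -- For arbitrary sets the entering degree is only submodular. Equality holds here because an arc
  -- between the two differences of `U` and `W` would leave one of these sets. So uncrossing does
  -- not change the load of any arc.
  enters-modular : ∀ {U W} → Closed U → Closed W → ∀ a →
    𝟙 (enters a (U ∩ W)) + 𝟙 (enters a (U ∪ W)) ≡ 𝟙 (enters a U) + 𝟙 (enters a W)
  enters-modular {U} {W} cU cW a =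
    bits (U (src a)) (U (tgt a)) (W (src a)) (W (tgt a)) (no-exit cU a) (no-exit cW a)
    where
    bits : ∀ s t s' t' → (s ≡ true → t ≡ true) → (s' ≡ true → t' ≡ true) →
           𝟙 ((t ∧ t') ∧ not (s ∧ s')) + 𝟙 ((t ∨ t') ∧ not (s ∨ s')) ≡ 𝟙 (t ∧ not s) + 𝟙 (t' ∧ not s')
    bits true  false _     _     s⇒t _     = contradiction (sym (s⇒t refl)) true≢false
    bits _     _     true  false _   s'⇒t' = contradiction (sym (s'⇒t' refl)) true≢false
    bits true  true  true  true  _   _     = refl
    bits true  true  false true  _   _     = refl
    bits true  true  false false _   _     = refl
    bits false true  true  true  _   _     = refl
    bits false true  false true  _   _     = refl
    bits false true  false false _   _     = refl
    bits false false true  true  _   _     = refl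
    bits false false false true  _   _     = refl
    bits false false false false _   _     = refl

  -- Closed sets of the digraph in which the arcs of Z are contracted.
  ClosedMod : Sub m → Sub N → Set
  ClosedMod Z U = Closed U × (∀ a → Z a ≡ true → enters a U ≡ false)

  ∩-∪-closedMod : ∀ {Z U W} → ClosedMod Z U → ClosedMod Z W → ClosedMod Z (U ∩ W) × ClosedMod Z (U ∪ W)
  ∩-∪-closedMod {Z} {U} {W} (cU , zU) (cW , zW) =
    (∩-closed cU cW , λ a za → 𝟙≡0 (ℕₚ.m+n≡0⇒m≡0 _ (zero-sum a za))) ,
    (∪-closed cU cW , λ a za → 𝟙≡0 (ℕₚ.m+n≡0⇒n≡0 (𝟙 (enters a (U ∩ W))) (zero-sum a za)))
    where
    𝟙≡0 : ∀ {b} → 𝟙 b ≡ 0 → b ≡ false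
    𝟙≡0 {false} _ = refl
    zero-sum : ∀ a → Z a ≡ true → 𝟙 (enters a (U ∩ W)) + 𝟙 (enters a (U ∪ W)) ≡ 0
    zero-sum a za = trans (enters-modular cU cW a) (cong₂ (λ b c → 𝟙 b + 𝟙 c) (zU a za) (zW a za))

  -- The family may repeat a set, which then counts with multiplicity in `load`. Repetitions do
  -- arise, when a packing is appended to itself.
  record Packing (Z : Sub m) (cap : Fin m → ℕ) (k : ℕ) : Set where
    field
      sets       : Fin k → Sub N
      closed     : ∀ i → ClosedMod Z (sets i)
      nontrivial : ∀ i → Nontrivial (sets i)
      load       : ∀ a → count (enters a ∘ sets) ≤ cap a

  open Packing

  -- Only a lower bound on the size is recorded, so that no packing ever has to be truncated.
  Packs : Sub m → (Fin m → ℕ) → ℕ → Set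
  Packs Z cap k = ∃ λ k' → k ≤ k' × Packing Z cap k'

  -- Replacing a crossing pair by its intersection and union strictly increases the sum of the
  -- squared sizes, which never exceeds `k * square N`. The fuel is the distance to this bound.
  uncross : ∀ {Z cap k} → Packing Z cap k → ∃ λ (P : Packing Z cap k) → ∀ i j → NonCrossing (sets P i) (sets P j)
  uncross {Z} {cap} {k} P₀ = go (suc (k * square N)) P₀ (ℕₚ.m≤n+m (suc (k * square N)) (weight P₀))
    where
    weight : Packing Z cap k → ℕ
    weight P = ∑ℕ.sum (λ i → square (count (sets P i)))

    weight-bound : ∀ P → weight P ≤ k * square N
    weight-bound P = ℕₚ.≤-trans
      (sum-mono {g = const (square N)} (λ i → ℕₚ.*-mono-≤ (count≤k (sets P i)) (count≤k (sets P i))))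
      (ℕₚ.≤-reflexive (sum-const k (square N)))

    module Step (P : Packing Z cap k) {i j : Fin k} (crossing : ¬ NonCrossing (sets P i) (sets P j)) where
      U = sets P i
      W = sets P j
      i≢j : i ≢ j
      i≢j refl = crossing (inj₁ λ _ u → u)

      x∈U∖W = counterexample {U = U} {W} {true} {true} (crossing ∘ inj₁)
      x∈W∖U = counterexample {U = W} {U} {true} {true} (crossing ∘ inj₂ ∘ inj₁)
      x∈U∩W = counterexample {U = U} {W} {true} {false} (crossing ∘ inj₂ ∘ inj₂ ∘ inj₁)
      x∉U∪W = counterexample {U = U} {W} {false} {true} (crossing ∘ inj₂ ∘ inj₂ ∘ inj₂)

      F′ : Fin k → Sub N
      F′ = Vector.updateAt (Vector.updateAt (sets P) i (const (U ∩ W))) j (const (U ∪ W))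

      update-all : ∀ {Q : Sub N → Set} → Q (U ∩ W) → Q (U ∪ W) → (∀ l → Q (sets P l)) → ∀ l → Q (F′ l)
      update-all {Q} q∩ q∪ qP = updateAt-elim {P = Q} _ j q∪ (updateAt-elim {P = Q} _ i q∩ qP)

      P′ : Packing Z cap k
      P′ .sets = F′
      P′ .closed =
        let c∩ , c∪ = ∩-∪-closedMod {Z} {U} {W} (closed P i) (closed P j)
        in update-all {ClosedMod Z} c∩ c∪ (closed P)
      -- A crossing pair has a common element and a common non-element. They serve for both the
      -- intersection and the union.
      P′ .nontrivial =
        let x , Ux , Wx = x∈U∩W ; y , ¬Uy , Wy = x∉U∪W in
        update-all {Nontrivial}
          ((x , cong₂ _∧_ Ux (Boolₚ.¬-not Wx)) , (y , cong (_∧ W y) ¬Uy))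
          ((x , cong (_∨ W x) Ux) , (y , cong₂ _∨_ ¬Uy (Boolₚ.¬-not Wy)))
          (nontrivial P)
      P′ .load a = ℕₚ.≤-trans (ℕₚ.≤-reflexive same) (load P a)
        where
        same : count (enters a ∘ F′) ≡ count (enters a ∘ sets P)
        same = ℕₚ.+-cancelʳ-≡ (𝟙 (enters a U) + 𝟙 (enters a W)) _ _
          (trans (sum-updateAt₂ (𝟙 ∘ enters a) (sets P) (U ∩ W) (U ∪ W) i≢j)
                 (cong (count (enters a ∘ sets P) +_)
                       (enters-modular (proj₁ (closed P i)) (proj₁ (closed P j)) a)))

      heavier : weight P < weight P′
      heavier = ℕₚ.+-cancelʳ-< (square (count U) + square (count W)) _ _
        (ℕₚ.<-≤-trans (ℕₚ.+-monoʳ-< (weight P)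
            (let x , Ux , Wx = x∈U∖W ; y , Wy , Uy = x∈W∖U
             in ∩-∪-squares {U = U} {W} (x , Ux , Boolₚ.¬-not Wx) (y , Wy , Boolₚ.¬-not Uy)))
          (ℕₚ.≤-reflexive (sym (sum-updateAt₂ (square ∘ count) (sets P) (U ∩ W) (U ∪ W) i≢j))))

    go : ∀ fuel (P : Packing Z cap k) → k * square N < weight P + fuel →
         ∃ λ (P : Packing Z cap k) → ∀ i j → NonCrossing (sets P i) (sets P j)
    go zero P enough = contradiction (weight-bound P) (ℕₚ.<⇒≱ (subst (k * square N <_) (ℕₚ.+-identityʳ _) enough))
    go (suc fuel) P enough
      with Finₚ.all? (λ i → Finₚ.all? λ j → nonCrossing? (sets P i) (sets P j))
    ... | yes nc = P , nc
    ... | no ¬nc =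
      let i , ¬nci = Finₚ.¬∀⟶∃¬ k _ (λ i → Finₚ.all? λ j → nonCrossing? (sets P i) (sets P j)) ¬nc
          j , ¬ncij = Finₚ.¬∀⟶∃¬ k _ (λ j → nonCrossing? (sets P i) (sets P j)) ¬nci
          open Step P ¬ncij
      in go fuel P′ (ℕₚ.<-≤-trans enough
           (ℕₚ.≤-trans (ℕₚ.≤-reflexive (ℕₚ.+-suc (weight P) fuel)) (ℕₚ.+-monoˡ-≤ fuel heavier)))

  -- Two-colouring a cross-free family

  module Colouring {k : ℕ} (F : Fin k → Sub N) (closed : ∀ i → Closed (F i))
                   (noncrossing : ∀ i j → NonCrossing (F i) (F j)) where

    -- F j lies strictly above F i when the tail of F i, as an arc of the tree
    -- that represents the cross-free family, lies on the F j side.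
    Above : Fin k → Fin k → Set
    Above i j = (F i ⊆ F j × (¬ (F j ⊆ F i) ⊎ toℕ i < toℕ j)) ⊎ Covering (F i) (F j)

    above? : ∀ i j → Dec (Above i j)
    above? i j =
      ((F i ⊆? F j) ×-dec (¬? (F j ⊆? F i) ⊎-dec (toℕ i ℕₚ.<? toℕ j))) ⊎-dec covering? (F i) (F j)

    height : Fin k → ℕ
    height i = count (λ j → does (above? i j))

    colour : Fin k → Bool
    colour i = parity (height i)

    module At (a : Fin m) where
      s = src a
      t = tgt a

      E : Fin k → Bool
      E j = enters a (F j)

      E⇒s : ∀ {i} → E i ≡ true → F i s ≡ false
      E⇒s {i} Ei = proj₁ (enters⇒ a (F i) Ei)

      E⇒t : ∀ {i} → E i ≡ true → F i t ≡ true
      E⇒t {i} Ei = proj₂ (enters⇒ a (F i) Ei)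

      clash : ∀ {b : Bool} → b ≡ true → b ≡ false → ⊥
      clash b≡t b≡f = true≢false (trans (sym b≡t) b≡f)

      ¬covering : ∀ {i j} → E i ≡ true → F j s ≡ false → ¬ Covering (F i) (F j)
      ¬covering Ei ¬Fjs cover = clash (cover s (E⇒s Ei)) ¬Fjs

      above-if-s∈ : ∀ {i j} → E i ≡ true → F j s ≡ true → Above i j
      above-if-s∈ {i} {j} Ei Fjs with noncrossing i j
      ... | inj₁ i⊆j = inj₁ (i⊆j , inj₁ λ j⊆i → clash (j⊆i s Fjs) (E⇒s Ei))
      ... | inj₂ (inj₁ j⊆i) = ⊥-elim (clash (j⊆i s Fjs) (E⇒s Ei))
      ... | inj₂ (inj₂ (inj₁ disj)) = ⊥-elim (clash (no-exit (closed j) a Fjs) (disj t (E⇒t Ei)))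
      ... | inj₂ (inj₂ (inj₂ cover)) = inj₂ cover

      ¬above-if-t∉ : ∀ {i j} → E i ≡ true → F j s ≡ false → F j t ≡ false → ¬ Above i j
      ¬above-if-t∉ Ei _ ¬Fjt (inj₁ (i⊆j , _)) = clash (i⊆j t (E⇒t Ei)) ¬Fjt
      ¬above-if-t∉ Ei ¬Fjs _ (inj₂ cover) = ¬covering Ei ¬Fjs cover

      rank : Fin k → ℕ
      rank i = count (λ j → E j ∧ does (above? i j))

      -- Of the sets that `a` does not enter, those containing its tail are above every set it
      -- enters, and those missing its head are above none. They contribute the same base to all
      -- heights, so along `a` the colour is determined by the rank up to a common flip.
      height≡base+rank : ∀ {i} → E i ≡ true → height i ≡ count (λ j → F j s) + rank i
      height≡base+rank {i} Ei =
        trans (∑ℕ.sum-cong-≗ (λ j → pointwise j)) (∑ℕ.∑-distrib-+ (λ j → 𝟙 (F j s)) (λ j → 𝟙 (E j ∧ does (above? i j))))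
        where
        pointwise : ∀ j → 𝟙 (does (above? i j)) ≡ 𝟙 (F j s) + 𝟙 (E j ∧ does (above? i j))
        pointwise j with F j s in Fjs | F j t in Fjt
        ... | true  | true  = cong 𝟙 (dec-true (above? i j) (above-if-s∈ Ei Fjs))
        ... | true  | false = ⊥-elim (clash (no-exit (closed j) a Fjs) Fjt)
        ... | false | true  = refl
        ... | false | false = cong 𝟙 (dec-false (above? i j) (¬above-if-t∉ Ei Fjs Fjt))

      -- All sets entered by `a` contain its head and miss its tail, so being cross-free forces them
      -- into a chain. Equal sets are ordered by their indices.
      above-total : ∀ {i j} → E i ≡ true → E j ≡ true → i ≢ j → Above i j ⊎ Above j i
      above-total {i} {j} Ei Ej i≢j with F i ⊆? F j | F j ⊆? F i
      ... | yes i⊆j | no  j⊈i = inj₁ (inj₁ (i⊆j , inj₁ j⊈i))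
      ... | no  i⊈j | yes j⊆i = inj₂ (inj₁ (j⊆i , inj₁ i⊈j))
      ... | yes i⊆j | yes j⊆i with ℕₚ.<-cmp (toℕ i) (toℕ j)
      ...   | tri< i<j _ _ = inj₁ (inj₁ (i⊆j , inj₂ i<j))
      ...   | tri≈ _ i≡j _ = contradiction (Finₚ.toℕ-injective i≡j) i≢j
      ...   | tri> _ _ j<i = inj₂ (inj₁ (j⊆i , inj₂ j<i))
      above-total {i} {j} Ei Ej i≢j | no i⊈j | no j⊈i with noncrossing i j
      ... | inj₁ i⊆j = contradiction i⊆j i⊈j
      ... | inj₂ (inj₁ j⊆i) = contradiction j⊆i j⊈i
      ... | inj₂ (inj₂ (inj₁ disj)) = ⊥-elim (clash (E⇒t Ej) (disj t (E⇒t Ei)))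
      ... | inj₂ (inj₂ (inj₂ cover)) = inj₁ (inj₂ cover)

      above-irrefl : ∀ {i} → E i ≡ true → ¬ Above i i
      above-irrefl Ei (inj₁ (i⊆i , inj₁ ¬i⊆i)) = ¬i⊆i i⊆i
      above-irrefl Ei (inj₁ (_ , inj₂ i<i)) = ℕₚ.<-irrefl refl i<i
      above-irrefl Ei (inj₂ cover) = ¬covering Ei (E⇒s Ei) cover

      above-trans : ∀ {i j l} → E i ≡ true → E j ≡ true → E l ≡ true → Above i j → Above j l → Above i l
      above-trans Ei Ej El (inj₂ cover) _ = ⊥-elim (¬covering Ei (E⇒s Ej) cover)
      above-trans Ei Ej El _ (inj₂ cover) = ⊥-elim (¬covering Ej (E⇒s El) cover)
      above-trans {i} {j} {l} Ei Ej El (inj₁ (i⊆j , i≺j)) (inj₁ (j⊆l , j≺l)) =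
        inj₁ ((λ x → j⊆l x ∘ i⊆j x) , strict i≺j j≺l)
        where
        strict : ¬ (F j ⊆ F i) ⊎ toℕ i < toℕ j → ¬ (F l ⊆ F j) ⊎ toℕ j < toℕ l → ¬ (F l ⊆ F i) ⊎ toℕ i < toℕ l
        strict (inj₁ j⊈i) _          = inj₁ λ l⊆i → j⊈i λ x → l⊆i x ∘ j⊆l x
        strict _          (inj₁ l⊈j) = inj₁ λ l⊆i → l⊈j λ x → i⊆j x ∘ l⊆i x
        strict (inj₂ i<j) (inj₂ j<l) = inj₂ (ℕₚ.<-trans i<j j<l)

      rank-< : ∀ {i j} → E i ≡ true → E j ≡ true → Above i j → rank j < rank i
      rank-< {i} {j} Ei Ej i≺j = count-mono-< below j (cong₂ _∧_ Ej (dec-false (above? j j) (above-irrefl Ej)))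
                                                     (cong₂ _∧_ Ej (dec-true (above? i j) i≺j))
        where
        below : ∀ l → E l ∧ does (above? j l) ≡ true → E l ∧ does (above? i l) ≡ true
        below l h = let El , j≺l = ∧-true h in
          cong₂ _∧_ El (dec-true (above? i l) (above-trans Ei Ej El i≺j (does⇒ (above? j l) j≺l)))

      rank-injective : ∀ {i j} → E i ≡ true → E j ≡ true → rank i ≡ rank j → i ≡ j
      rank-injective {i} {j} Ei Ej eq with i ≟ j
      ... | yes i≡j = i≡j
      ... | no  i≢j with above-total Ei Ej i≢j
      ...   | inj₁ i≺j = contradiction (sym eq) (ℕₚ.<⇒≢ (rank-< Ei Ej i≺j))
      ...   | inj₂ j≺i = contradiction eq (ℕₚ.<⇒≢ (rank-< Ej Ei j≺i))

      rank-bound : ∀ {i} → E i ≡ true → rank i < count E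
      rank-bound {i} Ei = count-mono-< (λ j → proj₁ ∘ ∧-true) i
        (cong₂ _∧_ Ei (dec-false (above? i i) (above-irrefl Ei))) Ei

      -- The ranks of the sets entered by `a` are distinct and less than their number. Within one
      -- colour class they also have equal parity, so their halves are still distinct.
      class-load : ∀ c → count (λ i → E i ∧ does (colour i Boolₚ.≟ c)) ≤ ⌈ count E /2⌉
      class-load c = count≤-injective (λ i → ⌊ rank i /2⌋) half-injective
        (λ i h → ℕₚ.⌊n/2⌋-mono (s≤s (rank-bound (proj₁ (∧-true h)))))
        where
        half-injective : ∀ i j → E i ∧ does (colour i Boolₚ.≟ c) ≡ true → E j ∧ does (colour j Boolₚ.≟ c) ≡ true →
                         ⌊ rank i /2⌋ ≡ ⌊ rank j /2⌋ → i ≡ j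
        half-injective i j hi hj eq = let
            Ei , ci = ∧-true hi
            Ej , cj = ∧-true hj
            same-colour : parity (height i) ≡ parity (height j)
            same-colour = trans (does⇒ (colour i Boolₚ.≟ c) ci) (sym (does⇒ (colour j Boolₚ.≟ c) cj))
          in rank-injective Ei Ej (parity-half-injective (rank i) (rank j)
               (parity-cancelˡ (count (λ j → F j s))
                 (trans (cong parity (sym (height≡base+rank Ei)))
                   (trans same-colour (cong parity (height≡base+rank Ej))))) eq)

  -- This is where positive capacities matter: for c = 0 the inequality fails.
  ⌈1+c/2⌉≤c : ∀ c → 1 ≤ c → ⌈ suc c /2⌉ ≤ c
  ⌈1+c/2⌉≤c (suc zero)    _ = s≤s z≤n
  ⌈1+c/2⌉≤c (suc (suc c)) _ = s≤s (s≤s (ℕₚ.⌊n/2⌋≤n c))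

  -- In the tree representing a cross-free family each arc enters the sets along
  -- a directed path, on which the parity of the height alternates.
  split-packing : ∀ {Z cap} ν → (∀ a → 1 ≤ cap a) → ∀ {k} → ν + suc ν ≤ k →
                  Packing Z (suc ∘ cap) k → Packs Z cap (suc ν)
  split-packing {Z} {cap} ν 1≤cap {k} big P₀ with uncross P₀
  ... | P , nc = conclude (majority (ℕₚ.≤-trans big (ℕₚ.≤-reflexive total)))
    where
    open Colouring (sets P) (proj₁ ∘ closed P) nc
    class : Bool → Fin k → Bool
    class c i = does (colour i Boolₚ.≟ c)

    total : k ≡ count (class true) + count (class false)
    total = trans (sym (count-true k)) (trans (∑ℕ.sum-cong-≗ (λ i → bits (colour i)))
              (∑ℕ.∑-distrib-+ (𝟙 ∘ class true) (𝟙 ∘ class false)))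
      where
      bits : ∀ b → 1 ≡ 𝟙 (does (b Boolₚ.≟ true)) + 𝟙 (does (b Boolₚ.≟ false))
      bits true  = refl
      bits false = refl

    majority : ∀ {x y} → ν + suc ν ≤ x + y → suc ν ≤ x ⊎ suc ν ≤ y
    majority {x} {y} h with ℕₚ.<-≤-connex ν x
    ... | inj₁ ν<x = inj₁ ν<x
    ... | inj₂ x≤ν = inj₂ (ℕₚ.+-cancelˡ-≤ ν (suc ν) y (ℕₚ.≤-trans h (ℕₚ.+-monoˡ-≤ y x≤ν)))

    part : ∀ c → Packing Z cap (count (class c))
    part c .sets = select (class c) (sets P)
    part c .closed = select-elim {P = ClosedMod Z} (class c) (sets P) (closed P)
    part c .nontrivial = select-elim {P = Nontrivial} (class c) (sets P) (nontrivial P)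
    part c .load a = begin
      count (enters a ∘ select (class c) (sets P))   ≡⟨ count-select (enters a) (class c) (sets P) ⟩
      count (λ i → class c i ∧ enters a (sets P i))  ≡⟨ ∑ℕ.sum-cong-≗ (λ i → cong 𝟙 (Boolₚ.∧-comm (class c i) _)) ⟩
      count (λ i → enters a (sets P i) ∧ class c i)  ≤⟨ At.class-load a c ⟩
      ⌈ count (enters a ∘ sets P) /2⌉                ≤⟨ ℕₚ.⌈n/2⌉-mono (load P a) ⟩
      ⌈ suc (cap a) /2⌉                              ≤⟨ ⌈1+c/2⌉≤c (cap a) (1≤cap a) ⟩
      cap a                                          ∎
      where open ℕₚ.≤-Reasoning

    conclude : suc ν ≤ count (class true) ⊎ suc ν ≤ count (class false) → Packs Z cap (suc ν)
    conclude (inj₁ h) = _ , h , part true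
    conclude (inj₂ h) = _ , h , part false

  -- The min-max relation

  Covers : Sub m → List (Fin m) → Set
  Covers Z S = ∀ {U} → ClosedMod Z U → Nontrivial U → ∃ λ a → a ∈ S × enters a U ≡ true

  MinMax : Sub m → Set
  MinMax Z = ∃ λ k → Packs Z (const 1) k × ∃ λ S → length S ≤ k × Covers Z S

  -- Count the pairs of a set and an arc entering it: each set has at least one such arc, and each
  -- arc enters at most one set.
  packing-bound : ∀ {Z k} → Packing Z (const 1) k → k ≤ m
  packing-bound {k = k} P = begin
    k                                             ≡⟨ count-true k ⟨
    count {k} (const true)                        ≤⟨ sum-mono (λ i → let a , e = crossed (proj₁ (closed P i)) (nontrivial P i)
                                                                     in count-positive {p = λ a → enters a (sets P i)} a e) ⟩
    ∑ℕ.sum (λ i → count (λ a → enters a (sets P i))) ≡⟨ ∑ℕ.∑-comm (λ i a → 𝟙 (enters a (sets P i))) ⟩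
    ∑ℕ.sum (λ a → count (enters a ∘ sets P))      ≤⟨ sum-mono {g = const 1} (load P) ⟩
    ∑ℕ.sum {m} (const 1)                          ≡⟨ count-true m ⟩
    m                                             ∎
    where open ℕₚ.≤-Reasoning

  append : ∀ {Z cap cap₁ cap₂ k₁ k₂} (P : Packing Z cap₁ k₁) (Q : Packing Z cap₂ k₂) →
           (∀ a → count (enters a ∘ sets P) + count (enters a ∘ sets Q) ≤ cap a) → Packing Z cap (k₁ + k₂)
  append P Q fits .sets = sets P Vector.++ sets Q
  append {Z} P Q fits .closed = ++-elim {P = ClosedMod Z} (sets P) (sets Q) (closed P) (closed Q)
  append P Q fits .nontrivial = ++-elim {P = Nontrivial} (sets P) (sets Q) (nontrivial P) (nontrivial Q)
  append P Q fits .load a = ℕₚ.≤-trans (ℕₚ.≤-reflexive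
    (trans (∑ℕ.sum-cong-≗ (map-++ (𝟙 ∘ enters a) (sets P) (sets Q)))
           (sum-++ (𝟙 ∘ enters a ∘ sets P) (𝟙 ∘ enters a ∘ sets Q)))) (fits a)

  contract : Sub m → Fin m → Sub m
  contract Z b a = does (a ≟ b) ∨ Z a

  contract-closed : ∀ {Z b U} → ClosedMod Z U → enters b U ≡ false → ClosedMod (contract Z b) U
  contract-closed {Z} {b} {U} (cU , zU) ¬b = cU , avoids
    where
    avoids : ∀ a → contract Z b a ≡ true → enters a U ≡ false
    avoids a h with a ≟ b
    ... | yes refl = ¬b
    ... | no  _    = zU a h

  uncontract : ∀ {Z b cap k} → Packing (contract Z b) cap k → Packing Z cap k
  uncontract P .sets = sets P
  uncontract {Z} {b} P .closed i = let c , z = closed P i in c , λ a za → z a (trans (cong (does (a ≟ b) ∨_) za) (Boolₚ.∨-zeroʳ _))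
  uncontract P .nontrivial = nontrivial P
  uncontract P .load = load P

  -- Doubles the arcs numbered below j.
  cap : ℕ → Fin m → ℕ
  cap j a = 1 + 𝟙 (does (toℕ a ℕₚ.<? j))

  -- Induction on the number of uncontracted arcs. If contracting some arc b lowers the maximum
  -- packing size ν, a small cover of the contraction together with b is a cover. Otherwise every
  -- arc is avoided by a packing of size ν. Doubling the arcs one at a time, there is a first arc b
  -- whose doubling admits ν + 1 sets. That packing and one avoiding b have 2ν + 1 sets together,
  -- and splitting them by parity gives ν + 1 sets already before the doubling of b.
  minmax : ∀ q Z → count (not ∘ Z) ≤ q → ¬ ¬ MinMax Z
  minmax q Z uncontracted≤q ¬mm =
    -- A packing has at most `m` sets, so there is a maximum size ν.
    last-before-jump (Packs Z (const 1)) (suc m)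
      (λ (k , m<k , P) → ℕₚ.<⇒≱ m<k (packing-bound P))
      (0 , z≤n , record { sets = λ () ; closed = λ () ; nontrivial = λ () ; load = λ _ → z≤n })
      (λ (ν , _ , packs , ¬packs) → at-maximum ν packs ¬packs)
    where
    at-maximum : ∀ ν → Packs Z (const 1) ν → ¬ Packs Z (const 1) (suc ν) → ⊥
    -- A single nontrivial closed set would be a packing of size 1. So there is none, and the empty
    -- cover suffices.
    at-maximum zero packs ¬packs = ¬mm (0 , packs , [] , z≤n , λ {U} cU ntU → ⊥-elim (¬packs
      (1 , ℕₚ.≤-refl , record { sets = const U ; closed = const cU ; nontrivial = const ntU
                              ; load = λ a → count≤k (λ (_ : Fin 1) → enters a U) })))
    at-maximum ν@(suc ν′) packs@(k , ν≤k , P) ¬packs =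
      -- With nothing doubled, ν + 1 sets do not fit. With everything doubled, a packing taken twice
      -- fits and has at least ν + 1 sets because ν is positive here. Arc number `j` is the one
      -- whose doubling makes the difference.
      last-before-jump (λ j → ¬ Packs Z (cap j) (suc ν)) m (λ ¬p → ¬p doubled) ¬packs
        λ (j , j<m , ¬packsⱼ , ¬¬packs₁₊ⱼ) → ¬¬packs₁₊ⱼ λ packs₁₊ⱼ →
          avoiding (fromℕ< j<m) λ avoids → ¬packsⱼ (merge j j<m packs₁₊ⱼ avoids)
      where
      doubled : Packs Z (cap m) (suc ν)
      doubled = k + k , ℕₚ.+-mono-≤ (ℕₚ.≤-trans (s≤s z≤n) ν≤k) ν≤k ,
        append P P λ a → ℕₚ.≤-trans (ℕₚ.+-mono-≤ (load P a) (load P a))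
          (ℕₚ.≤-reflexive (cong (suc ∘ 𝟙) (sym (dec-true (toℕ a ℕₚ.<? m) (Finₚ.toℕ<n a)))))

      avoiding : ∀ b → ¬ ¬ Packs (contract Z b) (const 1) ν
      avoiding b ¬p with Z b in Zb
      ... | true = ¬p (k , ν≤k , record
              { sets = sets P ; closed = λ i → contract-closed (closed P i) (proj₂ (closed P i) b Zb)
              ; nontrivial = nontrivial P ; load = load P })
      ... | false = recurse q uncontracted≤q
        where
        fewer : count (not ∘ contract Z b) < count (not ∘ Z)
        fewer = count-mono-< (λ a → shrink a) b (cong (λ c → not (c ∨ Z b)) (dec-true (b ≟ b) refl)) (cong not Zb)
          where
          shrink : ∀ a → not (contract Z b a) ≡ true → not (Z a) ≡ true
          shrink a h with does (a ≟ b)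
          ... | false = h

        extend : MinMax (contract Z b) → ⊥
        -- The contraction admits no ν sets, so its cover has fewer than ν arcs and leaves room for
        -- `b`. The arc `b` takes care of the closed sets lost by contracting it.
        extend (k′ , packs′@(l , k′≤l , Q) , S , S≤k′ , covers) = ¬mm (ν , packs , b ∷ S , ℕₚ.≤-trans (s≤s S≤k′) k′<ν , covers⁺)
          where
          k′<ν : k′ < ν
          k′<ν = ℕₚ.≰⇒> λ ν≤k′ → ¬p (l , ℕₚ.≤-trans ν≤k′ k′≤l , Q)
          covers⁺ : Covers Z (b ∷ S)
          covers⁺ {U} cU ntU with enters b U in eb
          ... | true  = b , here refl , eb
          ... | false = let a , a∈S , ea = covers (contract-closed cU eb) ntU in a , there a∈S , ea

        recurse : ∀ q → count (not ∘ Z) ≤ q → ⊥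
        recurse zero     h = ℕₚ.<⇒≱ (count-positive b (cong not Zb)) h
        recurse (suc q′) h = minmax q′ (contract Z b) (ℕₚ.≤-pred (ℕₚ.≤-trans fewer h)) extend

      merge : ∀ j (j<m : j < m) → Packs Z (cap (suc j)) (suc ν) → Packs (contract Z (fromℕ< j<m)) (const 1) ν →
              Packs Z (cap j) (suc ν)
      merge j j<m (k₁ , ν<k₁ , P₁) (k₂ , ν≤k₂ , P₂) =
        -- The sets of `P₂` avoid `b`, which balances the doubled capacity of `b` in `P₁`. At every
        -- other arc `P₂` adds at most 1. So all loads stay within `suc (cap j a)`.
        split-packing ν (λ _ → s≤s z≤n)
          (ℕₚ.≤-trans (ℕₚ.≤-reflexive (ℕₚ.+-suc ν ν)) (ℕₚ.+-mono-≤ ν<k₁ ν≤k₂))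
          (append P₁ (uncontract P₂) fits)
        where
        b = fromℕ< j<m
        fits : ∀ a → count (enters a ∘ sets P₁) + count (enters a ∘ sets P₂) ≤ suc (cap j a)
        fits a with a ≟ b
        ... | yes refl = ℕₚ.≤-trans (ℕₚ.+-mono-≤ (ℕₚ.≤-trans (load P₁ b) (s≤s (𝟙-mono {c = true} (λ _ → refl))))
                (ℕₚ.≤-reflexive (count-none λ i → proj₂ (closed P₂ i) b (cong (_∨ Z b) (dec-true (b ≟ b) refl)))))
                (s≤s (s≤s z≤n))
        ... | no a≢b = ℕₚ.≤-trans (ℕₚ.+-mono-≤ (ℕₚ.≤-trans (load P₁ a) (s≤s (𝟙-mono below))) (load P₂ a))
                (ℕₚ.≤-reflexive (ℕₚ.+-comm (cap j a) 1))
          where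
          below : does (toℕ a ℕₚ.<? suc j) ≡ true → does (toℕ a ℕₚ.<? j) ≡ true
          below h = dec-true (toℕ a ℕₚ.<? j) (ℕₚ.≤∧≢⇒< (ℕₚ.≤-pred (does⇒ (toℕ a ℕₚ.<? suc j) h))
            λ a≡j → a≢b (Finₚ.toℕ-injective (trans a≡j (sym (Finₚ.toℕ-fromℕ< j<m)))))

-- Orbits of an injection of Fin d

iter-+ : {A : Set} (f : A → A) → ∀ j k x → iter f (j + k) x ≡ iter f j (iter f k x)
iter-+ f zero    k x = refl
iter-+ f (suc j) k x = cong f (iter-+ f j k x)

iter-shift : {A : Set} (f : A → A) → ∀ k x → iter f k (f x) ≡ iter f (suc k) x
iter-shift f zero    x = refl
iter-shift f (suc k) x = cong f (iter-shift f k x)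

iter-* : {A : Set} (f : A → A) → ∀ q k {x} → iter f k x ≡ x → iter f (q * k) x ≡ x
iter-* f zero    k fix = refl
iter-* f (suc q) k fix = trans (iter-+ f k (q * k) _) (trans (cong (iter f k) (iter-* f q k fix)) fix)

iter-injective : {A : Set} {f : A → A} → (∀ x y → f x ≡ f y → x ≡ y) →
                 ∀ k {x y} → iter f k x ≡ iter f k y → x ≡ y
iter-injective inj zero    eq = eq
iter-injective inj (suc k) eq = iter-injective inj k (inj _ _ eq)

iter-repeats : ∀ {d} (f : Fin d → Fin d) x → ∃₂ λ i P → i + suc P ≤ d × iter f (i + suc P) x ≡ iter f i x
iter-repeats {d} f x =
  let i , j , i<j , eq = Finₚ.pigeonhole (ℕₚ.n<1+n d) (λ i → iter f (toℕ i) x)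
      j≡ : toℕ i + suc (toℕ j ∸ suc (toℕ i)) ≡ toℕ j
      j≡ = trans (ℕₚ.+-suc (toℕ i) _) (ℕₚ.m+[n∸m]≡n i<j)
  in toℕ i , toℕ j ∸ suc (toℕ i) , subst (_≤ d) (sym j≡) (ℕₚ.≤-pred (Finₚ.toℕ<n j)) ,
     trans (cong (λ k → iter f k x) j≡) (sym eq)

least : ∀ {d} {P : Fin d → Set} → (∀ x → Dec (P x)) → ∃ P → ∃ λ y → P y × (∀ z → P z → toℕ y ≤ toℕ z)
least {suc d} P? ∃P with P? zero
... | yes p₀ = zero , p₀ , λ _ _ → z≤n
least {suc d} P? (zero , p₀)  | no ¬p₀ = contradiction p₀ ¬p₀
least {suc d} {P} P? (suc x , px) | no ¬p₀ with least (P? ∘ suc) (x , px)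
... | y , py , y≤ = suc y , py , λ { zero p₀ → contradiction p₀ ¬p₀ ; (suc z) pz → s≤s (y≤ z pz) }

allBelow-complete : ∀ m {p} → (∀ k → k < m → p k ≡ true) → allBelow m p ≡ true
allBelow-complete zero    _ = refl
allBelow-complete (suc m) h = cong₂ _∧_ (allBelow-complete m (λ k k<m → h k (ℕₚ.m<n⇒m<1+n k<m))) (h m ℕₚ.≤-refl)

allBelow-sound : ∀ m {p} → allBelow m p ≡ true → ∀ k → k < m → p k ≡ true
allBelow-sound (suc m) {p} h k k<1+m with ∧-true {allBelow m p} h | k ℕₚ.≟ m
... | _  , pm | yes refl = pm
... | hm , _  | no k≢m   = allBelow-sound m hm k (ℕₚ.≤∧≢⇒< (ℕₚ.≤-pred k<1+m) k≢m)

≡-from-⇔ : ∀ {b c} → (b ≡ true → c ≡ true) → (c ≡ true → b ≡ true) → b ≡ c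
≡-from-⇔ {true}          f g = sym (f refl)
≡-from-⇔ {false} {true}  f g = g refl
≡-from-⇔ {false} {false} f g = refl

list-sum≡sum : ∀ {d} (f : Fin d → ℕ) → ListAction.sum (tabulate f) ≡ ∑ℕ.sum f
list-sum≡sum {zero}  f = refl
list-sum≡sum {suc d} f = cong (f zero +_) (list-sum≡sum (f ∘ suc))

countFin≡count : ∀ {d} (b : Sub d) → countFin d b ≡ count b
countFin≡count {d} b = begin
  ListAction.sum (map 𝟙′ (tabulate id))  ≡⟨ cong ListAction.sum (Listₚ.map-tabulate id 𝟙′) ⟩
  ListAction.sum (tabulate 𝟙′)           ≡⟨ list-sum≡sum 𝟙′ ⟩
  ∑ℕ.sum 𝟙′                              ≡⟨ ∑ℕ.sum-cong-≗ (λ x → bit (b x)) ⟩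
  count b                                ∎
  where
  open ≡-Reasoning
  𝟙′ = λ x → if b x then 1 else 0
  bit : ∀ c → (if c then 1 else 0) ≡ 𝟙 c
  bit true  = refl
  bit false = refl

module Orbits {d : ℕ} (f : Fin d → Fin d) (f-inj : ∀ x y → f x ≡ f y → x ≡ y) where

  period : ∀ x → ∃ λ P → P < d × iter f (suc P) x ≡ x
  period x =
    let i , P , i+P<d , eq = iter-repeats f x
    in P , ℕₚ.m+n≤o⇒n≤o i i+P<d ,
       iter-injective f-inj i (trans (sym (iter-+ f i (suc P) x)) eq)

  SameOrbit : Fin d → Fin d → Set
  SameOrbit x y = ∃ λ k → iter f k x ≡ y

  orbit-trans : ∀ {x y z} → SameOrbit x y → SameOrbit y z → SameOrbit x z
  orbit-trans {x} (j , refl) (k , refl) = k + j , iter-+ f k j x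

  orbit-sym : ∀ {x y} → SameOrbit x y → SameOrbit y x
  orbit-sym {x} (k , refl) =
    let P , _ , fix = period x
    -- After `k` steps, `k * P` more complete `k` full periods of length `suc P`.
    in k * P , trans (sym (iter-+ f (k * P) k x))
                 (trans (cong (λ j → iter f j x) (trans (ℕₚ.+-comm (k * P) k) (sym (ℕₚ.*-suc k P)))) (iter-* f k (suc P) fix))

  orbit-bounded : ∀ {x y} → SameOrbit x y → ∃ λ k → k < d × iter f k x ≡ y
  orbit-bounded {x} (k , refl) =
    let P , P<d , fix = period x
    in k % suc P , ℕₚ.≤-trans (m%n<n k (suc P)) P<d ,
       trans (cong (iter f (k % suc P)) (sym (iter-* f (k / suc P) (suc P) fix)))
         (trans (sym (iter-+ f (k % suc P) _ x)) (cong (λ j → iter f j x) (sym (m≡m%n+[m/n]*n k (suc P)))))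

  sameOrbit? : ∀ x y → Dec (SameOrbit x y)
  sameOrbit? x y = map′
    (λ (k , eq) → toℕ k , eq)
    (λ o → let k , k<d , eq = orbit-bounded o
           in fromℕ< k<d , trans (cong (λ j → iter f j x) (Finₚ.toℕ-fromℕ< k<d)) eq)
    (Finₚ.any? λ k → iter f (toℕ k) x ≟ y)

  abstract
    rep : Fin d → Fin d
    rep x = proj₁ (least (sameOrbit? x) (x , 0 , refl))

    rep-orbit : ∀ x → SameOrbit x (rep x)
    rep-orbit x = proj₁ (proj₂ (least (sameOrbit? x) (x , 0 , refl)))

    rep-least : ∀ x {z} → SameOrbit x z → toℕ (rep x) ≤ toℕ z
    rep-least x {z} = proj₂ (proj₂ (least (sameOrbit? x) (x , 0 , refl))) z

    rep-cong : ∀ {x y} → SameOrbit x y → rep x ≡ rep y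
    rep-cong {x} {y} o = Finₚ.toℕ-injective (ℕₚ.≤-antisym
      (rep-least x (orbit-trans o (rep-orbit y))) (rep-least y (orbit-trans (orbit-sym o) (rep-orbit x))))

    rep-idem : ∀ x → rep (rep x) ≡ rep x
    rep-idem x = sym (rep-cong (rep-orbit x))

    -- Euler's formula counts faces by testing `d` iterates of each dart. These exhaust the orbit,
    -- so the darts counted are the canonical representatives.
    orbitCount≡reps : orbitCount d f ≡ count (λ x → does (rep x ≟ x))
    orbitCount≡reps = trans (countFin≡count {d} _) (∑ℕ.sum-cong-≗ (λ x → cong 𝟙 (≡-from-⇔ (is-rep x) (rep-is x))))
      where
      is-rep : ∀ x → allBelow d (λ k → toℕ x ≤ᵇ toℕ (iter f k x)) ≡ true → does (rep x ≟ x) ≡ true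
      is-rep x h = dec-true (rep x ≟ x) (Finₚ.toℕ-injective (ℕₚ.≤-antisym (rep-least x (0 , refl)) x≤rep))
        where
        x≤rep : toℕ x ≤ toℕ (rep x)
        x≤rep = let k , k<d , eq = orbit-bounded (rep-orbit x)
                in subst (λ z → toℕ x ≤ toℕ z) eq (does⇒ (toℕ x ℕₚ.≤? _) (allBelow-sound d h k k<d))
      rep-is : ∀ x → does (rep x ≟ x) ≡ true → allBelow d (λ k → toℕ x ≤ᵇ toℕ (iter f k x)) ≡ true
      rep-is x h = allBelow-complete d λ k _ →
        dec-true (toℕ x ℕₚ.≤? _) (subst (λ z → toℕ z ≤ toℕ (iter f k x)) (does⇒ (rep x ≟ x) h) (rep-least x (k , refl)))

  inverse : Fin d → Fin d
  inverse x = iter f (proj₁ (period x)) x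

  f-inverse : ∀ x → f (inverse x) ≡ x
  f-inverse x = proj₂ (proj₂ (period x))

  perm : Permutation′ d
  perm = permutation f inverse f-inverse (λ x → f-inj _ _ (f-inverse (f x)))

-- Union–find forests

roots : (Fin N → Fin N) → ℕ
roots c = count (λ v → does (c v ≟ v))

relabel : Fin N → Fin N → Fin N → Fin N
relabel old new y = if does (y ≟ old) then new else y

relabel-old : ∀ (old new : Fin N) → relabel old new old ≡ new
relabel-old old new rewrite dec-true (old ≟ old) refl = refl

relabel-other : ∀ {old y : Fin N} new → y ≢ old → relabel old new y ≡ y
relabel-other {old = old} {y} new y≢old rewrite dec-false (y ≟ old) y≢old = refl

count-single : (p : Sub k) → ∀ w → p w ≡ true → count (λ v → p v ∧ does (v ≟ w)) ≡ 1
count-single p w pw = ℕₚ.≤-antisym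
  (count≤1 λ i j hi hj → trans (does⇒ (i ≟ w) (proj₂ (∧-true hi))) (sym (does⇒ (j ≟ w) (proj₂ (∧-true hj)))))
  (count-positive w (cong₂ _∧_ pw (dec-true (w ≟ w) refl)))

roots-id : ∀ N → roots {N} id ≡ N
roots-id N = trans (∑ℕ.sum-cong-≗ {N} (λ v → cong 𝟙 (dec-true (v ≟ v) refl))) (count-true N)

roots-constant : {c : Fin N → Fin N} → Fin N → (∀ v → c (c v) ≡ c v) → (∀ u v → c u ≡ c v) → roots c ≡ 1
roots-constant {c = c} v₀ idem const-c = ℕₚ.≤-antisym
  (count≤1 λ i j hi hj → trans (sym (does⇒ (c i ≟ i) hi)) (trans (const-c i j) (does⇒ (c j ≟ j) hj)))
  (count-positive (c v₀) (dec-true (c (c v₀) ≟ c v₀) (idem v₀)))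

module Forests {N m : ℕ} (l r : Fin m → Fin N) (c₀ : Fin N → Fin N) (c₀-idem : ∀ v → c₀ (c₀ v) ≡ c₀ v) where

  -- Forest c T: adding the edges T one by one, each joining two distinct
  -- components, turns the component labelling c₀ into c.
  data Forest : (Fin N → Fin N) → List (Fin m) → Set where
    none : Forest c₀ []
    join : ∀ {c T} → Forest c T → ∀ x → c (l x) ≢ c (r x) → Forest (relabel (c (r x)) (c (l x)) ∘ c) (x ∷ T)

  idem : ∀ {c T} → Forest c T → ∀ v → c (c v) ≡ c v
  idem none = c₀-idem
  idem (join {c} F x l≢r) v with c v ≟ c (r x)
  ... | yes _ = trans (cong (relabel (c (r x)) (c (l x))) (idem F (l x))) (relabel-other _ l≢r)
  ... | no cv≢ = trans (cong (relabel (c (r x)) (c (l x))) (idem F v)) (relabel-other _ cv≢)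

  coarser : ∀ {c T} → Forest c T → ∀ {u v} → c₀ u ≡ c₀ v → c u ≡ c v
  coarser none         eq = eq
  coarser (join F x _) eq = cong (relabel _ _) (coarser F eq)

  joined-now : ∀ {c : Fin N → Fin N} {x} → c (l x) ≢ c (r x) →
               relabel (c (r x)) (c (l x)) (c (l x)) ≡ relabel (c (r x)) (c (l x)) (c (r x))
  joined-now {c} {x} l≢r = trans (relabel-other _ l≢r) (sym (relabel-old (c (r x)) (c (l x))))

  joined : ∀ {c T x} → Forest c T → x ∈ T → c (l x) ≡ c (r x)
  joined (join {c} F x l≢r) (here refl) = joined-now {c} l≢r
  joined (join F x _)       (there x∈T) = cong (relabel _ _) (joined F x∈T)

  -- A join destroys exactly one root, the label `w` of the absorbed component, and creates none.
  roots-forest : ∀ {c T} → Forest c T → roots c + length T ≡ roots c₀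
  roots-forest none = ℕₚ.+-identityʳ _
  roots-forest (join {c} {T} F x l≢r) = begin
    roots c′ + suc (length T)   ≡⟨ ℕₚ.+-suc (roots c′) _ ⟩
    suc (roots c′) + length T   ≡⟨ cong (_+ length T) loses-one ⟨
    roots c + length T          ≡⟨ roots-forest F ⟩
    roots c₀                    ∎
    where
    open ≡-Reasoning
    w = c (r x)
    c′ = relabel w (c (l x)) ∘ c
    root? : Sub N
    root? v = does (c v ≟ v)
    survives : ∀ v → root? v ∧ not (does (v ≟ w)) ≡ does (c′ v ≟ v)
    survives v with c v ≟ w
    ... | no cv≢w with c v ≟ v
    ...   | no _     = refl
    ...   | yes cv≡v = cong not (dec-false (v ≟ w) λ v≡w → cv≢w (trans cv≡v v≡w))
    survives v | yes cv≡w with c v ≟ v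
    ... | yes cv≡v = trans (cong not (dec-true (v ≟ w) (trans (sym cv≡v) cv≡w)))
                       (sym (dec-false (c (l x) ≟ v) λ cl≡v → l≢r (trans cl≡v (trans (sym cv≡v) cv≡w))))
    ... | no _     = sym (dec-false (c (l x) ≟ v) λ cl≡v →
                       l≢r (trans (sym (idem F (l x))) (trans (cong c cl≡v) cv≡w)))
    loses-one : roots c ≡ suc (roots c′)
    loses-one = trans (count-split root? (λ v → does (v ≟ w)))
      (cong₂ _+_ (count-single root? w (dec-true (c w ≟ w) (idem F (r x)))) (∑ℕ.sum-cong-≗ (cong 𝟙 ∘ survives)))

  record Spanning (es : List (Fin m)) : Set where
    field
      label     : Fin N → Fin N
      tree rest : List (Fin m)
      forest    : Forest label tree
      lengths   : length tree + length rest ≡ length es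
      split     : ∀ {x} → x ∈ es → x ∈ tree ⊎ x ∈ rest
      connects  : ∀ {x} → x ∈ es → label (l x) ≡ label (r x)

  spanning : ∀ es → Spanning es
  spanning [] = record { label = c₀ ; tree = [] ; rest = [] ; forest = none ; lengths = refl ; split = λ () ; connects = λ () }
  spanning (x ∷ es) with spanning es
  ... | S with Spanning.label S (l x) ≟ Spanning.label S (r x)
  ...   | yes l≡r = record
      { label = label ; tree = tree ; rest = x ∷ rest ; forest = forest
      ; lengths = trans (ℕₚ.+-suc (length tree) _) (cong suc lengths)
      ; split = λ { (here refl) → inj₂ (here refl) ; (there e) → Data.Sum.map id there (split e) }
      ; connects = λ { (here refl) → l≡r ; (there e) → connects e } }
      where open Spanning S
  ...   | no l≢r = record
      { label = relabel (label (r x)) (label (l x)) ∘ label ; tree = x ∷ tree ; rest = rest ; forest = join forest x l≢r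
      ; lengths = cong suc lengths
      ; split = λ { (here refl) → inj₁ (here refl) ; (there e) → Data.Sum.map there id (split e) }
      ; connects = λ { (here refl) → joined-now {label} l≢r ; (there e) → cong (relabel _ _) (connects e) } }
      where open Spanning S

  -- When `x` joins two components, the potential on the absorbed one is shifted by the constant
  -- that gives `x` its prescribed difference. Earlier edges have both ends in one component, so
  -- their differences persist.
  potential : ∀ {c T} → Forest c T → (g : Fin m → ℤ) →
    ∃ λ (p : Fin N → ℤ) → (∀ {u v} → c₀ u ≡ c₀ v → p u ≡ p v) × (∀ {x} → x ∈ T → p (l x) ℤ.- p (r x) ≡ g x)
  potential none g = const 0ℤ , (λ _ → refl) , λ ()
  potential (join {c} {T} F x l≢r) g with potential F g
  ... | p , p-cong , p-tree = p′ , p′-cong , p′-tree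
    where
    shift : Fin N → ℤ
    shift y = if does (y ≟ c (r x)) then p (l x) ℤ.- p (r x) ℤ.- g x else 0ℤ
    p′ : Fin N → ℤ
    p′ v = p v ℤ.+ shift (c v)
    p′-cong : ∀ {u v} → c₀ u ≡ c₀ v → p′ u ≡ p′ v
    p′-cong eq = cong₂ ℤ._+_ (p-cong eq) (cong shift (coarser F eq))
    cancel : ∀ a b s → (a ℤ.+ s) ℤ.- (b ℤ.+ s) ≡ a ℤ.- b
    cancel = ℤRing.solve-∀
    solve-new : ∀ a b g → (a ℤ.+ 0ℤ) ℤ.- (b ℤ.+ (a ℤ.- b ℤ.- g)) ≡ g
    solve-new = ℤRing.solve-∀
    p′-tree : ∀ {y} → y ∈ (x ∷ T) → p′ (l y) ℤ.- p′ (r y) ≡ g y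
    p′-tree (here refl)
      rewrite dec-false (c (l x) ≟ c (r x)) l≢r | dec-true (c (r x) ≟ c (r x)) refl
      = solve-new (p (l x)) (p (r x)) (g x)
    p′-tree {y} (there y∈T) =
      trans (cong (λ z → (p (l y) ℤ.+ shift z) ℤ.- p′ (r y)) (joined F y∈T))
        (trans (cancel (p (l y)) (p (r y)) (shift (c (r y)))) (p-tree y∈T))

-- Circulations on a plane graph

bit : Bool → ℤ
bit true  = 1ℤ
bit false = 0ℤ

sum-− : (f g : Fin k → ℤ) → ∑ℤ.sum (λ i → f i ℤ.- g i) ≡ ∑ℤ.sum f ℤ.- ∑ℤ.sum g
sum-− {zero}  f g = refl
sum-− {suc k} f g = trans (cong (λ s → f zero ℤ.- g zero ℤ.+ s) (sum-− (f ∘ suc) (g ∘ suc)))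
  (interchange (f zero) (g zero) (∑ℤ.sum (f ∘ suc)) (∑ℤ.sum (g ∘ suc)))
  where
  interchange : ∀ a b s t → a ℤ.- b ℤ.+ (s ℤ.- t) ≡ a ℤ.+ s ℤ.- (b ℤ.+ t)
  interchange = ℤRing.solve-∀

sum-zero : {f : Fin k → ℤ} → (∀ i → f i ≡ 0ℤ) → ∑ℤ.sum f ≡ 0ℤ
sum-zero {k} f≡0 = trans (∑ℤ.sum-cong-≗ f≡0) (∑ℤ.sum-replicate-zero k)

sum-single : (z : Fin k) (f : Fin k → ℤ) → (∀ y → y ≢ z → f y ≡ 0ℤ) → ∑ℤ.sum f ≡ f z
sum-single zero    f f≡0 = trans (cong (λ s → f zero ℤ.+ s) (sum-zero (λ i → f≡0 (suc i) λ ()))) (ℤₚ.+-identityʳ _)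
sum-single (suc z) f f≡0 = trans (cong₂ ℤ._+_ (f≡0 zero λ ()) (sum-single z (f ∘ suc) λ y y≢z → f≡0 (suc y) (y≢z ∘ Finₚ.suc-injective)))
                                 (ℤₚ.+-identityˡ _)

self-negative : ∀ {i} → i ≡ ℤ.- i → i ≡ 0ℤ
self-negative {ℤ.+ zero} _ = refl

length-filter : {P : Fin m → Set} (P? : ∀ x → Dec (P x)) (f : Fin k → Fin m) →
                length (filter P? (tabulate f)) ≡ count (λ i → does (P? (f i)))
length-filter {k = zero}  P? f = refl
length-filter {k = suc k} P? f with does (P? (f zero))
... | true  = cong suc (length-filter P? (f ∘ suc))
... | false = length-filter P? (f ∘ suc)

module Plane (G : PlaneGraph) where
  open PlaneGraph G public

  ϕ : Fin d → Fin d
  ϕ = φ G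

  rev-injective : ∀ x y → rev x ≡ rev y → x ≡ y
  rev-injective x y eq = trans (sym (rev-invol x)) (trans (cong rev eq) (rev-invol y))

  ϕ-injective : ∀ x y → ϕ x ≡ ϕ y → x ≡ y
  ϕ-injective x y eq = rev-injective x y (next-inj _ _ eq)

  ϕ-rev : ∀ x → ϕ (rev x) ≡ next x
  ϕ-rev x = cong next (rev-invol x)

  tail-ϕ : ∀ x → tail (ϕ x) ≡ tail (rev x)
  tail-ϕ x = next-tail (rev x)

  module Faces = Orbits ϕ ϕ-injective
  module Rotation = Orbits next next-inj
  module Reversal = Orbits rev rev-injective

  FaceFunction : {A : Set} → (Fin d → A) → Set
  FaceFunction q = ∀ x → q (ϕ x) ≡ q x

  face-function-iter : ∀ {A : Set} {q : Fin d → A} → FaceFunction q → ∀ k x → q (iter ϕ k x) ≡ q x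
  face-function-iter qϕ zero    x = refl
  face-function-iter qϕ (suc k) x = trans (qϕ _) (face-function-iter qϕ k x)

  next-face : ∀ {A : Set} {q : Fin d → A} → FaceFunction q → ∀ x → q (next x) ≡ q (rev x)
  next-face {q = q} qϕ x = trans (cong q (sym (ϕ-rev x))) (qϕ (rev x))

  -- Connectedness of the dual. Since `next` is `ϕ` after `rev`, `q` is constant around each vertex,
  -- and walks in the graph link the vertices.
  locally-constant : ∀ {A : Set} {q : Fin d → A} → FaceFunction q → (∀ x → q (rev x) ≡ q x) → ∀ x y → q x ≡ q y
  locally-constant {q = q} qϕ qrev x y = along (connected (tail x) (tail y)) x y refl refl
    where
    around : ∀ k x → q (iter next k x) ≡ q x
    around zero    x = refl
    around (suc k) x = trans (trans (next-face qϕ _) (qrev _)) (around k x)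
    same-tail : ∀ x y → tail x ≡ tail y → q x ≡ q y
    same-tail x y eq = let k , it = next-cyc x y eq in trans (sym (around k x)) (cong q it)
    along : ∀ {u v} → Walk tail rev u v → ∀ x y → tail x ≡ u → tail y ≡ v → q x ≡ q y
    along here       x y xu yv = same-tail x y (trans xu (sym yv))
    along (step z w) x y xu yv = trans (same-tail x z xu) (trans (sym (qrev z)) (along w (rev z) y refl yv))

  -- Conservation at every vertex, tested against all vertex weights. An indicator function as
  -- weight gives the net flow out of a vertex set at once.
  Circulation : (Fin d → ℤ) → Set
  Circulation h = ∀ (w : Fin n → ℤ) → ∑ℤ.sum (λ x → w (tail x) ℤ.* h x) ≡ 0ℤ

  Antisymmetric : (Fin d → ℤ) → Set
  Antisymmetric h = ∀ x → h (rev x) ≡ ℤ.- h x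

  δ : (Fin d → ℤ) → Fin d → ℤ
  δ p x = p x ℤ.- p (rev x)

  δ-antisymmetric : ∀ p → Antisymmetric (δ p)
  δ-antisymmetric p x = trans (cong (λ z → p (rev x) ℤ.- p z) (rev-invol x)) (flip (p (rev x)) (p x))
    where
    flip : ∀ a b → a ℤ.- b ≡ ℤ.- (b ℤ.- a)
    flip = ℤRing.solve-∀

  -- Around a vertex the differences telescope, because `rev x` and `next x` lie on the same face.
  -- Globally, `next` merely permutes the summands.
  δ-circulation : ∀ {p} → FaceFunction p → Circulation (δ p)
  δ-circulation {p} pϕ w = begin
    ∑ℤ.sum (λ x → w (tail x) ℤ.* δ p x)          ≡⟨ ∑ℤ.sum-cong-≗ pointwise ⟩
    ∑ℤ.sum (λ x → f x ℤ.- f (next x))            ≡⟨ sum-− f (f ∘ next) ⟩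
    ∑ℤ.sum f ℤ.- ∑ℤ.sum (f ∘ next)               ≡⟨ cong (λ s → ∑ℤ.sum f ℤ.- s) (∑ℤ.sum-permute f Rotation.perm) ⟨
    ∑ℤ.sum f ℤ.- ∑ℤ.sum f                        ≡⟨ ℤₚ.+-inverseʳ (∑ℤ.sum f) ⟩
    0ℤ                                           ∎
    where
    open ≡-Reasoning
    f : Fin d → ℤ
    f x = w (tail x) ℤ.* p x
    distrib : ∀ a b c → a ℤ.* (b ℤ.- c) ≡ a ℤ.* b ℤ.- a ℤ.* c
    distrib = ℤRing.solve-∀
    pointwise : ∀ x → w (tail x) ℤ.* δ p x ≡ f x ℤ.- f (next x)
    pointwise x = trans (distrib (w (tail x)) (p x) (p (rev x)))
      (cong₂ (λ v z → f x ℤ.- w v ℤ.* z) (sym (next-tail x)) (sym (next-face pϕ x)))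

  circulation-− : ∀ {g h} → Circulation g → Circulation h → Circulation (λ x → g x ℤ.- h x)
  circulation-− {g} {h} cg ch w =
    trans (∑ℤ.sum-cong-≗ (λ x → distrib (w (tail x)) (g x) (h x)))
      (trans (sum-− (λ x → w (tail x) ℤ.* g x) (λ x → w (tail x) ℤ.* h x)) (cong₂ ℤ._-_ (cg w) (ch w)))
    where
    distrib : ∀ a b c → a ℤ.* (b ℤ.- c) ≡ a ℤ.* b ℤ.- a ℤ.* c
    distrib = ℤRing.solve-∀

  module Primal = Forests tail (tail ∘ rev) id (λ _ → refl)
  module Dual = Forests id rev Faces.rep Faces.rep-idem

  -- The last edge joined is a bridge of the forest, so the net flow out of one
  -- of the two components it joins is the flow along that edge alone.
  forest-circulation-vanishes : ∀ {c T} → Primal.Forest c T → ∀ {h} → Circulation h → Antisymmetric h →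
    (∀ y → h y ≡ 0ℤ ⊎ y ∈ T ⊎ rev y ∈ T) → ∀ y → h y ≡ 0ℤ
  forest-circulation-vanishes Primal.none circ anti supp y with supp y
  ... | inj₁ h≡0 = h≡0
  ... | inj₂ (inj₁ ())
  ... | inj₂ (inj₂ ())
  forest-circulation-vanishes (Primal.join {c} {T} F x l≢r) {h} circ anti supp =
    forest-circulation-vanishes F circ anti supp′
    where
    A : Fin n → Bool
    A v = does (c v ≟ c (tail (rev x)))

    within across : Fin d → ℤ
    within y = bit (A (tail y)) ℤ.* (bit (A (tail (rev y))) ℤ.* h y)
    across y = bit (A (tail y)) ℤ.* (bit (not (A (tail (rev y)))) ℤ.* h y)

    -- Reversing darts maps the edges inside `A` to themselves and negates their flow, so this sum
    -- is its own negative.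
    within-zero : ∑ℤ.sum within ≡ 0ℤ
    within-zero = self-negative (begin
      ∑ℤ.sum within                            ≡⟨ ∑ℤ.sum-permute within Reversal.perm ⟩
      ∑ℤ.sum (within ∘ rev)                    ≡⟨ ∑ℤ.sum-cong-≗ (λ y → trans (reversed y) (sym (ℤₚ.+-identityˡ _))) ⟩
      ∑ℤ.sum (λ y → 0ℤ ℤ.- within y)           ≡⟨ sum-− (const 0ℤ) within ⟩
      ∑ℤ.sum {d} (const 0ℤ) ℤ.- ∑ℤ.sum within  ≡⟨ cong (ℤ._- ∑ℤ.sum within) (sum-zero {d} (λ _ → refl)) ⟩
      0ℤ ℤ.- ∑ℤ.sum within                     ≡⟨ ℤₚ.+-identityˡ _ ⟩
      ℤ.- ∑ℤ.sum within                        ∎)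
      where
      open ≡-Reasoning
      commute : ∀ a b c → a ℤ.* (b ℤ.* ℤ.- c) ≡ ℤ.- (b ℤ.* (a ℤ.* c))
      commute = ℤRing.solve-∀
      reversed : ∀ y → within (rev y) ≡ ℤ.- within y
      reversed y = trans (cong₂ (λ z b → bit (A (tail (rev y))) ℤ.* (bit (A (tail z)) ℤ.* b)) (rev-invol y) (anti y))
                         (commute (bit (A (tail (rev y)))) (bit (A (tail y))) (h y))

    decompose : ∀ y → bit (A (tail y)) ℤ.* h y ℤ.- within y ≡ across y
    decompose y = bits (A (tail y)) (A (tail (rev y))) (h y)
      where
      one-case : ∀ a → 1ℤ ℤ.* a ℤ.- 1ℤ ℤ.* (1ℤ ℤ.* a) ≡ 1ℤ ℤ.* (0ℤ ℤ.* a)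
      one-case = ℤRing.solve-∀
      two-case : ∀ a → 1ℤ ℤ.* a ℤ.- 1ℤ ℤ.* (0ℤ ℤ.* a) ≡ 1ℤ ℤ.* (1ℤ ℤ.* a)
      two-case = ℤRing.solve-∀
      bits : ∀ b b' a → bit b ℤ.* a ℤ.- bit b ℤ.* (bit b' ℤ.* a) ≡ bit b ℤ.* (bit (not b') ℤ.* a)
      bits false b'    a = refl
      bits true  true  a = one-case a
      bits true  false a = two-case a

    across-zero : ∀ y → y ≢ rev x → across y ≡ 0ℤ
    across-zero y y≢ with c (tail y) ≟ c (tail (rev x)) | c (tail (rev y)) ≟ c (tail (rev x))
    ... | no _ | _ = refl
    ... | yes _ | yes _ = refl
    ... | yes y∈A | no y'∉A with supp y
    ...   | inj₁ h≡0 = cong (λ a → 1ℤ ℤ.* (1ℤ ℤ.* a)) h≡0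
    ...   | inj₂ (inj₁ (here refl)) = contradiction y∈A l≢r
    ...   | inj₂ (inj₁ (there y∈T)) = contradiction (trans (sym (Primal.joined F y∈T)) y∈A) y'∉A
    ...   | inj₂ (inj₂ (here y'≡x)) = contradiction (trans (sym (rev-invol y)) (cong rev y'≡x)) y≢
    ...   | inj₂ (inj₂ (there y'∈T)) =
              contradiction (trans (Primal.joined F y'∈T) (trans (cong (c ∘ tail) (rev-invol y)) y∈A)) y'∉A

    across-x : across (rev x) ≡ h (rev x)
    across-x
      rewrite dec-true (c (tail (rev x)) ≟ c (tail (rev x))) refl
            | dec-false (c (tail (rev (rev x))) ≟ c (tail (rev x))) (λ eq → l≢r (trans (cong (c ∘ tail) (sym (rev-invol x))) eq))
      = trans (ℤₚ.*-identityˡ _) (ℤₚ.*-identityˡ _)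

    h-rev-x : h (rev x) ≡ 0ℤ
    h-rev-x = begin
      h (rev x)                                               ≡⟨ across-x ⟨
      across (rev x)                                          ≡⟨ sum-single (rev x) across across-zero ⟨
      ∑ℤ.sum across                                           ≡⟨ ∑ℤ.sum-cong-≗ decompose ⟨
      ∑ℤ.sum (λ y → bit (A (tail y)) ℤ.* h y ℤ.- within y)    ≡⟨ sum-− (λ y → bit (A (tail y)) ℤ.* h y) within ⟩
      ∑ℤ.sum (λ y → bit (A (tail y)) ℤ.* h y) ℤ.- ∑ℤ.sum within ≡⟨ cong₂ ℤ._-_ (circ (bit ∘ A)) within-zero ⟩
      0ℤ                                                      ∎
      where open ≡-Reasoning

    h-x : h x ≡ 0ℤ
    h-x = trans (cong h (sym (rev-invol x))) (trans (anti (rev x)) (cong ℤ.-_ h-rev-x))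

    supp′ : ∀ y → h y ≡ 0ℤ ⊎ y ∈ T ⊎ rev y ∈ T
    supp′ y with supp y
    ... | inj₁ h≡0 = inj₁ h≡0
    ... | inj₂ (inj₁ (here refl)) = inj₁ h-x
    ... | inj₂ (inj₁ (there y∈T)) = inj₂ (inj₁ y∈T)
    ... | inj₂ (inj₂ (here y'≡x)) = inj₁ (trans (cong h (trans (sym (rev-invol y)) (cong rev y'≡x))) h-rev-x)
    ... | inj₂ (inj₂ (there y'∈T)) = inj₂ (inj₂ y'∈T)

  smaller? : ∀ x → Dec (toℕ x < toℕ (rev x))
  smaller? x = toℕ x ℕₚ.<? toℕ (rev x)

  abstract
    edges : List (Fin d)
    edges = filter smaller? (allFin d)

    edge-or-reverse : ∀ x → x ∈ edges ⊎ rev x ∈ edges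
    edge-or-reverse x with ℕₚ.<-cmp (toℕ x) (toℕ (rev x))
    ... | tri< x<x' _ _ = inj₁ (∈ₚ.∈-filter⁺ smaller? (∈ₚ.∈-allFin x) x<x')
    ... | tri≈ _ x≡x' _ = contradiction (cong tail (sym (Finₚ.toℕ-injective x≡x'))) (no-loop x)
    ... | tri> _ _ x'<x = inj₂ (∈ₚ.∈-filter⁺ smaller? (∈ₚ.∈-allFin (rev x))
                                  (subst (λ z → toℕ (rev x) < toℕ z) (sym (rev-invol x)) x'<x))

    twice-edges : length edges + length edges ≡ d
    twice-edges = begin
      length edges + length edges                  ≡⟨ cong (λ e → e + e) (length-filter smaller? id) ⟩
      count fwd + count fwd                        ≡⟨ cong (count fwd +_) (∑ℕ.sum-permute (𝟙 ∘ fwd) Reversal.perm) ⟩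
      count fwd + count (fwd ∘ rev)                ≡⟨ ∑ℕ.∑-distrib-+ (𝟙 ∘ fwd) (𝟙 ∘ fwd ∘ rev) ⟨
      ∑ℕ.sum (λ x → 𝟙 (fwd x) + 𝟙 (fwd (rev x)))   ≡⟨ ∑ℕ.sum-cong-≗ one-direction ⟩
      ∑ℕ.sum {d} (const 1)                         ≡⟨ count-true d ⟩
      d                                            ∎
      where
      open ≡-Reasoning
      fwd : Fin d → Bool
      fwd = does ∘ smaller?
      one-direction : ∀ x → 𝟙 (fwd x) + 𝟙 (fwd (rev x)) ≡ 1
      one-direction x with ℕₚ.<-cmp (toℕ x) (toℕ (rev x))
      ... | tri< x<x' _ x≮ = cong₂ (λ b c → 𝟙 b + 𝟙 c) (dec-true (smaller? x) x<x')
              (dec-false (smaller? (rev x)) (x≮ ∘ subst (λ z → toℕ (rev x) < toℕ z) (rev-invol x)))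
      ... | tri≈ _ x≡x' _ = contradiction (cong tail (sym (Finₚ.toℕ-injective x≡x'))) (no-loop x)
      ... | tri> x≮x' _ x'<x = cong₂ (λ b c → 𝟙 b + 𝟙 c) (dec-false (smaller? x) x≮x')
              (dec-true (smaller? (rev x)) (subst (λ z → toℕ (rev x) < toℕ z) (sym (rev-invol x)) x'<x))

  module TreeCotree (T : Primal.Spanning edges) (T* : Dual.Spanning (Primal.Spanning.rest T)) where

    module Tree = Primal.Spanning T
    module Cotree = Dual.Spanning T*

    supported-on-tree : ∀ {h} → Antisymmetric h → (∀ {x} → x ∈ Tree.rest → h x ≡ 0ℤ) →
                        ∀ y → h y ≡ 0ℤ ⊎ y ∈ Tree.tree ⊎ rev y ∈ Tree.tree
    supported-on-tree {h} anti off y with edge-or-reverse y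
    ... | inj₁ y∈ with Tree.split y∈
    ...   | inj₁ t = inj₂ (inj₁ t)
    ...   | inj₂ r = inj₁ (off r)
    supported-on-tree {h} anti off y | inj₂ y'∈ with Tree.split y'∈
    ...   | inj₁ t = inj₂ (inj₂ t)
    ...   | inj₂ r = inj₁ (trans (cong h (sym (rev-invol y))) (trans (anti (rev y)) (cong ℤ.-_ (off r))))

    tree-connected : ∀ u v → Tree.label u ≡ Tree.label v
    tree-connected u v = along (connected u v)
      where
      edge : ∀ x → Tree.label (tail x) ≡ Tree.label (tail (rev x))
      edge x with edge-or-reverse x
      ... | inj₁ e = Tree.connects e
      ... | inj₂ e = trans (cong (Tree.label ∘ tail) (sym (rev-invol x))) (sym (Tree.connects e))
      along : ∀ {u v} → Walk tail rev u v → Tree.label u ≡ Tree.label v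
      along here       = refl
      along (step x w) = trans (edge x) (along w)

    -- The boundary of a union of components of the cotree is a circulation
    -- supported on the tree, hence empty.
    cotree-connected : ∀ u v → Cotree.label u ≡ Cotree.label v
    cotree-connected u v = sym (does⇒ (Cotree.label v ≟ Cotree.label u)
      (trans (locally-constant Xϕ Xrev v u) (dec-true (Cotree.label u ≟ Cotree.label u) refl)))
      where
      X : Fin d → Bool
      X x = does (Cotree.label x ≟ Cotree.label u)
      Xϕ : FaceFunction X
      Xϕ x = cong (λ y → does (y ≟ Cotree.label u)) (Dual.coarser Cotree.forest (sym (Faces.rep-cong (1 , refl))))
      bit-injective : ∀ {b c} → bit b ≡ bit c → b ≡ c
      bit-injective {true}  {true}  _ = refl
      bit-injective {false} {false} _ = refl
      Xrev : ∀ x → X (rev x) ≡ X x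
      Xrev x = bit-injective (sym (ℤₚ.i-j≡0⇒i≡j (bit (X x)) (bit (X (rev x)))
        (forest-circulation-vanishes Tree.forest (δ-circulation (cong bit ∘ Xϕ)) (δ-antisymmetric (bit ∘ X))
          (supported-on-tree (δ-antisymmetric (bit ∘ X)) λ {x} r →
            trans (cong (λ y → bit (does (y ≟ Cotree.label u)) ℤ.- bit (X (rev x))) (Cotree.connects r))
                  (ℤₚ.+-inverseʳ (bit (X (rev x))))) x)))

    -- The tree has n - 1 edges and the cotree f - 1. By Euler's formula these are all e = n + f - 2
    -- edges, so none is left over.
    cotree-is-rest : length Cotree.rest ≡ 0
    cotree-is-rest = count-up
      (trans (cong (_+ length Tree.tree) (sym (roots-constant (tail outer) (Primal.idem Tree.forest) tree-connected)))
        (trans (Primal.roots-forest Tree.forest)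
          (roots-id n)))
      (trans (cong (_+ length Cotree.tree) (sym (roots-constant outer (Dual.idem Cotree.forest) cotree-connected)))
        (trans (Dual.roots-forest Cotree.forest) (sym Faces.orbitCount≡reps)))
      Tree.lengths Cotree.lengths twice-edges euler
      where
      count-up : ∀ {t r t₂ r₂ e d n f} → 1 + t ≡ n → 1 + t₂ ≡ f → t + r ≡ e → t₂ + r₂ ≡ r →
                 e + e ≡ d → 2 * n + 2 * f ≡ d + 4 → r₂ ≡ 0
      count-up {t} {_} {t₂} {r₂} refl refl refl refl refl eq =
        ℕₚ.m+n≡0⇒m≡0 r₂ (ℕₚ.+-cancelˡ-≡ (2 * t + 2 * t₂ + 4) _ _ (trans (lhs t t₂ r₂) (trans (sym eq) (rhs t t₂))))
        where
        lhs : ∀ t t₂ r₂ → 2 * t + 2 * t₂ + 4 + (r₂ + r₂) ≡ t + (t₂ + r₂) + (t + (t₂ + r₂)) + 4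
        lhs = ℕRing.solve-∀
        rhs : ∀ t t₂ → 2 * (1 + t) + 2 * (1 + t₂) ≡ 2 * t + 2 * t₂ + 4 + 0
        rhs = ℕRing.solve-∀

    -- A potential can be prescribed along the cotree so that its coboundary agrees with `h` there.
    -- The difference is a circulation supported on the tree, hence zero.
    coboundary : ∀ {h} → Circulation h → Antisymmetric h →
                                ∃ λ p → FaceFunction p × (∀ x → h x ≡ p x ℤ.- p (rev x))
    coboundary {h} circ anti = p , pϕ , λ x → ℤₚ.i-j≡0⇒i≡j (h x) (δ p x)
        (forest-circulation-vanishes Tree.forest (circulation-− circ (δ-circulation pϕ)) anti-diff
          (supported-on-tree anti-diff off) x)
      where
      pot = Dual.potential Cotree.forest h
      p = proj₁ pot
      p-tree = proj₂ (proj₂ pot)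
      pϕ : FaceFunction p
      pϕ x = proj₁ (proj₂ pot) (sym (Faces.rep-cong (1 , refl)))
      negate : ∀ a b → ℤ.- a ℤ.- ℤ.- b ≡ ℤ.- (a ℤ.- b)
      negate = ℤRing.solve-∀
      anti-diff : Antisymmetric (λ x → h x ℤ.- δ p x)
      anti-diff x = trans (cong₂ ℤ._-_ (anti x) (δ-antisymmetric p x)) (negate (h x) (δ p x))
      empty : ∀ {x} (xs : List (Fin d)) → length xs ≡ 0 → ¬ x ∈ xs
      empty [] _ ()
      off : ∀ {x} → x ∈ Tree.rest → h x ℤ.- δ p x ≡ 0ℤ
      off {x} r with Cotree.split r
      ... | inj₁ t = ℤₚ.i≡j⇒i-j≡0 (sym (p-tree t))
      ... | inj₂ t = contradiction t (empty Cotree.rest cotree-is-rest)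

  circulation-is-coboundary : ∀ {h} → Circulation h → Antisymmetric h →
                              ∃ λ p → FaceFunction p × (∀ x → h x ≡ p x ℤ.- p (rev x))
  circulation-is-coboundary = TreeCotree.coboundary (Primal.spanning edges) (Dual.spanning _)

-- Cycles and perfect matchings

-- If two iterates below the least period coincided, continuing both to the end of the period would
-- give an earlier return to `w`.
minimal-period : (f : Fin k → Fin k) (w : Fin k) → ∀ {P₀} → P₀ < k → iter f (suc P₀) w ≡ w →
  ∃ λ P → iter f (suc P) w ≡ w × (∀ a b → a < suc P → b < suc P → iter f a w ≡ iter f b w → a ≡ b)
minimal-period {k} f w P₀<k fix₀ with
  least (λ (P : Fin k) → iter f (suc (toℕ P)) w ≟ w)
        (fromℕ< P₀<k , trans (cong (λ j → iter f (suc j) w) (Finₚ.toℕ-fromℕ< P₀<k)) fix₀)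
... | P , fix , minimal = toℕ P , fix , distinct-iterates
  where
  ordered : ∀ a b → a < b → b < suc (toℕ P) → iter f a w ≡ iter f b w → ⊥
  ordered a b a<b b≤P eq = ℕₚ.<⇒≱ c<P (subst (toℕ P ≤_) (Finₚ.toℕ-fromℕ< c<k)
      (minimal (fromℕ< c<k) (trans (cong (λ j → iter f (suc j) w) (Finₚ.toℕ-fromℕ< c<k)) returns)))
    where
    e = toℕ P ∸ b
    P≡ : e + b ≡ toℕ P
    P≡ = ℕₚ.m∸n+n≡m (ℕₚ.≤-pred b≤P)
    c = e + a
    c<P : c < toℕ P
    c<P = subst (c <_) P≡ (ℕₚ.+-monoʳ-< e a<b)
    c<k : c < k
    c<k = ℕₚ.<-trans c<P (Finₚ.toℕ<n P)
    returns : iter f (suc c) w ≡ w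
    returns = trans (cong f (trans (iter-+ f e a w) (trans (cong (iter f e) eq) (sym (iter-+ f e b w)))))
                    (trans (cong (λ j → iter f (suc j) w) P≡) fix)
  distinct-iterates : ∀ a b → a < suc (toℕ P) → b < suc (toℕ P) → iter f a w ≡ iter f b w → a ≡ b
  distinct-iterates a b a< b< eq with ℕₚ.<-cmp a b
  ... | tri< a<b _ _ = ⊥-elim (ordered a b a<b b< eq)
  ... | tri≈ _ a≡b _ = a≡b
  ... | tri> _ _ b<a = ⊥-elim (ordered b a b<a a< (sym eq))

module CycleFacts (G : PlaneGraph) (C : Cycle G) where
  open Plane G

  private
    L = len C
    D = dart C

    instance
      L-nonZero : NonZero L
      L-nonZero = >-nonZero (ℕₚ.≤-trans (s≤s z≤n) (len≥3 C))

  VertexOf : Fin n → Set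
  VertexOf v = ∃ λ i → tail (D i) ≡ v

  predecessor : ∀ i → ∃ λ j → D (suc j) ≡ D i
  predecessor i = i + pred L ,
    trans (cong D (trans (sym (ℕₚ.+-suc i _)) (cong (i +_) (ℕₚ.suc-pred L)))) (periodic C i)

  dart-+* : ∀ q r → D (r + q * L) ≡ D r
  dart-+* zero    r = cong D (ℕₚ.+-identityʳ r)
  dart-+* (suc q) r = trans (cong D (trans (cong (r +_) (ℕₚ.+-comm L (q * L))) (sym (ℕₚ.+-assoc r (q * L) L))))
                            (trans (periodic C _) (dart-+* q r))

  dart-% : ∀ i → D i ≡ D (i % L)
  dart-% i = trans (cong D (m≡m%n+[m/n]*n i L)) (dart-+* (i / L) (i % L))

  tail-injective-% : ∀ i j → tail (D i) ≡ tail (D j) → i % L ≡ j % L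
  tail-injective-% i j eq = distinct C (i % L) (j % L) (m%n<n i L) (m%n<n j L)
    (trans (cong tail (sym (dart-% i))) (trans eq (cong tail (dart-% j))))

  outgoing-unique : ∀ i j → tail (D i) ≡ tail (D j) → D i ≡ D j
  outgoing-unique i j eq = trans (dart-% i) (trans (cong D (tail-injective-% i j eq)) (sym (dart-% j)))

  incoming-unique : ∀ i j → tail (rev (D i)) ≡ tail (rev (D j)) → D i ≡ D j
  incoming-unique i j eq = trans (shift i) (trans (dart-% _) (trans (cong D same) (trans (sym (dart-% _)) (sym (shift j)))))
    where
    -- Modulo `L`, adding `pred L` undoes a successor. So uniqueness of incoming darts reduces to
    -- that of the outgoing darts one step later.
    l = pred L
    shift : ∀ i → D i ≡ D (suc i + l)
    shift i = sym (trans (cong D (trans (sym (ℕₚ.+-suc i l)) (cong (i +_) (ℕₚ.suc-pred L)))) (periodic C i))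
    suc-same : suc i % L ≡ suc j % L
    suc-same = tail-injective-% (suc i) (suc j) (trans (consec C i) (trans eq (sym (consec C j))))
    same : (suc i + l) % L ≡ (suc j + l) % L
    same = trans (%-distribˡ-+ (suc i) l L) (trans (cong (λ r → (r + l % L) % L) suc-same) (sym (%-distribˡ-+ (suc j) l L)))

  onCycle-rev : ∀ {x} → OnCycle G C x → OnCycle G C (rev x)
  onCycle-rev {x} (i , inj₁ eq) = i , inj₂ (trans (rev-invol x) eq)
  onCycle-rev {x} (i , inj₂ eq) = i , inj₁ eq

  onCycle-unrev : ∀ {x} → OnCycle G C (rev x) → OnCycle G C x
  onCycle-unrev {x} on = subst (OnCycle G C) (rev-invol x) (onCycle-rev on)

  onCycle-vertex : ∀ {x} → OnCycle G C x → VertexOf (tail x)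
  onCycle-vertex (i , inj₁ refl) = i , refl
  onCycle-vertex {x} (i , inj₂ eq) =
    suc i , trans (consec C i) (cong tail (trans (cong rev (sym eq)) (rev-invol x)))

  onCycle-at : ∀ {z} j → OnCycle G C z → tail z ≡ tail (D (suc j)) → z ≡ D (suc j) ⊎ z ≡ rev (D j)
  onCycle-at j (i , inj₁ refl) eq = inj₁ (outgoing-unique i (suc j) eq)
  onCycle-at {z} j (i , inj₂ z'≡) eq = inj₂ (trans z≡ (cong rev (incoming-unique i j
      (trans (cong tail (sym z≡)) (trans eq (consec C j))))))
    where
    z≡ : z ≡ rev (D i)
    z≡ = trans (sym (rev-invol z)) (cong rev z'≡)

module PerfectMatching (G : PlaneGraph) {M : Fin (PlaneGraph.d G) → Bool} (pm : IsPM G (Whole G) M) where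
  open Plane G

  M-rev : ∀ x → M (rev x) ≡ M x
  M-rev = proj₁ (proj₂ pm)

  private
    at : ∀ v → ∃ λ x → tail x ≡ v × M x ≡ true × (∀ y → tail y ≡ v → M y ≡ true → y ≡ x)
    at v = proj₁ (proj₂ (proj₂ pm)) v tt

  mate : Fin n → Fin d
  mate v = proj₁ (at v)

  mate-tail : ∀ v → tail (mate v) ≡ v
  mate-tail v = proj₁ (proj₂ (at v))

  mate-M : ∀ v → M (mate v) ≡ true
  mate-M v = proj₁ (proj₂ (proj₂ (at v)))

  mate-unique : ∀ {y} → M y ≡ true → y ≡ mate (tail y)
  mate-unique {y} My = proj₂ (proj₂ (proj₂ (at (tail y)))) y refl My

  M-unique : ∀ {x y} → M x ≡ true → M y ≡ true → tail x ≡ tail y → x ≡ y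
  M-unique Mx My eq = trans (mate-unique Mx) (trans (cong mate eq) (sym (mate-unique My)))

  -- Each vertex is the tail of exactly one matching dart. The sum therefore does not depend on the
  -- matching, which makes the difference of two matchings conserve flow.
  matching-sum : ∀ (w : Fin n → ℤ) → ∑ℤ.sum (λ x → w (tail x) ℤ.* bit (M x)) ≡ ∑ℤ.sum w
  matching-sum w = begin
    ∑ℤ.sum (λ x → w (tail x) ℤ.* bit (M x))           ≡⟨ ∑ℤ.sum-cong-≗ row ⟩
    ∑ℤ.sum (λ x → ∑ℤ.sum (λ v → hit x v))             ≡⟨ ∑ℤ.∑-comm hit ⟩
    ∑ℤ.sum (λ v → ∑ℤ.sum (λ x → hit x v))             ≡⟨ ∑ℤ.sum-cong-≗ column ⟩
    ∑ℤ.sum w                                          ∎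
    where
    open ≡-Reasoning
    hit : Fin d → Fin n → ℤ
    hit x v = w v ℤ.* bit (does (mate v ≟ x))
    miss : ∀ x v → mate v ≢ x → hit x v ≡ 0ℤ
    miss x v ≢x rewrite dec-false (mate v ≟ x) ≢x = ℤₚ.*-zeroʳ (w v)
    row : ∀ x → w (tail x) ℤ.* bit (M x) ≡ ∑ℤ.sum (hit x)
    row x with M x in Mx
    ... | true = trans (cong (λ b → w (tail x) ℤ.* bit b) (sym (dec-true (mate (tail x) ≟ x) (sym (mate-unique Mx)))))
                   (sym (sum-single (tail x) (hit x) λ v v≢ → miss x v λ m≡x → v≢ (trans (sym (mate-tail v)) (cong tail m≡x))))
    ... | false = trans (ℤₚ.*-zeroʳ (w (tail x)))
                    (sym (sum-zero λ v → miss x v λ m≡x → true≢false (trans (sym (mate-M v)) (trans (cong M m≡x) Mx))))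
    column : ∀ v → ∑ℤ.sum (λ x → hit x v) ≡ w v
    column v = trans (sum-single (mate v) (λ x → hit x v) (λ x x≢ → miss x v (x≢ ∘ sym)))
                 (trans (cong (λ b → w v ℤ.* bit b) (dec-true (mate v ≟ mate v) refl)) (ℤₚ.*-identityʳ (w v)))

  mate-onCycle : ∀ {C : Cycle G} → Alternating G C M → ∀ {v} → CycleFacts.VertexOf G C v → OnCycle G C (mate v)
  mate-onCycle {C} alt {v} (i , iv) with CycleFacts.predecessor G C i
  ... | j , j≡ with M (dart C (suc j)) in My
  ...   | true = suc j , inj₁ (sym (trans (mate-unique My) (cong mate (trans (cong tail j≡) iv))))
  ...   | false = j , inj₂ (trans (cong rev (sym (trans (mate-unique (trans (M-rev (dart C j)) Mj))
                    (cong mate (trans (sym (consec C j)) (trans (cong tail j≡) iv)))))) (rev-invol _))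
    where
    Mj : M (dart C j) ≡ true
    Mj = Boolₚ.not-injective (trans (sym (alt j)) My)

  module Flip {C : Cycle G} (alt : Alternating G C M) (on? : ∀ x → Dec (OnCycle G C x)) where
    open CycleFacts G C

    flip : Fin d → Bool
    flip x = M x xor does (on? x)

    flip-on : ∀ {x} → OnCycle G C x → flip x ≡ not (M x)
    flip-on {x} on = trans (cong (M x xor_) (dec-true (on? x) on)) (Boolₚ.xor-comm (M x) true)

    flip-off : ∀ {x} → ¬ OnCycle G C x → flip x ≡ M x
    flip-off {x} off = trans (cong (M x xor_) (dec-false (on? x) off)) (Boolₚ.xor-identityʳ (M x))

    flip-alternating : Alternating G C flip
    flip-alternating i = trans (flip-on (suc i , inj₁ refl)) (cong not (trans (alt i) (sym (flip-on (i , inj₁ refl)))))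

    flip-rev : ∀ x → flip (rev x) ≡ flip x
    flip-rev x with on? x
    ... | yes on = trans (flip-on (onCycle-rev on)) (trans (cong not (M-rev x)) (Boolₚ.xor-comm true (M x)))
    ... | no off = trans (flip-off (off ∘ onCycle-unrev)) (trans (M-rev x) (sym (Boolₚ.xor-identityʳ (M x))))

    flip-at : ∀ v → ∃ λ x → tail x ≡ v × flip x ≡ true × (∀ y → tail y ≡ v → flip y ≡ true → y ≡ x)
    flip-at v with on? (mate v)
    ... | no off = mate v , mate-tail v , trans (flip-off off) (mate-M v) , unique
      where
      unique : ∀ y → tail y ≡ v → flip y ≡ true → y ≡ mate v
      unique y yv fy with on? y
      ... | no offy = trans (mate-unique (trans (sym (Boolₚ.xor-identityʳ (M y))) fy)) (cong mate yv)
      ... | yes ony = contradiction (subst (OnCycle G C ∘ mate) yv (mate-onCycle {C} alt (onCycle-vertex ony))) off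
    flip-at v | yes on with onCycle-vertex on
    ... | i , iv with predecessor i
    ...   | j , j≡ = flipped
      where
      y = dart C (suc j)
      r = rev (dart C j)
      y-at : tail y ≡ v
      y-at = trans (cong tail j≡) (trans iv (mate-tail v))
      r-at : tail r ≡ v
      r-at = trans (sym (consec C j)) y-at
      y-on : OnCycle G C y
      y-on = suc j , inj₁ refl
      r-on : OnCycle G C r
      r-on = onCycle-rev (j , inj₁ refl)
      My≡ : M y ≡ not (M r)
      My≡ = trans (alt j) (cong not (sym (M-rev _)))
      on-only : ∀ {z} → tail z ≡ v → flip z ≡ true → OnCycle G C z
      on-only {z} zv fz with on? z
      ... | yes onz = onz
      ... | no offz = subst (OnCycle G C) (sym (trans (mate-unique (trans (sym (Boolₚ.xor-identityʳ (M z))) fz)) (cong mate zv))) on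
      clash : ∀ {z} → OnCycle G C z → M z ≡ true → flip z ≡ true → ⊥
      clash onz Mz fz = true≢false (trans (sym fz) (trans (flip-on onz) (cong not Mz)))
      flipped : ∃ λ x → tail x ≡ v × flip x ≡ true × (∀ z → tail z ≡ v → flip z ≡ true → z ≡ x)
      flipped with M r in Mr
      ... | true = y , y-at , trans (flip-on y-on) (cong not (trans My≡ (cong not Mr))) ,
          λ z zv fz → [ id , (λ z≡r → ⊥-elim (clash r-on Mr (trans (cong flip (sym z≡r)) fz))) ]′
                        (onCycle-at j (on-only zv fz) (trans zv (sym y-at)))
      ... | false = r , r-at , trans (flip-on r-on) (cong not Mr) ,
          λ z zv fz → [ (λ z≡y → ⊥-elim (clash y-on (trans My≡ (cong not Mr)) (trans (cong flip (sym z≡y)) fz))) , id ]′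
                        (onCycle-at j (on-only zv fz) (trans zv (sym y-at)))

    flip-pm : IsPM G (Whole G) flip
    flip-pm = (λ _ _ → tt) , flip-rev , (λ v _ → flip-at v) , λ v ¬⊤ → ⊥-elim (¬⊤ tt)

-- Forcing sets and alternating cycles from the dual digraph

eventual-cycle : (f : Fin k → Fin k) (v : Fin k) → ∃ λ i → ∃ λ P →
  iter f (suc P) (iter f i v) ≡ iter f i v ×
  (∀ a b → a < suc P → b < suc P → iter f a (iter f i v) ≡ iter f b (iter f i v) → a ≡ b)
eventual-cycle f v =
  let i , P₀ , bound , eq = iter-repeats f v
  in i , minimal-period f (iter f i v) (ℕₚ.m+n≤o⇒n≤o i bound)
           (trans (sym (iter-+ f (suc P₀) i v)) (trans (cong (λ j → iter f j v) (ℕₚ.+-comm (suc P₀) i)) eq))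

lookup-all : {A : Set} {P : A → Set} {xs : List A} → (∀ {x} → x ∈ xs → P x) → ∀ i → P (lookup xs i)
lookup-all {xs = xs} h i = h (∈ₚ.∈-lookup {xs = xs} i)

all-lookup : {A : Set} {P : A → Set} {xs : List A} → (∀ i → P (lookup xs i)) → ∀ {x} → x ∈ xs → P x
all-lookup {P = P} h (here refl) = h zero
all-lookup {P = P} h (there x∈)  = all-lookup {P = P} (h ∘ suc) x∈

module BipartitePlane (G : PlaneGraph) (bip : Bipartite G) where
  open Plane G

  col : Fin n → Bool
  col = proj₁ bip

  col-rev : ∀ x → col (tail (rev x)) ≡ not (col (tail x))
  col-rev = proj₂ bip

  sign : Bool → ℤ
  sign true  = 1ℤ
  sign false = ℤ.- 1ℤ

  -- Indicators of matchings are symmetric under `rev`. The sign of the colour class makes their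
  -- difference antisymmetric, as a flow should be.
  flow : (M M' : Fin d → Bool) → Fin d → ℤ
  flow M M' x = sign (col (tail x)) ℤ.* (bit (M x) ℤ.- bit (M' x))

  flow-circulation : ∀ {M M'} → IsPM G (Whole G) M → IsPM G (Whole G) M' → Circulation (flow M M')
  flow-circulation {M} {M'} pm pm' w = begin
    ∑ℤ.sum (λ x → w (tail x) ℤ.* flow M M' x)
      ≡⟨ ∑ℤ.sum-cong-≗ (λ x → expand (w (tail x)) (sign (col (tail x))) (bit (M x)) (bit (M' x))) ⟩
    ∑ℤ.sum (λ x → w′ (tail x) ℤ.* bit (M x) ℤ.- w′ (tail x) ℤ.* bit (M' x))
      ≡⟨ sum-− (λ x → w′ (tail x) ℤ.* bit (M x)) (λ x → w′ (tail x) ℤ.* bit (M' x)) ⟩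
    ∑ℤ.sum (λ x → w′ (tail x) ℤ.* bit (M x)) ℤ.- ∑ℤ.sum (λ x → w′ (tail x) ℤ.* bit (M' x))
      ≡⟨ cong₂ ℤ._-_ (PerfectMatching.matching-sum G pm w′) (PerfectMatching.matching-sum G pm' w′) ⟩
    ∑ℤ.sum w′ ℤ.- ∑ℤ.sum w′
      ≡⟨ ℤₚ.+-inverseʳ (∑ℤ.sum w′) ⟩
    0ℤ ∎
    where
    open ≡-Reasoning
    w′ : Fin n → ℤ
    w′ v = w v ℤ.* sign (col v)
    expand : ∀ a s b c → a ℤ.* (s ℤ.* (b ℤ.- c)) ≡ a ℤ.* s ℤ.* b ℤ.- a ℤ.* s ℤ.* c
    expand = ℤRing.solve-∀

  flow-antisymmetric : ∀ {M M'} → (∀ x → M (rev x) ≡ M x) → (∀ x → M' (rev x) ≡ M' x) → Antisymmetric (flow M M')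
  flow-antisymmetric {M} {M'} M-rev M'-rev x
    rewrite col-rev x | M-rev x | M'-rev x = negate (col (tail x)) (bit (M x) ℤ.- bit (M' x))
    where
    neg : ∀ a → ℤ.- 1ℤ ℤ.* a ≡ ℤ.- (1ℤ ℤ.* a)
    neg = ℤRing.solve-∀
    pos : ∀ a → 1ℤ ℤ.* a ≡ ℤ.- (ℤ.- 1ℤ ℤ.* a)
    pos = ℤRing.solve-∀
    negate : ∀ b a → sign (not b) ℤ.* a ≡ ℤ.- (sign b ℤ.* a)
    negate true  = neg
    negate false = pos

  flow-potential : ∀ {M M'} → IsPM G (Whole G) M → IsPM G (Whole G) M' →
                   ∃ λ p → FaceFunction p × (∀ x → flow M M' x ≡ p x ℤ.- p (rev x))
  flow-potential pm pm' = circulation-is-coboundary (flow-circulation pm pm')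
    (flow-antisymmetric (PerfectMatching.M-rev G pm) (PerfectMatching.M-rev G pm'))

  flow-equal : ∀ M M' {x} → M' x ≡ M x → flow M M' x ≡ 0ℤ
  flow-equal M M' {x} eq rewrite eq =
    trans (cong (sign (col (tail x)) ℤ.*_) (ℤₚ.+-inverseʳ (bit (M x)))) (ℤₚ.*-zeroʳ (sign (col (tail x))))

  flow-zero : ∀ {M M' x} → flow M M' x ≡ 0ℤ → M x ≡ M' x
  flow-zero {M} {M'} {x} eq = bits (col (tail x)) (M x) (M' x) eq
    where
    bits : ∀ c a b → sign c ℤ.* (bit a ℤ.- bit b) ≡ 0ℤ → a ≡ b
    bits _     true  true  _ = refl
    bits _     false false _ = refl
    bits true  true  false ()
    bits true  false true  ()
    bits false true  false ()
    bits false false true  ()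

  module Directed {M : Fin d → Bool} (pm : IsPM G (Whole G) M) where
    open PerfectMatching G pm

    -- Matching edges are directed from colour true to colour false, all other
    -- edges the other way, so that alternating cycles become directed cycles.
    Forward : Fin d → Set
    Forward x = M x ≡ col (tail x)

    directed? : ∀ x → Dec (Forward x)
    directed? x = M x Boolₚ.≟ col (tail x)

    forward-exclusive : ∀ {x} → Forward x → ¬ Forward (rev x)
    forward-exclusive {x} fx fx' =
      Boolₚ.not-¬ fx (trans (sym (M-rev x)) (trans fx' (col-rev x)))

    forward-either : ∀ {x} → ¬ Forward x → Forward (rev x)
    forward-either {x} ¬fx = trans (M-rev x) (trans (Boolₚ.¬-not ¬fx) (sym (col-rev x)))

    Closed : Sub d → Set
    Closed U = FaceFunction U × (∀ x → Forward x → U (rev x) ≡ true → U x ≡ true)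

    Crossing : Sub d → Fin d → Set
    Crossing U x = Forward x × U x ≡ true × U (rev x) ≡ false

    -- The dual arc of a forward dart leads from the face of `rev x` to that of `x`. A backward dart
    -- becomes a loop, which enters no set, so all darts can serve as arcs.
    src : Fin d → Fin d
    src x = if does (directed? x) then rev x else x

    ∩-closed : ∀ {U W} → Closed U → Closed W → Closed (U ∩ W)
    ∩-closed (Uϕ , U⇐) (Wϕ , W⇐) = (λ x → cong₂ _∧_ (Uϕ x) (Wϕ x)) ,
      λ x fx h → let u , w = ∧-true h in cong₂ _∧_ (U⇐ x fx u) (W⇐ x fx w)

    ∪-closed : ∀ {U W} → Closed U → Closed W → Closed (U ∪ W)
    ∪-closed {U} {W} (Uϕ , U⇐) (Wϕ , W⇐) = (λ x → cong₂ _∨_ (Uϕ x) (Wϕ x)) , back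
      where
      back : ∀ x → Forward x → (U ∪ W) (rev x) ≡ true → (U ∪ W) x ≡ true
      back x fx h with U (rev x) in u
      ... | true  = cong (_∨ W x) (U⇐ x fx u)
      ... | false = trans (cong (U x ∨_) (W⇐ x fx h)) (Boolₚ.∨-zeroʳ (U x))

    no-exit : ∀ {U} → Closed U → ∀ x → U (src x) ≡ true → U x ≡ true
    no-exit (_ , U⇐) x h with directed? x
    ... | yes fx = U⇐ x fx h
    ... | no  _  = h

    crossing-direction : ∀ {U} → Closed U → ∀ {x} → U x ≡ true → U (rev x) ≡ false → Crossing U x
    crossing-direction {U} (_ , U⇐) {x} Ux ¬Ux' with directed? x
    ... | yes fx = fx , Ux , ¬Ux'
    ... | no ¬fx = contradiction
      (trans (sym (U⇐ (rev x) (forward-either ¬fx) (trans (cong U (rev-invol x)) Ux))) ¬Ux') true≢false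

    enters⇒crossing : ∀ {U x} → U x ∧ not (U (src x)) ≡ true → Crossing U x
    enters⇒crossing {U} {x} h with U x in Ux | directed? x
    ... | true | yes fx = fx , refl , Boolₚ.not-injective h
    ... | true | no  _  = contradiction (trans (sym h) (cong not Ux)) true≢false

    crossing⇒enters : ∀ {U x} → Crossing U x → U x ∧ not (U (src x)) ≡ true
    crossing⇒enters {U} {x} (fx , Ux , ¬Ux') with directed? x
    ... | yes _  = cong₂ (λ b c → b ∧ not c) Ux ¬Ux'
    ... | no ¬fx = contradiction fx ¬fx

    crossing-exists : ∀ {U} → Closed U → Nontrivial U → ∃ (Crossing U)
    crossing-exists {U} cU ((x , Ux) , (y , ¬Uy)) with Finₚ.all? (λ z → U (rev z) Boolₚ.≟ U z)
    ... | yes same = contradiction (trans (sym Ux) (trans (locally-constant (proj₁ cU) same x y) ¬Uy)) true≢false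
    ... | no ¬same with Finₚ.¬∀⟶∃¬ d _ (λ z → U (rev z) Boolₚ.≟ U z) ¬same
    ...   | z , differ with U z in Uz
    ...     | true  = z , crossing-direction cU Uz (≢true⇒≡false differ)
    ...     | false = rev z , crossing-direction cU (Boolₚ.¬-not differ) (trans (cong U (rev-invol z)) Uz)

    entered-by-some : ∀ {U} → Closed U → Nontrivial U → ∃ λ x → U x ∧ not (U (src x)) ≡ true
    entered-by-some {U} cU ntU = let x , cr = crossing-exists {U} cU ntU in x , crossing⇒enters {U} cr

    module Dicut = LucchesiYounger src id Closed
      (λ {U} {W} → ∩-closed {U} {W}) (λ {U} {W} → ∪-closed {U} {W}) (λ {U} → no-exit {U})
      (λ {U} → entered-by-some {U})

    -- The orientation makes the flow from `M` to any other matching nonnegative along forward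
    -- darts. This is why upper level sets of its potential are closed.
    forward-flow : ∀ {M' x} → Forward x → flow M M' x ≡ bit (M x xor M' x)
    forward-flow {M'} {x} fx rewrite sym fx = bits (M x) (M' x)
      where
      bits : ∀ a b → sign a ℤ.* (bit a ℤ.- bit b) ≡ bit (a xor b)
      bits true  true  = refl
      bits true  false = refl
      bits false true  = refl
      bits false false = refl

    -- A dijoin may contain non-matching edges, but a forcing set may not. Fixing the matching edge
    -- at the head of such an edge excludes that edge from every matching that contains the fixed
    -- one.
    toMatching : Fin d → Fin d
    toMatching x = if M x then x else mate (tail (rev x))

    toMatching-M : ∀ x → M (toMatching x) ≡ true
    toMatching-M x with M x in Mx
    ... | true  = Mx
    ... | false = mate-M _

    toMatching-forces : ∀ {M'} → IsPM G (Whole G) M' → ∀ x → M' (toMatching x) ≡ true → M' x ≡ M x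
    toMatching-forces {M'} pm' x h with M x in Mx
    ... | true  = h
    ... | false = ≢true⇒≡false λ M'x → true≢false (trans (sym (mate-M (tail (rev x))))
        (trans (cong M (PerfectMatching.M-unique G pm' h (trans (PerfectMatching.M-rev G pm' x) M'x) (mate-tail _)))
               (trans (M-rev x) Mx)))

    -- If M' ≠ M agrees with M on S, then an upper level set of the potential of
    -- the flow M - M' is a closed set that no arc of S enters.
    cover-forces : ∀ {S} → Dicut.Covers (const false) S → Forcing G M (map toMatching S)
    cover-forces {S} covers =
      lookup-all {xs = map toMatching S} (λ y∈ → let x , _ , y≡ = ∈ₚ.∈-map⁻ toMatching y∈ in trans (cong M y≡) (toMatching-M x)) ,
      λ M' pm' agree x → decidable-stable (M' x Boolₚ.≟ M x) (unequal pm' (all-lookup {P = λ y → M' y ≡ true} agree) x)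
      where
      module _ {M' : Fin d → Bool} (pm' : IsPM G (Whole G) M') (agree : ∀ {y} → y ∈ map toMatching S → M' y ≡ true) where
        pot = flow-potential pm pm'
        p = proj₁ pot

        forward-unequal : ∀ x → Forward x → ¬ M' x ≢ M x
        forward-unequal x fx M'≢M =
          let a , a∈S , ea = covers {U} ((Uϕ , U⇐) , λ _ ()) ((x , Ux) , (rev x , ¬Ux'))
              _ , Ua , ¬Ua' = enters⇒crossing {U} ea
              M'a≡Ma = toMatching-forces pm' a (agree (∈ₚ.∈-map⁺ toMatching a∈S))
          in does⇏ (p x ℤₚ.≤? p (rev a)) ¬Ua' (subst (p x ℤ.≤_)
               (ℤₚ.i-j≡0⇒i≡j (p a) (p (rev a)) (trans (sym (proj₂ (proj₂ pot) a)) (flow-equal M M' M'a≡Ma)))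
               (does⇒ (p x ℤₚ.≤? p a) Ua))
          where
          U : Sub d
          U y = does (p x ℤₚ.≤? p y)
          Uϕ : FaceFunction U
          Uϕ y = cong (λ i → does (p x ℤₚ.≤? i)) (proj₁ (proj₂ pot) y)
          climb : ∀ y → Forward y → p y ≡ bit (M y xor M' y) ℤ.+ p (rev y)
          climb y fy = trans (recover (p y) (p (rev y)))
            (cong (ℤ._+ p (rev y)) (trans (sym (proj₂ (proj₂ pot) y)) (forward-flow {M'} fy)))
            where
            recover : ∀ a b → a ≡ a ℤ.- b ℤ.+ b
            recover = ℤRing.solve-∀
          bit≥0 : ∀ b → 0ℤ ℤ.≤ bit b
          bit≥0 true  = ℤ.+≤+ z≤n
          bit≥0 false = ℤ.+≤+ z≤n
          U⇐ : ∀ y → Forward y → U (rev y) ≡ true → U y ≡ true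
          U⇐ y fy h = dec-true (p x ℤₚ.≤? p y) (ℤₚ.≤-trans (does⇒ (p x ℤₚ.≤? p (rev y)) h)
            (subst (p (rev y) ℤ.≤_) (sym (climb y fy))
              (subst (ℤ._≤ bit (M y xor M' y) ℤ.+ p (rev y)) (ℤₚ.+-identityˡ (p (rev y)))
                (ℤₚ.+-monoˡ-≤ (p (rev y)) (bit≥0 (M y xor M' y))))))
          Ux : U x ≡ true
          Ux = dec-true (p x ℤₚ.≤? p x) ℤₚ.≤-refl
          differ : ∀ a b → b ≢ a → a xor b ≡ true
          differ true  b b≢a = cong not (Boolₚ.¬-not b≢a)
          differ false b b≢a = Boolₚ.¬-not b≢a
          ¬Ux' : U (rev x) ≡ false
          ¬Ux' = dec-false (p x ℤₚ.≤? p (rev x)) (ℤₚ.<⇒≱ (subst (p (rev x) ℤ.<_)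
            (sym (trans (climb x fx) (cong (λ b → bit b ℤ.+ p (rev x)) (differ (M x) (M' x) M'≢M)))) (ℤₚ.suc[i]≤j⇒i<j ℤₚ.≤-refl)))

        unequal : ∀ x → ¬ M' x ≢ M x
        unequal x M'≢M with directed? x
        ... | yes fx = forward-unequal x fx M'≢M
        ... | no ¬fx = forward-unequal (rev x) (forward-either ¬fx)
                λ eq → M'≢M (trans (sym (PerfectMatching.M-rev G pm' x)) (trans eq (M-rev x)))

    -- Rotating about the head of x, from one side of x round to the other, the
    -- boundary of U is crossed once more.
    next-crossing : ∀ {U} → Closed U → ∀ {x} → Crossing U x → ∃ λ y → tail y ≡ tail (rev x) × Crossing U y
    next-crossing {U} cU@(Uϕ , _) {x} (fx , Ux , ¬Ux') =
      let k , returns = next-cyc (next (rev x)) (rev x) (next-tail (rev x))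
          y , y-at , cr = rotate k (next (rev x)) (trans (next-face Uϕ (rev x)) (trans (cong U (rev-invol x)) Ux))
                                 (trans (cong U returns) ¬Ux')
      in y , trans y-at (next-tail (rev x)) , cr
      where
      rotate : ∀ k z → U z ≡ true → U (iter next k z) ≡ false → ∃ λ y → tail y ≡ tail z × Crossing U y
      rotate zero z Uz ¬Uz = contradiction (trans (sym Uz) ¬Uz) true≢false
      rotate (suc k) z Uz ¬U with U (rev z) in Uz'
      ... | false = z , refl , crossing-direction cU Uz Uz'
      ... | true =
        let y , y-at , cr = rotate k (next z) (trans (next-face Uϕ z) Uz') (trans (cong U (iter-shift next k z)) ¬U)
        in y , trans y-at (next-tail z) , cr

    -- A crossing dart can always be continued by another one at its head. The resulting walk on
    -- finitely many vertices becomes periodic, and one least period of it is a simple directed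
    -- cycle in the boundary of `U`.
    module BoundaryCycle {U : Sub d} (cU : Closed U) (ntU : Nontrivial U) where
      Out : Fin n → Set
      Out v = ∃ λ y → tail y ≡ v × Crossing U y

      out? : ∀ v → Dec (Out v)
      out? v = Finₚ.any? λ y → (tail y ≟ v) ×-dec (directed? y ×-dec ((U y Boolₚ.≟ true) ×-dec (U (rev y) Boolₚ.≟ false)))

      out : Fin n → Fin d
      out v with out? v
      ... | yes (y , _) = y
      -- An arbitrary default: the walk visits only vertices satisfying `Out`.
      ... | no  _       = outer

      out-Out : ∀ {v} → Out v → tail (out v) ≡ v × Crossing U (out v)
      out-Out {v} o with out? v
      ... | yes (_ , h) = h
      ... | no ¬o       = contradiction o ¬o

      f : Fin n → Fin n
      f v = tail (rev (out v))

      f-Out : ∀ {v} → Out v → Out (f v)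
      f-Out o = next-crossing cU (proj₂ (out-Out o))

      iter-Out : ∀ k {v} → Out v → Out (iter f k v)
      iter-Out zero    o = o
      iter-Out (suc k) o = f-Out (iter-Out k o)

      start : Fin d
      start = proj₁ (crossing-exists cU ntU)

      ec = eventual-cycle f (tail start)
      w = iter f (proj₁ ec) (tail start)
      P = proj₁ (proj₂ ec)

      w-Out : ∀ i → Out (iter f i w)
      w-Out i = iter-Out i (iter-Out (proj₁ ec) (start , refl , proj₂ (crossing-exists cU ntU)))

      D : ℕ → Fin d
      D i = out (iter f i w)

      D-tail : ∀ i → tail (D i) ≡ iter f i w
      D-tail i = proj₁ (out-Out (w-Out i))

      D-crossing : ∀ i → Crossing U (D i)
      D-crossing i = proj₂ (out-Out (w-Out i))

      returns : iter f (suc P) w ≡ w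
      returns = proj₁ (proj₂ (proj₂ ec))

      -- Period 1 would give a loop. In a simple graph period 2 would traverse one edge in both
      -- directions, and only one of them is forward.
      long : ∀ Q → iter f (suc Q) w ≡ w → 3 ≤ suc Q
      long zero          eq = contradiction (trans eq (sym (D-tail 0))) (no-loop (D 0))
      long (suc zero)    eq = contradiction (subst Forward back (proj₁ (D-crossing 1))) (forward-exclusive (proj₁ (D-crossing 0)))
        where
        back : D 1 ≡ rev (D 0)
        back = simple (D 1) (rev (D 0)) (D-tail 1) (trans eq (trans (sym (D-tail 0)) (cong tail (sym (rev-invol (D 0))))))
      long (suc (suc Q)) _  = s≤s (s≤s (s≤s z≤n))

      cycle : Cycle G
      cycle .len = suc P
      cycle .dart = D
      cycle .len≥3 = long P returns
      cycle .periodic i = cong out (trans (iter-+ f i (suc P) w) (cong (iter f i) returns))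
      cycle .consec i = D-tail (suc i)
      cycle .distinct i j i< j< eq =
        proj₂ (proj₂ (proj₂ ec)) i j i< j< (trans (sym (D-tail i)) (trans eq (D-tail j)))

    forward-alternating : ∀ {C : Cycle G} → (∀ i → Forward (dart C i)) → Alternating G C M
    forward-alternating {C} fwd i = trans (fwd (suc i))
      (trans (cong col (consec C i)) (trans (col-rev (dart C i)) (cong not (sym (fwd i)))))

    directed-mate : Fin n → Fin d
    directed-mate v = if col v then mate v else rev (mate v)

    forward-cycle-mate : ∀ {C : Cycle G} → (∀ i → Forward (dart C i)) → ∀ {v} →
                         CycleFacts.VertexOf G C v → ∃ λ i → dart C i ≡ directed-mate v
    forward-cycle-mate {C} fwd {v} (i , iv) with col v in cv
    ... | true = i , trans (mate-unique (trans (fwd i) (trans (cong col iv) cv))) (cong mate iv)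
    ... | false with CycleFacts.predecessor G C i
    ...   | j , j≡ = j , trans (sym (rev-invol _)) (cong rev (trans (mate-unique Mr) (cong mate r-at)))
      where
      r-at : tail (rev (dart C j)) ≡ v
      r-at = trans (sym (consec C j)) (trans (cong tail j≡) iv)
      Mr : M (rev (dart C j)) ≡ true
      Mr = trans (M-rev _) (trans (fwd j) (Boolₚ.not-injective
             (trans (sym (col-rev (dart C j))) (trans (cong col r-at) cv))))

    -- Two forward cycles with a common vertex `v` would both contain the dart `directed-mate v`. It
    -- would then enter two sets of the packing, against capacity 1.
    disjoint-cycles : ∀ {k} → Dicut.Packing (const false) (const 1) k →
      ∃ λ (Cs : Fin k → Cycle G) → (∀ i → Alternating G (Cs i) M) ×
        (∀ i j → i ≢ j → ∀ v → CycleFacts.VertexOf G (Cs i) v → ¬ CycleFacts.VertexOf G (Cs j) v)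
    disjoint-cycles {k} Pk = Cs , (λ i → forward-alternating {Cs i} (proj₁ ∘ crossings i)) , separate
      where
      open Dicut.Packing Pk
      module B i = BoundaryCycle {sets i} (proj₁ (closed i)) (nontrivial i)
      Cs : Fin k → Cycle G
      Cs i = B.cycle i
      crossings : ∀ i l → Crossing (sets i) (dart (Cs i) l)
      crossings i = B.D-crossing i
      entered : ∀ i {v} → CycleFacts.VertexOf G (Cs i) v → Dicut.enters (directed-mate v) (sets i) ≡ true
      entered i {v} on =
        let l , eq = forward-cycle-mate {Cs i} (proj₁ ∘ crossings i) on
        in crossing⇒enters {sets i} (subst (Crossing (sets i)) eq (crossings i l))
      separate : ∀ i j → i ≢ j → ∀ v → CycleFacts.VertexOf G (Cs i) v → ¬ CycleFacts.VertexOf G (Cs j) v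
      separate i j i≢j v oni onj = ℕₚ.<⇒≱ (ℕₚ.≤-refl {2}) (ℕₚ.≤-trans
        (ℕₚ.≤-trans (ℕₚ.≤-reflexive (sym (cong₂ (λ b c → 𝟙 b + 𝟙 c) (entered i oni) (entered j onj))))
          (two-terms≤sum (λ l → 𝟙 (Dicut.enters (directed-mate v) (sets l))) i≢j))
        (load (directed-mate v)))

-- Interiors of alternating cycles

-- Bundles the decisions about a cycle and its exterior, which are obtained under a double negation
-- and used to compute with regions.
record DecCycle (G : PlaneGraph) : Set where
  field
    cycle : Cycle G
    on?   : ∀ x → Dec (OnCycle G cycle x)
    out?  : ∀ x → Dec (Outside G cycle x)

module Region (G : PlaneGraph) (Cd : DecCycle G) where
  open Plane G
  open DecCycle Cd
  open CycleFacts G cycle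

  outside : Fin d → Bool
  outside x = does (out? x)

  outside-outer : outside outer ≡ true
  outside-outer = dec-true (out? outer) out-base

  outside-face : FaceFunction outside
  outside-face x = ≡-from-⇔
    (λ o → dec-true (out? x) (back (does⇒ (out? (ϕ x)) o)))
    (λ o → dec-true (out? (ϕ x)) (out-face (does⇒ (out? x) o)))
    where
    along : ∀ k {y} → Outside G cycle y → Outside G cycle (iter ϕ k y)
    along zero    o = o
    along (suc k) o = out-face (along k o)
    back : Outside G cycle (ϕ x) → Outside G cycle x
    back o = let k , eq = Faces.orbit-sym {x} (1 , refl) in subst (Outside G cycle) eq (along k o)

  outside-cross : ∀ {x} → ¬ OnCycle G cycle x → outside (rev x) ≡ outside x
  outside-cross {x} off = ≡-from-⇔
    (λ o → dec-true (out? x) (subst (Outside G cycle) (rev-invol x) (out-cross (does⇒ (out? (rev x)) o) (off ∘ onCycle-unrev))))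
    (λ o → dec-true (out? (rev x)) (out-cross (does⇒ (out? x) o) off))

  free-off : ∀ {x} → ¬ VertexOf (tail x) → ¬ OnCycle G cycle x
  free-off free = free ∘ onCycle-vertex

  outside-around : ∀ {x y} → ¬ VertexOf (tail x) → tail x ≡ tail y → outside x ≡ outside y
  outside-around {x} {y} free eq = let k , it = next-cyc x y eq in trans (around k x free) (cong outside it)
    where
    around : ∀ k x → ¬ VertexOf (tail x) → outside x ≡ outside (iter next k x)
    around zero    x free = refl
    around (suc k) x free =
      trans (sym (outside-cross (free-off free)))
        (trans (sym (next-face outside-face x))
          (trans (around k (next x) (free ∘ subst VertexOf (next-tail x))) (cong outside (iter-shift next k x))))

  inE? : ∀ x → Dec (inE (IC G cycle) x)
  inE? x = ¬? (out? x) ⊎-dec ¬? (out? (rev x))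

  inE-rev : ∀ {x} → inE (IC G cycle) x → inE (IC G cycle) (rev x)
  inE-rev {x} (inj₁ ins) = inj₂ (subst (λ y → ¬ Outside G cycle y) (sym (rev-invol x)) ins)
  inE-rev {x} (inj₂ ins) = inj₁ ins

  inE-unrev : ∀ {x} → inE (IC G cycle) (rev x) → inE (IC G cycle) x
  inE-unrev {x} e = subst (inE (IC G cycle)) (rev-invol x) (inE-rev e)

  inside-inE : ∀ {x} → outside x ≡ false → inE (IC G cycle) x
  inside-inE {x} ¬o = inj₁ (does⇏ (out? x) ¬o)

  free-inE : ∀ {x} → ¬ VertexOf (tail x) → inE (IC G cycle) x → outside x ≡ false
  free-inE {x} free (inj₁ ins) = dec-false (out? x) ins
  free-inE {x} free (inj₂ ins) = trans (sym (outside-cross (free-off free))) (dec-false (out? (rev x)) ins)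

  free-inV : ∀ {x} → ¬ VertexOf (tail x) → inV (IC G cycle) (tail x) → outside x ≡ false
  free-inV free (y , yv , e) =
    trans (outside-around free (sym yv)) (free-inE (free ∘ subst VertexOf yv) e)

  insideCount : ℕ
  insideCount = count (not ∘ outside)

  -- Turning around the vertex between two consecutive darts of the cycle, no
  -- other edge of the cycle is crossed.
  private
    sweep : ∀ a b → tail a ≡ tail b → (∀ z → tail z ≡ tail b → OnCycle G cycle z → z ≡ a ⊎ z ≡ b) →
            outside b ≡ outside (rev a)
    sweep a b a-at only =
      let k , it = next-cyc (next a) b (trans (next-tail a) a-at)
      in go k (next a) (trans (next-tail a) a-at) (next-face outside-face a) it
      where
      go : ∀ k z → tail z ≡ tail b → outside z ≡ outside (rev a) → iter next k z ≡ b → outside b ≡ outside (rev a)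
      go zero    z z-at eq it = trans (cong outside (sym it)) eq
      go (suc k) z z-at eq it with z ≟ b
      ... | yes z≡b = trans (cong outside (sym z≡b)) eq
      ... | no  z≢b = go k (next z) (trans (next-tail z) z-at) next-eq (trans (iter-shift next k z) it)
        where
        next-eq : outside (next z) ≡ outside (rev a)
        next-eq with on? z
        ... | no off = trans (next-face outside-face z) (trans (outside-cross off) eq)
        ... | yes on with only z z-at on
        ...   | inj₁ z≡a = trans (next-face outside-face z) (cong (outside ∘ rev) z≡a)
        ...   | inj₂ z≡b = contradiction z≡b z≢b

    D = dart cycle

  left-constant : ∀ i → outside (D i) ≡ outside (D 0)
  left-constant zero    = refl
  left-constant (suc i) = trans
    (trans (sweep (rev (D i)) (D (suc i)) (sym (consec cycle i)) λ z zv on → Data.Sum.swap (onCycle-at i on zv))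
           (cong outside (rev-invol (D i))))
    (left-constant i)

  right-constant : ∀ i → outside (rev (D i)) ≡ outside (rev (D 0))
  right-constant zero    = refl
  right-constant (suc i) = trans
    (sym (sweep (D (suc i)) (rev (D i)) (consec cycle i) λ z zv on → onCycle-at i on (trans zv (sym (consec cycle i)))))
    (right-constant i)

module AlternatingCycle (G : PlaneGraph) (bip : Bipartite G) {M : Fin (PlaneGraph.d G) → Bool}
  (pm : IsPM G (Whole G) M) (Cd : DecCycle G) (alt : Alternating G (DecCycle.cycle Cd) M) where
  open Plane G
  open DecCycle Cd
  open CycleFacts G cycle
  open PerfectMatching G pm
  open Region G Cd
  open Flip {cycle} alt on? public
  open BipartitePlane G bip using (flow; flow-potential; flow-equal; flow-zero)

  private
    D = dart cycle
    H = IC G cycle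

  -- The Jordan curve property. If both sides of the cycle agreed, everything would be outside. But
  -- every derivation of `Outside` crosses only edges off the cycle, where `M` and its flip
  -- coincide, so the potential of their flow would be constant. On the cycle, however, the flow is
  -- nonzero.
  separates₀ : outside (D 0) ≢ outside (rev (D 0))
  separates₀ same = Boolₚ.not-¬ refl (trans (flow-zero {M} {flip} {D 0} no-flow) (flip-on (0 , inj₁ refl)))
    where
    symmetric : ∀ x → outside (rev x) ≡ outside x
    symmetric x with on? x
    ... | no off = outside-cross off
    ... | yes (i , inj₁ refl) = trans (right-constant i) (trans (sym same) (sym (left-constant i)))
    ... | yes (i , inj₂ x'≡) = trans (cong outside x'≡) (trans (left-constant i) (trans same
            (trans (sym (right-constant i)) (cong outside (trans (cong rev (sym x'≡)) (rev-invol x))))))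
    everything : ∀ x → Outside G cycle x
    everything x = does⇒ (out? x) (trans (locally-constant outside-face symmetric x outer) outside-outer)
    pot = flow-potential pm flip-pm
    p = proj₁ pot
    p-outside : ∀ {x} → Outside G cycle x → p x ≡ p outer
    p-outside out-base = refl
    p-outside (out-face o) = trans (proj₁ (proj₂ pot) _) (p-outside o)
    p-outside (out-cross {x} o off) =
      trans (sym (ℤₚ.i-j≡0⇒i≡j (p x) (p (rev x)) (trans (sym (proj₂ (proj₂ pot) x)) (flow-equal M flip (flip-off off))))) (p-outside o)
    no-flow : flow M flip (D 0) ≡ 0ℤ
    no-flow = trans (proj₂ (proj₂ pot) (D 0))
      (ℤₚ.i≡j⇒i-j≡0 (trans (p-outside (everything (D 0))) (sym (p-outside (everything (rev (D 0)))))))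

  onCycle-inE : ∀ {x} → OnCycle G cycle x → inE H x
  onCycle-inE {x} (i , inj₂ eq) = inE-unrev (subst (inE H) (sym eq) (onCycle-inE (i , inj₁ refl)))
  onCycle-inE (i , inj₁ refl) with out? (D i) | out? (rev (D i))
  ... | no ins | _ = inj₁ ins
  ... | yes _ | no ins = inj₂ ins
  ... | yes o | yes o' = contradiction
    (trans (sym (left-constant i)) (trans (dec-true (out? (D i)) o)
      (trans (sym (dec-true (out? (rev (D i))) o')) (right-constant i)))) separates₀

  vertexOf? : ∀ v → Dec (VertexOf v)
  vertexOf? v with on? (mate v)
  ... | yes on = yes (subst VertexOf (mate-tail v) (onCycle-vertex on))
  ... | no off = no (off ∘ mate-onCycle {cycle} alt)

  -- No matching edge leaves I[C]: vertices of the cycle are matched along it, and all edges at any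
  -- other vertex of I[C] are inside. Hence `M` restricts to I[C], and any perfect matching of I[C]
  -- can be glued to the rest of `M`.
  mate-inE : ∀ {v} → inV H v → inE H (mate v)
  mate-inE {v} v∈H with vertexOf? v
  ... | yes on = onCycle-inE (mate-onCycle {cycle} alt on)
  ... | no free = inside-inE (free-inV (free ∘ subst VertexOf (mate-tail v)) (subst (inV H) (sym (mate-tail v)) v∈H))

  restrict : Fin d → Bool
  restrict x = M x ∧ does (inE? x)

  inE-does-rev : ∀ x → does (inE? (rev x)) ≡ does (inE? x)
  inE-does-rev x = ≡-from-⇔ (λ h → dec-true (inE? x) (inE-unrev (does⇒ (inE? (rev x)) h)))
                            (λ h → dec-true (inE? (rev x)) (inE-rev (does⇒ (inE? x) h)))

  restrict-pm : IsPM G H restrict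
  restrict-pm =
    (λ x h → does⇒ (inE? x) (proj₂ (∧-true h))) ,
    (λ x → cong₂ _∧_ (M-rev x) (inE-does-rev x)) ,
    (λ v v∈H → mate v , mate-tail v , cong₂ _∧_ (mate-M v) (dec-true (inE? (mate v)) (mate-inE v∈H)) ,
       λ y yv h → trans (mate-unique (proj₁ (∧-true h))) (cong mate yv)) ,
    λ v v∉H x xv → ≢true⇒≡false λ h → v∉H (x , xv , does⇒ (inE? x) (proj₂ (∧-true {M x} h)))

  module Glue {N : Fin d → Bool} (pmN : IsPM G H N) where
    glue : Fin d → Bool
    glue x = if does (inE? x) then N x else M x

    glue-in : ∀ {x} → inE H x → glue x ≡ N x
    glue-in {x} e rewrite dec-true (inE? x) e = refl

    glue-out : ∀ {x} → ¬ inE H x → glue x ≡ M x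
    glue-out {x} e rewrite dec-false (inE? x) e = refl

    glue-rev : ∀ x → glue (rev x) ≡ glue x
    glue-rev x rewrite inE-does-rev x | proj₁ (proj₂ pmN) x | M-rev x = refl

    glue-at : ∀ v → ∃ λ x → tail x ≡ v × glue x ≡ true × (∀ y → tail y ≡ v → glue y ≡ true → y ≡ x)
    glue-at v with inE? (mate v)
    ... | yes e =
      let v∈H = mate v , mate-tail v , e
          x , xv , Nx , unique = proj₁ (proj₂ (proj₂ pmN)) v v∈H
      in x , xv , trans (glue-in (proj₁ pmN x Nx)) Nx , λ y yv gy → at-inside v∈H y yv gy unique
      where
      at-inside : inV H v → ∀ y → tail y ≡ v → glue y ≡ true → ∀ {x} → (∀ y → tail y ≡ v → N y ≡ true → y ≡ x) → y ≡ x
      at-inside v∈H y yv gy unique with inE? y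
      ... | yes e = unique y yv (trans (sym (glue-in e)) gy)
      ... | no ¬e = contradiction (subst (inE H) (sym (trans (mate-unique (trans (sym (glue-out ¬e)) gy)) (cong mate yv))) (mate-inE v∈H)) ¬e
    ... | no ¬e = mate v , mate-tail v , trans (glue-out ¬e) (mate-M v) , at-outside
      where
      at-outside : ∀ y → tail y ≡ v → glue y ≡ true → y ≡ mate v
      at-outside y yv gy with inE? y
      ... | yes e = contradiction (mate-inE (y , yv , e)) ¬e
      ... | no ¬e′ = trans (mate-unique (trans (sym (glue-out ¬e′)) gy)) (cong mate yv)

    glue-pm : IsPM G (Whole G) glue
    glue-pm = (λ _ _ → tt) , glue-rev , (λ v _ → glue-at v) , λ v ¬⊤ → ⊥-elim (¬⊤ tt)

module Nested (G : PlaneGraph) (bip : Bipartite G) {M : Fin (PlaneGraph.d G) → Bool} (pm : IsPM G (Whole G) M)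
  (C D : DecCycle G) (altC : Alternating G (DecCycle.cycle C) M) (altD : Alternating G (DecCycle.cycle D) M)
  (disjoint : ∀ v → CycleFacts.VertexOf G (DecCycle.cycle C) v → ¬ CycleFacts.VertexOf G (DecCycle.cycle D) v) where
  open Plane G
  module RC = Region G C
  module RD = Region G D

  constant-along : ∀ (E F : DecCycle G) →
    (∀ v → CycleFacts.VertexOf G (DecCycle.cycle F) v → ¬ CycleFacts.VertexOf G (DecCycle.cycle E) v) →
    ∀ {x} → OnCycle G (DecCycle.cycle F) x →
    Region.outside G E x ≡ Region.outside G E (dart (DecCycle.cycle F) 0)
  constant-along E F free {x} on = onto x on
    where
    open Region G E
    B = dart (DecCycle.cycle F)
    step′ : ∀ i → outside (B (suc i)) ≡ outside (B i)
    step′ i = trans (outside-around (free _ (suc i , refl)) (consec (DecCycle.cycle F) i)) (outside-cross (free-off (free _ (i , refl))))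
    all : ∀ i → outside (B i) ≡ outside (B 0)
    all zero    = refl
    all (suc i) = trans (step′ i) (all i)
    onto : ∀ x → OnCycle G (DecCycle.cycle F) x → outside x ≡ outside (B 0)
    onto x (i , inj₁ refl) = all i
    onto x on@(i , inj₂ eq) = trans
      (sym (outside-cross (free-off (free _ (CycleFacts.onCycle-vertex G (DecCycle.cycle F) on)))))
      (trans (cong outside eq) (all i))

  -- By disjointness all of D lies inside C, and C lies entirely on one side of D. C inside D is
  -- impossible, since the outer face is outside both. So C is outside D, and the interior of D is a
  -- proper part of that of C.
  inside-smaller : ∀ {v} → CycleFacts.VertexOf G (DecCycle.cycle D) v → inV (IC G (DecCycle.cycle C)) v →
                   RD.insideCount < RC.insideCount
  inside-smaller {v} (i₀ , i₀v) v∈ = go _ refl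
    where
    D-in-C : ∀ {x} → OnCycle G (DecCycle.cycle D) x → RC.outside x ≡ false
    D-in-C on = trans (constant-along C D (λ v onD onC → disjoint v onC onD) on)
      (trans (sym (constant-along C D (λ v onD onC → disjoint v onC onD) (i₀ , inj₁ refl)))
        (RC.free-inV (λ onC → disjoint _ onC (i₀ , refl)) (subst (inV (IC G (DecCycle.cycle C))) (sym i₀v) v∈)))

    -- Across D only the second argument of `f` can change, while the first is `false`. Across C
    -- only the first can change, while the second is `s`. So an `f` insensitive to these changes is
    -- constant on the sphere.
    combined : (f : Bool → Bool → Bool) → (∀ b c → f false b ≡ f false c) → ∀ s → (∀ b c → f b s ≡ f c s) →
               RD.outside (dart (DecCycle.cycle C) 0) ≡ s → ∀ x y → f (RC.outside x) (RD.outside x) ≡ f (RC.outside y) (RD.outside y)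
    combined f fD s fC eq = locally-constant (λ x → cong₂ f (RC.outside-face x) (RD.outside-face x)) symmetric
      where
      C-in-D : ∀ {x} → OnCycle G (DecCycle.cycle C) x → RD.outside x ≡ s
      C-in-D on = trans (constant-along D C disjoint on) eq
      symmetric : ∀ x → f (RC.outside (rev x)) (RD.outside (rev x)) ≡ f (RC.outside x) (RD.outside x)
      symmetric x with DecCycle.on? C x | DecCycle.on? D x
      ... | yes on | _ rewrite C-in-D on | C-in-D (CycleFacts.onCycle-rev G (DecCycle.cycle C) on) = fC _ _
      ... | no _ | yes on rewrite D-in-C on | D-in-C (CycleFacts.onCycle-rev G (DecCycle.cycle D) on) = fD _ _
      ... | no offC | no offD = cong₂ f (RC.outside-cross offC) (RD.outside-cross offD)

    go : ∀ s → RD.outside (dart (DecCycle.cycle C) 0) ≡ s → RD.insideCount < RC.insideCount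
    go false eq = contradiction
      (trans (sym (cong₂ _∧_ RC.outside-outer RD.outside-outer))
        (trans (combined _∧_ (λ _ _ → refl) false (λ b c → trans (Boolₚ.∧-zeroʳ b) (sym (Boolₚ.∧-zeroʳ c))) eq outer (dart (DecCycle.cycle D) 0))
               (cong (_∧ _) (D-in-C (0 , inj₁ refl))))) true≢false
    go true eq = count-mono-< inclusion (proj₁ inner)
        (cong not (trans (constant-along D C disjoint (proj₁ (proj₂ inner))) eq)) (cong not (proj₂ (proj₂ inner)))
      where
      open AlternatingCycle G bip pm C altC using (separates₀)
      inclusion : ∀ x → not (RD.outside x) ≡ true → not (RC.outside x) ≡ true
      inclusion x ¬o with RC.outside x in oC
      ... | false = refl
      ... | true = contradiction
        (trans (sym (cong₂ (λ b c → b ∧ not c) oC (Boolₚ.not-injective ¬o)))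
          (trans (combined (λ b c → b ∧ not c) (λ _ _ → refl) true (λ b c → trans (Boolₚ.∧-zeroʳ b) (sym (Boolₚ.∧-zeroʳ c))) eq x outer)
                 (cong₂ (λ b c → b ∧ not c) RC.outside-outer RD.outside-outer))) true≢false
      inner : ∃ λ x → OnCycle G (DecCycle.cycle C) x × RC.outside x ≡ false
      inner with RC.outside (dart (DecCycle.cycle C) 0) in o | RC.outside (rev (dart (DecCycle.cycle C) 0)) in o'
      ... | false | _ = _ , (0 , inj₁ refl) , o
      ... | true | false = _ , CycleFacts.onCycle-rev G (DecCycle.cycle C) (0 , inj₁ refl) , o'
      ... | true | true = contradiction (trans o (sym o')) separates₀

-- Replacing alternating cycles by resonant faces

AllPairs-lookup : {A : Set} {R : A → A → Set} → (∀ {x y} → R x y → R y x) → ∀ {xs} → AllPairs R xs →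
                  ∀ i j → i ≢ j → R (lookup xs i) (lookup xs j)
AllPairs-lookup R-sym (x∷ ∷ rs) zero    zero    i≢j = contradiction refl i≢j
AllPairs-lookup R-sym (x∷ ∷ rs) zero    (suc j) i≢j = All.lookup x∷ (∈ₚ.∈-lookup j)
AllPairs-lookup R-sym (x∷ ∷ rs) (suc i) zero    i≢j = R-sym (All.lookup x∷ (∈ₚ.∈-lookup i))
AllPairs-lookup R-sym (x∷ ∷ rs) (suc i) (suc j) i≢j = AllPairs-lookup R-sym rs i j (i≢j ∘ cong suc)

lookup-AllPairs : {A : Set} {R : A → A → Set} → ∀ xs → (∀ i j → i ≢ j → R (lookup xs i) (lookup xs j)) → AllPairs R xs
lookup-AllPairs [] h = []
lookup-AllPairs {R = R} (x ∷ xs) h =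
  All.tabulate (all-lookup {P = R x} λ i → h zero (suc i) λ ()) ∷ lookup-AllPairs xs λ i j i≢j → h (suc i) (suc j) (i≢j ∘ Finₚ.suc-injective)

AllPairs-resp-↭ : {A : Set} {R : A → A → Set} → (∀ {x y} → R x y → R y x) →
                  ∀ {xs ys} → xs ↭ ys → AllPairs R xs → AllPairs R ys
AllPairs-resp-↭ R-sym ↭.refl rs = rs
AllPairs-resp-↭ R-sym (↭.prep x p) (r ∷ rs) = ↭ₚ.All-resp-↭ p r ∷ AllPairs-resp-↭ R-sym p rs
AllPairs-resp-↭ R-sym (↭.swap x y p) ((xy ∷ r) ∷ r′ ∷ rs) =
  (R-sym xy ∷ ↭ₚ.All-resp-↭ p r′) ∷ ↭ₚ.All-resp-↭ p r ∷ AllPairs-resp-↭ R-sym p rs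
AllPairs-resp-↭ R-sym (↭.trans p q) rs = AllPairs-resp-↭ R-sym q (AllPairs-resp-↭ R-sym p rs)

length-filter-split : {A : Set} {P : A → Set} (P? : ∀ x → Dec (P x)) → ∀ xs →
                      length (filter (¬? ∘ P?) xs) + length (filter P? xs) ≡ length xs
length-filter-split P? [] = refl
length-filter-split P? (x ∷ xs) with does (P? x)
... | true  = trans (ℕₚ.+-suc _ _) (cong suc (length-filter-split P? xs))
... | false = cong suc (length-filter-split P? xs)

pick-minimal : {A : Set} (μ : A → ℕ) → ∀ x xs → ∃₂ λ y ys → (x ∷ xs) ↭ (y ∷ ys) × All (λ z → μ y ≤ μ z) ys
pick-minimal μ x [] = x , [] , ↭.refl , []
pick-minimal μ x (x′ ∷ xs) with pick-minimal μ x′ xs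
... | y , ys , perm , minimal with ℕₚ.≤-total (μ x) (μ y)
...   | inj₁ x≤y = x , y ∷ ys , ↭.prep x perm , x≤y ∷ All.map (ℕₚ.≤-trans x≤y) minimal
...   | inj₂ y≤x = y , x ∷ ys , ↭.trans (↭.prep x perm) (↭.swap x y ↭.refl) , y≤x ∷ minimal

module ResonantFaces (G : PlaneGraph) where
  open Plane G

  onFace? : ∀ v x → Dec (OnFace G v x)
  onFace? v x = map′ (λ (y , (k , eq) , yv) → k , trans (cong tail eq) yv) (λ (k , kv) → iter ϕ k x , (k , refl) , kv)
    (Finₚ.any? λ y → Faces.sameOrbit? x y ×-dec (tail y ≟ v))

  FaceDisjoint : Fin d → Fin d → Set
  FaceDisjoint x y = ∀ v → OnFace G v x → ¬ OnFace G v y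

  face-disjoint-sym : ∀ {x y} → FaceDisjoint x y → FaceDisjoint y x
  face-disjoint-sym dis v on on' = dis v on' on

  resonant-cong : ∀ M M' {x} → (∀ k → M' (iter ϕ k x) ≡ M (iter ϕ k x)) → Resonant G x M → Resonant G x M'
  resonant-cong M M' same (simple-boundary , alt) =
    simple-boundary , λ k → trans (same (suc k)) (trans (alt k) (cong not (sym (same k))))

  resonant-mate : ∀ {M} (pm : IsPM G (Whole G) M) {x v} → Resonant G x M → OnFace G v x →
                  OnFace G (tail (rev (PerfectMatching.mate G pm v))) x
  resonant-mate {M} pm {x} {v} (_ , alt) (i , iv) with M (iter ϕ i x) in My
  ... | true = suc i , trans (tail-ϕ (iter ϕ i x)) (cong (tail ∘ rev) (trans (mate-unique My) (cong mate iv)))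
    where open PerfectMatching G pm
  ... | false = j , cong tail (trans (sym (rev-invol z)) (cong rev (trans (mate-unique Mz') (cong mate z-at))))
    where
    open PerfectMatching G pm
    per = Faces.period x
    -- One step short of a full period beyond `i`, so `z` is the boundary dart preceding
    -- `iter ϕ i x`.
    j = i + proj₁ per
    z = iter ϕ j x
    ϕz : ϕ z ≡ iter ϕ i x
    ϕz = trans (cong (λ l → iter ϕ l x) (sym (ℕₚ.+-suc i (proj₁ per))))
           (trans (iter-+ ϕ i (suc (proj₁ per)) x) (cong (iter ϕ i) (proj₂ (proj₂ per))))
    z-at : tail (rev z) ≡ v
    z-at = trans (sym (tail-ϕ z)) (trans (cong tail ϕz) iv)
    Mz' : M (rev z) ≡ true
    Mz' = trans (M-rev z) (Boolₚ.not-injective (trans (sym (alt j)) (trans (cong M ϕz) My)))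

module Descent (G : PlaneGraph) (bip : Bipartite G)
  (hyp : ∀ C → Nice G C → ∀ K → MaxResonant G (IC G C) (Inside G C) K → UniquePM G (Minus G (IC G C) K)) where
  open Plane G
  open ResonantFaces G

  VertexOf′ : DecCycle G → Fin n → Set
  VertexOf′ C = CycleFacts.VertexOf G (DecCycle.cycle C)

  Alternating′ : (Fin d → Bool) → DecCycle G → Set
  Alternating′ M C = Alternating G (DecCycle.cycle C) M

  CycleDisjoint : DecCycle G → DecCycle G → Set
  CycleDisjoint C D = ∀ v → VertexOf′ C v → ¬ VertexOf′ D v

  FaceCycleDisjoint : DecCycle G → Fin d → Set
  FaceCycleDisjoint C x = ∀ v → OnFace G v x → ¬ VertexOf′ C v

  module Interior {M : Fin d → Bool} (pm : IsPM G (Whole G) M) (C : DecCycle G) (alt : Alternating′ M C)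
                  (K : List (Fin d)) (K-res : All (λ x → Resonant G x M) K) where
    open DecCycle C
    open Region G C
    open PerfectMatching G pm
    open AlternatingCycle G bip pm C alt

    private
      H = IC G cycle
      H∖K = Minus G H K

    inV? : ∀ v → Dec (inV H v)
    inV? v = Finₚ.any? λ x → (tail x ≟ v) ×-dec inE? x

    inV∖? : ∀ v → Dec (inV H∖K v)
    inV∖? v = inV? v ×-dec Finₚ.all? λ i → ¬? (onFace? v (lookup K i))

    inE∖? : ∀ x → Dec (inE H∖K x)
    inE∖? x = inE? x ×-dec (inV∖? (tail x) ×-dec inV∖? (tail (rev x)))

    inE∖-rev : ∀ {x} → inE H∖K x → inE H∖K (rev x)
    inE∖-rev {x} (e , t , t') = inE-rev e , t' , subst (inV H∖K ∘ tail) (sym (rev-invol x)) t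

    -- If the partner of `v` lay on a face of `K`, resonance would match it along that face, and `v`
    -- would lie on the face as well.
    mate-inE∖ : ∀ {v} → inV H∖K v → inE H∖K (mate v)
    mate-inE∖ {v} (v∈H , v∉K) = e , (subst (inV H∖K) (sym (mate-tail v)) (v∈H , v∉K)) ,
      (rev (mate v) , refl , inE-rev e) , λ i on → v∉K i (back (All.lookup K-res (∈ₚ.∈-lookup i)) on)
      where
      e : inE H (mate v)
      e = mate-inE v∈H
      back : ∀ {x} → Resonant G x M → OnFace G (tail (rev (mate v))) x → OnFace G v x
      back {x} res on = subst (λ w → OnFace G w x)
        (trans (cong (tail ∘ rev) (sym (mate-unique (trans (M-rev _) (mate-M v))))) (trans (cong tail (rev-invol _)) (mate-tail v)))
        (resonant-mate pm res on)

    remainder : Fin d → Bool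
    remainder x = M x ∧ does (inE∖? x)

    remainder-in : ∀ {x} → inE H∖K x → remainder x ≡ M x
    remainder-in {x} e = trans (cong (M x ∧_) (dec-true (inE∖? x) e)) (Boolₚ.∧-identityʳ (M x))

    remainder-pm : IsPM G H∖K remainder
    remainder-pm =
      (λ x h → does⇒ (inE∖? x) (proj₂ (∧-true {M x} h))) ,
      (λ x → cong₂ _∧_ (M-rev x) (≡-from-⇔
        (λ h → dec-true (inE∖? x) (subst (inE H∖K) (rev-invol x) (inE∖-rev (does⇒ (inE∖? (rev x)) h))))
        (λ h → dec-true (inE∖? (rev x)) (inE∖-rev (does⇒ (inE∖? x) h))))) ,
      (λ v v∈ → mate v , mate-tail v , trans (remainder-in (mate-inE∖ v∈)) (mate-M v) ,
         λ y yv h → trans (mate-unique (proj₁ (∧-true h))) (cong mate yv)) ,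
      λ v v∉ x xv → ≢true⇒≡false λ h →
        v∉ (subst (inV H∖K) xv (proj₁ (proj₂ (does⇒ (inE∖? x) (proj₂ (∧-true {M x} h))))))

  -- M and its flip along C restrict to two different perfect matchings of I[C] - K.
  not-unique : ∀ {M} (pm : IsPM G (Whole G) M) (C : DecCycle G) (alt : Alternating′ M C) {K} →
               All (λ x → Resonant G x M) K → All (FaceCycleDisjoint C) K →
               ¬ UniquePM G (Minus G (IC G (DecCycle.cycle C)) K)
  not-unique {M} pm C alt {K} K-res K-free (N , _ , unique) =
    Boolₚ.not-¬ refl (begin
      M x                ≡⟨ I.remainder-in x∈ ⟨
      I.remainder x      ≡⟨ unique I.remainder I.remainder-pm x ⟩
      N x                ≡⟨ unique I′.remainder I′.remainder-pm x ⟨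
      I′.remainder x     ≡⟨ I′.remainder-in x∈ ⟩
      flip x             ≡⟨ flip-on (0 , inj₁ refl) ⟩
      not (M x)          ∎)
    where
    open ≡-Reasoning
    open DecCycle C
    open AlternatingCycle G bip pm C alt
    x = dart cycle 0
    flip-res : All (λ x → Resonant G x flip) K
    flip-res = All.zipWith (λ (res , free) → resonant-cong M flip
      (λ k → flip-off (Region.free-off G C (free _ (k , refl)))) res) (K-res , K-free)
    module I = Interior pm C alt K K-res
    module I′ = Interior flip-pm C flip-alternating K flip-res
    x∈H : inE (IC G cycle) x
    x∈H = onCycle-inE (0 , inj₁ refl)
    x∈ : inE (Minus G (IC G cycle) K) x
    x∈ = x∈H ,
      ((x , refl , x∈H) , λ i on → All.lookup K-free (∈ₚ.∈-lookup i) _ on (0 , refl)) ,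
      ((rev x , refl , Region.inE-rev G C x∈H) , λ i on → All.lookup K-free (∈ₚ.∈-lookup i) _ on (1 , consec cycle 0))

  -- The invariant of the exchange process: faces already obtained and cycles still to be exchanged,
  -- pairwise vertex-disjoint and alternating for one common matching, which may change from step to
  -- step.
  record Configuration (K : List (Fin d)) (L : List (DecCycle G)) : Set where
    field
      M               : Fin d → Bool
      pm              : IsPM G (Whole G) M
      faces-finite    : All (FinFace G) K
      faces-resonant  : All (λ x → Resonant G x M) K
      faces-disjoint  : AllPairs FaceDisjoint K
      cycles-alternating : All (Alternating′ M) L
      cycles-disjoint : AllPairs CycleDisjoint L
      faces-cycles    : All (λ C → All (FaceCycleDisjoint C) K) L

  LargeResonantSet : ℕ → Set
  LargeResonantSet s = ∃ λ K → ResonantSet G (Whole G) (FinFace G) K × s ≤ length K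

  resonantSet : ∀ {H inF M K} → IsPM G H M → All inF K → AllPairs FaceDisjoint K → All (λ x → Resonant G x M) K →
                ResonantSet G H inF K
  resonantSet {M = M} pm fin dis res =
    lookup-all (All.lookup fin) , AllPairs-lookup face-disjoint-sym dis , M , pm , lookup-all (All.lookup res)

  -- `L-out` records that C is innermost. It is what keeps the cycles of `L` alternating, and
  -- disjoint from the new faces, when I[C] is rematched.
  module Exchange {M : Fin d → Bool} (pm : IsPM G (Whole G) M) (C : DecCycle G) (alt : Alternating′ M C)
                  (K : List (Fin d)) (L : List (DecCycle G))
                  (finite : All (FinFace G) K) (resonant : All (λ x → Resonant G x M) K)
                  (disjoint : AllPairs FaceDisjoint K) (C-free : All (FaceCycleDisjoint C) K)
                  (L-alt : All (Alternating′ M) L) (L-disjoint : AllPairs CycleDisjoint L)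
                  (K-L : All (λ D → All (FaceCycleDisjoint D) K) L)
                  (L-out : All (λ D → ∀ v → VertexOf′ D v → ¬ inV (IC G (DecCycle.cycle C)) v) L) where
    open DecCycle C
    open Region G C
    open AlternatingCycle G bip pm C alt

    private
      H = IC G cycle

    K-in K-out : List (Fin d)
    K-in = filter (¬? ∘ out?) K
    K-out = filter out? K

    K-in-inside : All (Inside G cycle) K-in
    K-in-inside = Allₚ.all-filter (¬? ∘ out?) K

    K-out-outside : All (Outside G cycle) K-out
    K-out-outside = Allₚ.all-filter out? K

    inside-iter : ∀ {x} → Inside G cycle x → ∀ k → inE H (iter ϕ k x)
    inside-iter {x} ins k = inside-inE (trans (face-function-iter outside-face k x) (dec-false (out? x) ins))

    outside-iter : ∀ {x} → Outside G cycle x → FaceCycleDisjoint C x → ∀ k → ¬ inE H (iter ϕ k x)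
    outside-iter {x} o free k e = true≢false (trans (sym (trans (face-function-iter outside-face k x) (dec-true (out? x) o)))
      (free-inE (free _ (k , refl)) e))

    K-in-resonantSet : ResonantSet G H (Inside G cycle) K-in
    K-in-resonantSet = resonantSet restrict-pm K-in-inside (AllPairsₚ.filter⁺ (¬? ∘ out?) disjoint)
      (All.zipWith (λ {x} (ins , res) → resonant-cong M restrict
          (λ k → trans (cong (M (iter ϕ k x) ∧_) (dec-true (inE? _) (inside-iter ins k))) (Boolₚ.∧-identityʳ _)) res)
        (K-in-inside , Allₚ.filter⁺ (¬? ∘ out?) resonant))

    module _ {K' : List (Fin d)} (RK' : ResonantSet G H (Inside G cycle) K') where
      M′ = proj₁ (proj₂ (proj₂ RK'))
      pm′ = proj₁ (proj₂ (proj₂ (proj₂ RK')))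
      open Glue pm′

      K'-inside : All (Inside G cycle) K'
      K'-inside = All.tabulate (all-lookup {P = Inside G cycle} (proj₁ RK'))

      K'-resonant : All (λ x → Resonant G x M′) K'
      K'-resonant = All.tabulate (all-lookup {P = λ x → Resonant G x M′} (proj₂ (proj₂ (proj₂ (proj₂ RK')))))

      inside-finite : ∀ {x} → Inside G cycle x → FinFace G x
      inside-finite ins (k , eq) = ins (subst (Outside G cycle) eq (along k))
        where
        along : ∀ k → Outside G cycle (iter ϕ k outer)
        along zero    = out-base
        along (suc k) = out-face (along k)

      K-out-free : All (FaceCycleDisjoint C) K-out
      K-out-free = Allₚ.filter⁺ out? C-free

      -- A common vertex would lie off C, where all darts are on the same side of C.
      separated : ∀ {x y} → Inside G cycle x → Outside G cycle y × FaceCycleDisjoint C y → FaceDisjoint x y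
      separated {x} {y} ins (o , free) v (i , iv) (j , jv) =
        outside-iter o free j (inside-inE (trans
          (outside-around (λ onC → free v (j , jv) (subst (VertexOf′ C) jv onC)) (trans jv (sym iv)))
          (free-inE (λ onC → free v (j , jv) (subst (VertexOf′ C) iv onC)) (inside-iter ins i))))

      exchanged : Configuration (K' ++ K-out) L
      exchanged = record
        { M = glue
        ; pm = glue-pm
        ; faces-finite = Allₚ.++⁺ (All.map inside-finite K'-inside) (Allₚ.filter⁺ out? finite)
        ; faces-resonant = Allₚ.++⁺
            (All.zipWith (λ (ins , res) → resonant-cong M′ glue (λ k → glue-in (inside-iter ins k)) res) (K'-inside , K'-resonant))
            (All.zipWith (λ ((o , free) , res) → resonant-cong M glue (λ k → glue-out (outside-iter o free k)) res)
              (All.zip (K-out-outside , K-out-free) , Allₚ.filter⁺ out? resonant))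
        ; faces-disjoint = AllPairsₚ.++⁺ (lookup-AllPairs K' (proj₁ (proj₂ RK'))) (AllPairsₚ.filter⁺ out? disjoint)
            (All.map (λ ins → All.map (separated ins) (All.zip (K-out-outside , K-out-free))) K'-inside)
        ; cycles-alternating = All.zipWith (λ {D} (free , altD) i →
            trans (glue-out (λ e → free _ (suc i , refl) (_ , refl , e)))
              (trans (altD i) (cong not (sym (glue-out (λ e → free _ (i , refl) (_ , refl , e))))))) (L-out , L-alt)
        ; cycles-disjoint = L-disjoint
        ; faces-cycles = All.zipWith (λ (free , K-D) → Allₚ.++⁺
            (All.map (λ ins v (i , iv) onD → free v onD (_ , iv , inside-iter ins i)) K'-inside)
            (Allₚ.filter⁺ out? K-D)) (L-out , K-L)
        }

    exchange : ¬ ¬ ∃ λ K⁺ → Configuration K⁺ L × suc (length K) ≤ length K⁺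
    exchange ¬ex = not-unique pm C alt (Allₚ.filter⁺ (¬? ∘ out?) resonant) (Allₚ.filter⁺ (¬? ∘ out?) C-free)
      (hyp cycle (M , pm , alt) K-in (K-in-resonantSet , λ K' RK' → ℕₚ.≮⇒≥ λ bigger →
        ¬ex (K' ++ K-out , exchanged RK' , (begin
          suc (length K)                      ≡⟨ cong suc (length-filter-split out? K) ⟨
          suc (length K-in) + length K-out    ≤⟨ ℕₚ.+-monoˡ-≤ (length K-out) bigger ⟩
          length K' + length K-out            ≡⟨ Listₚ.length-++ K' ⟨
          length (K' ++ K-out)                ∎))))
      where open ℕₚ.≤-Reasoning

  cycle-disjoint-sym : ∀ {C D} → CycleDisjoint C D → CycleDisjoint D C
  cycle-disjoint-sym dis v on on' = dis v on' on

  -- The number of faces plus the number of remaining cycles never decreases, since each exchange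
  -- spends one cycle and gains at least one face.
  descend : ∀ s {K L} → length L ≡ s → Configuration K L → ¬ ¬ LargeResonantSet (length K + s)
  descend zero {K} {[]} _ conf ¬large =
    ¬large (K , resonantSet pm faces-finite faces-disjoint faces-resonant , ℕₚ.≤-reflexive (ℕₚ.+-identityʳ _))
    where open Configuration conf
  descend (suc s) {K} {C₀ ∷ L₀} eq conf ¬large with pick-minimal (Region.insideCount G) C₀ L₀
  ... | C , L , perm , minimal
    with ↭ₚ.All-resp-↭ perm (Configuration.cycles-alternating conf)
       | AllPairs-resp-↭ (λ {C} {D} → cycle-disjoint-sym {C} {D}) perm (Configuration.cycles-disjoint conf)
       | ↭ₚ.All-resp-↭ perm (Configuration.faces-cycles conf)
  ...   | altC ∷ altL | C-L ∷ L-L | K-C ∷ K-L =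
    Exchange.exchange pm C altC K L faces-finite faces-resonant faces-disjoint K-C altL L-L K-L L-out
      λ (K⁺ , conf⁺ , bigger) → descend s (ℕₚ.suc-injective (trans (sym (↭ₚ.↭-length perm)) eq)) conf⁺
        λ (K* , RK* , large) → ¬large (K* , RK* , ℕₚ.≤-trans
          (ℕₚ.≤-trans (ℕₚ.≤-reflexive (ℕₚ.+-suc (length K) s)) (ℕₚ.+-monoˡ-≤ s bigger)) large)
    where
    open Configuration conf
    L-out : All (λ D → ∀ v → VertexOf′ D v → ¬ inV (IC G (DecCycle.cycle C)) v) L
    L-out = All.zipWith (λ { {D} ((altD , C-D) , C≤D) v onD v∈ →
      ℕₚ.<⇒≱ (Nested.inside-smaller G bip pm C D altC altD C-D onD v∈) C≤D }) (All.zip (altL , C-L) , minimal)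

-- Finite searches

-- Boolean functions are enumerated only up to pointwise equality, so `P` has to respect it.
any-function? : ∀ d {P : Sub d → Set} → (∀ {f g} → f ≗ g → P f → P g) → (∀ f → Dec (P f)) → Dec (∃ P)
any-function? zero    ext P? = map′ (λ p → _ , p) (λ (f , p) → ext (λ ()) p) (P? λ ())
any-function? (suc d) {P} ext P? = map′
  [ (λ (f , p) → _ , p) , (λ (f , p) → _ , p) ]′
  (λ (f , p) → split f (f zero) refl p)
  (any-function? d (ext ∘ ∷-cong true) (P? ∘ (true Vector.∷_)) ⊎-dec
   any-function? d (ext ∘ ∷-cong false) (P? ∘ (false Vector.∷_)))
  where
  ∷-cong : ∀ b {f g : Sub d} → f ≗ g → (b Vector.∷ f) ≗ (b Vector.∷ g)
  ∷-cong b f≗g zero    = refl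
  ∷-cong b f≗g (suc i) = f≗g i
  η : ∀ f {b} → f zero ≡ b → f ≗ (b Vector.∷ (f ∘ suc))
  η f eq zero    = eq
  η f eq (suc i) = refl
  split : ∀ f b → f zero ≡ b → P f → ∃ (P ∘ (true Vector.∷_)) ⊎ ∃ (P ∘ (false Vector.∷_))
  split f true  eq p = inj₁ (f ∘ suc , ext (η f eq) p)
  split f false eq p = inj₂ (f ∘ suc , ext (η f eq) p)

all-functions? : ∀ d {P : Sub d → Set} → (∀ {f g} → f ≗ g → P f → P g) → (∀ f → Dec (P f)) → Dec (∀ f → P f)
all-functions? d ext P? = map′
  (λ ¬∃¬ f → decidable-stable (P? f) λ ¬p → ¬∃¬ (f , ¬p))
  (λ ∀P (f , ¬p) → ¬p (∀P f))
  (¬? (any-function? d (λ f≗g ¬p p → ¬p (ext (sym ∘ f≗g) p)) (¬? ∘ P?)))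

any-list? : ∀ k {d} {P : List (Fin d) → Set} → (∀ xs → Dec (P xs)) → Dec (∃ λ xs → P xs × length xs ≡ k)
any-list? zero P? = map′ (λ p → [] , p , refl) (λ { ([] , p , _) → p }) (P? [])
any-list? (suc k) P? = map′
  (λ (x , xs , p , eq) → x ∷ xs , p , cong suc eq)
  (λ { (x ∷ xs , p , eq) → x , xs , p , ℕₚ.suc-injective eq })
  (Finₚ.any? λ x → any-list? k (P? ∘ (x ∷_)))

greatest : {P : ℕ → Set} → (∀ k → Dec (P k)) → P 0 → ∀ b → (∀ k → P k → k ≤ b) → ∃ λ c → P c × (∀ k → P k → k ≤ c)
greatest P? P0 zero    bound = 0 , P0 , bound
greatest P? P0 (suc b) bound with P? (suc b)
... | yes p = suc b , p , bound
... | no ¬p = greatest P? P0 b λ k pk → ℕₚ.≤-pred (ℕₚ.≤∧≢⇒< (bound k pk) λ { refl → ¬p pk })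

module Decisions (G : PlaneGraph) where
  open Plane G
  open ResonantFaces G

  isPM? : ∀ M → Dec (IsPM G (Whole G) M)
  isPM? M = map′
    (λ (symm , at) → (λ _ _ → tt) , symm , (λ v _ → at v) , λ v ¬⊤ → ⊥-elim (¬⊤ tt))
    (λ (_ , symm , at , _) → symm , λ v → at v tt)
    (Finₚ.all? (λ x → M (rev x) Boolₚ.≟ M x) ×-dec
     Finₚ.all? λ v → Finₚ.any? λ x → (tail x ≟ v) ×-dec ((M x Boolₚ.≟ true) ×-dec
       Finₚ.all? λ y → (tail y ≟ v) →-dec ((M y Boolₚ.≟ true) →-dec (y ≟ x))))

  isPM-cong : ∀ {M M'} → M ≗ M' → IsPM G (Whole G) M → IsPM G (Whole G) M'
  isPM-cong eq (_ , symm , at , _) = (λ _ _ → tt) ,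
    (λ x → trans (sym (eq (rev x))) (trans (symm x) (eq x))) ,
    (λ v _ → let x , xv , Mx , unique = at v tt
             in x , xv , trans (sym (eq x)) Mx , λ y yv My → unique y yv (trans (eq y) My)) ,
    λ v ¬⊤ → ⊥-elim (¬⊤ tt)

  -- The conditions range over infinitely many exponents; they become finite when restated for the
  -- darts of the orbit.
  resonant? : ∀ x M → Dec (Resonant G x M)
  resonant? x M = map′
    (λ (s , a) → (λ i j → s _ _ (i , refl) (j , refl)) , λ k → a _ (k , refl))
    (λ (s , a) → (λ { _ _ (i , refl) (j , refl) → s i j }) , λ { _ (k , refl) → a k })
    ((Finₚ.all? λ y → Finₚ.all? λ z → Faces.sameOrbit? x y →-dec (Faces.sameOrbit? x z →-dec ((tail y ≟ tail z) →-dec (y ≟ z))))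
     ×-dec (Finₚ.all? λ y → Faces.sameOrbit? x y →-dec (M (ϕ y) Boolₚ.≟ not (M y))))

  resonantSet? : ∀ K → Dec (ResonantSet G (Whole G) (FinFace G) K)
  resonantSet? K =
    (Finₚ.all? λ i → ¬? (Faces.sameOrbit? outer (lookup K i))) ×-dec
    ((Finₚ.all? λ i → Finₚ.all? λ j → ¬? (i ≟ j) →-dec
       Finₚ.all? λ v → onFace? v (lookup K i) →-dec ¬? (onFace? v (lookup K j))) ×-dec
     any-function? d
       (λ {M} {M'} eq (pm , res) → isPM-cong eq pm , λ i → resonant-cong M M' (λ k → sym (eq _)) (res i))
       (λ M → isPM? M ×-dec Finₚ.all? λ i → resonant? (lookup K i) M))

  forcing? : ∀ M S → Dec (Forcing G M S)
  forcing? M S =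
    (Finₚ.all? λ i → M (lookup S i) Boolₚ.≟ true) ×-dec
    all-functions? d
      (λ eq h pm agree x → trans (sym (eq x)) (h (isPM-cong (sym ∘ eq) pm) (λ i → trans (eq _) (agree i)) x))
      (λ M' → isPM? M' →-dec ((Finₚ.all? λ i → M' (lookup S i) Boolₚ.≟ true) →-dec (Finₚ.all? λ x → M' x Boolₚ.≟ M x)))

  resonantSet-bound : ∀ {K} → ResonantSet G (Whole G) (FinFace G) K → length K ≤ d
  resonantSet-bound {K} (_ , disjoint , _) = Finₚ.injective⇒≤ {f = lookup K} λ {i} {j} eq →
    decidable-stable (i ≟ j) λ i≢j → disjoint i j i≢j _ (0 , refl) (0 , cong tail (sym eq))

-- The two inequalities

module FaceCycle (G : PlaneGraph) {M : Fin (PlaneGraph.d G) → Bool} (pm : IsPM G (Whole G) M)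
                 {x : Fin (PlaneGraph.d G)} (res : Resonant G x M) where
  open Plane G
  open PerfectMatching G pm

  private
    per = minimal-period ϕ x (proj₁ (proj₂ (Faces.period x))) (proj₂ (proj₂ (Faces.period x)))
    P = proj₁ per
    returns = proj₁ (proj₂ per)

    -- A face of length 2 in a simple graph would have the same edge on both sides, which
    -- contradicts alternation.
    long : ∀ Q → iter ϕ (suc Q) x ≡ x → 3 ≤ suc Q
    long zero          eq = contradiction (trans (sym (tail-ϕ x)) (cong tail eq)) (no-loop x)
    long (suc zero)    eq = contradiction (trans (sym (M-rev x)) (trans (cong M (sym back)) (proj₂ res 0))) (Boolₚ.not-¬ refl)
      where
      back : ϕ x ≡ rev x
      back = simple (ϕ x) (rev x) (tail-ϕ x)
        (trans (sym (tail-ϕ (ϕ x))) (trans (cong tail eq) (cong tail (sym (rev-invol x)))))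
    long (suc (suc Q)) _  = s≤s (s≤s (s≤s z≤n))

  faceCycle : Cycle G
  faceCycle .len = suc P
  faceCycle .dart i = iter ϕ i x
  faceCycle .len≥3 = long P returns
  faceCycle .periodic i = trans (iter-+ ϕ i (suc P) x) (cong (iter ϕ i) returns)
  faceCycle .consec i = tail-ϕ (iter ϕ i x)
  faceCycle .distinct i j i< j< eq = proj₂ (proj₂ per) i j i< j< (proj₁ res i j eq)

module MinMaxBounds (G : PlaneGraph) where
  open Plane G

  forcing-lower-bound : ∀ {M K} → IsPM G (Whole G) M →
    (∀ i j → i ≢ j → ∀ v → OnFace G v (lookup K i) → ¬ OnFace G v (lookup K j)) →
    (∀ i → Resonant G (lookup K i) M) → ∀ S → Forcing G M S → length K ≤ length S
  forcing-lower-bound {M} {K} pm disjoint res S (in-M , forces) =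
    -- The goal is decidable, so membership in the face cycles may be assumed decided.
    decidable-stable (length K ℕₚ.≤? length S) λ K≰S →
      ¬¬-∀Fin (λ i → ¬¬-∀Fin λ x → ¬¬-excluded-middle {A = OnCycle G (C i) x}) λ on? → K≰S (bound on?)
    where
    C : Fin (length K) → Cycle G
    C i = FaceCycle.faceCycle G pm (res i)
    bound : (∀ i x → Dec (OnCycle G (C i) x)) → length K ≤ length S
    bound on? = Finₚ.injective⇒≤ {f = λ i → proj₁ (hit i)} λ {i} {j} eq → decidable-stable (i ≟ j) λ i≢j →
        disjoint i j i≢j _ (CycleFacts.onCycle-vertex G (C i) (proj₂ (hit i)))
          (CycleFacts.onCycle-vertex G (C j) (subst (OnCycle G (C j) ∘ lookup S) (sym eq) (proj₂ (hit j))))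
      where
      hit : ∀ i → ∃ λ s → OnCycle G (C i) (lookup S s)
      hit i with Finₚ.any? (λ s → on? i (lookup S s))
      ... | yes h = h
      ... | no ¬h = contradiction
        (trans (sym (forces flip flip-pm (λ s → trans (flip-off (λ on → ¬h (s , on))) (in-M s)) (lookup K i))) (flip-on (0 , inj₁ refl)))
        (Boolₚ.not-¬ refl)
        where
        open PerfectMatching.Flip G pm {C i} (proj₂ (res i)) (on? i)

  module _ (bip : Bipartite G)
    (hyp : ∀ C → Nice G C → ∀ K → MaxResonant G (IC G C) (Inside G C) K → UniquePM G (Minus G (IC G C) K)) where
    open Descent G bip hyp

    decide : (C : Cycle G) → ¬ ¬ ∃ λ (D : DecCycle G) → DecCycle.cycle D ≡ C
    decide C ¬dec =
      ¬¬-∀Fin (λ x → ¬¬-excluded-middle {A = OnCycle G C x}) λ on? →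
      ¬¬-∀Fin (λ x → ¬¬-excluded-middle {A = Outside G C x}) λ out? →
      ¬dec (record { cycle = C ; on? = on? ; out? = out? } , refl)

    disjoint-cycles-bound : ∀ {M k} → IsPM G (Whole G) M → (Cs : Fin k → Cycle G) → (∀ i → Alternating G (Cs i) M) →
      (∀ i j → i ≢ j → ∀ v → CycleFacts.VertexOf G (Cs i) v → ¬ CycleFacts.VertexOf G (Cs j) v) →
      ¬ ¬ LargeResonantSet k
    disjoint-cycles-bound {M} {k} pm Cs alt disjoint ¬large =
      ¬¬-∀Fin (λ i → decide (Cs i)) λ Ds → let D = proj₁ ∘ Ds in
        descend k {[]} {tabulate D} (Listₚ.length-tabulate D) (record
          { M = M ; pm = pm ; faces-finite = [] ; faces-resonant = [] ; faces-disjoint = []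
          ; cycles-alternating = Allₚ.tabulate⁺ λ i → subst (λ C → Alternating G C M) (sym (proj₂ (Ds i))) (alt i)
          ; cycles-disjoint = AllPairsₚ.tabulate⁺ λ {i} {j} i≢j v on on′ → disjoint i j i≢j v
              (subst (λ C → CycleFacts.VertexOf G C v) (proj₂ (Ds i)) on)
              (subst (λ C → CycleFacts.VertexOf G C v) (proj₂ (Ds j)) on′)
          ; faces-cycles = Allₚ.tabulate⁺ λ _ → []
          }) ¬large

    forcing-upper-bound : ∀ {c} → (∀ K → ResonantSet G (Whole G) (FinFace G) K → length K ≤ c) →
      ∀ {M} → IsPM G (Whole G) M → ¬ ¬ ∃ λ S → Forcing G M S × length S ≤ c
    forcing-upper-bound {c} clar {M} pm ¬S =
      Dicut.minmax d (const false) (count≤k {d} (const true)) λ (k , (k′ , k≤k′ , packing) , S , S≤k , covers) →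
        let Cs , alt , disjoint = disjoint-cycles packing in
        disjoint-cycles-bound pm Cs alt disjoint λ (K , RK , k′≤K) →
          ¬S (map toMatching S , cover-forces covers ,
              ℕₚ.≤-trans (ℕₚ.≤-reflexive (Listₚ.length-map toMatching S))
                (ℕₚ.≤-trans S≤k (ℕₚ.≤-trans k≤k′ (ℕₚ.≤-trans k′≤K (clar K RK)))))
      where open BipartitePlane.Directed G bip pm

theorem4p1 : (G : PlaneGraph) → Bipartite G → HasPM G →
    (∀ C → Nice G C → ∀ K → MaxResonant G (IC G C) (Inside G C) K →
    UniquePM G (Minus G (IC G C) K)) →
    ∃ λ k → IsClar G k × IsMaxForcing G k
theorem4p1 G bip (M₁ , pm₁) hyp with
  greatest {λ k → ∃ λ K → ResonantSet G (Whole G) (FinFace G) K × length K ≡ k}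
    (λ k → any-list? k resonantSet?) ([] , ((λ ()) , (λ ()) , M₁ , pm₁ , λ ()) , refl) _
    (λ { k (K , RK , refl) → resonantSet-bound {K} RK })
  where open Decisions G
... | c , (K , RK@(_ , disjoint , M , pm , res) , refl) , maximal =
  -- The matching for which a maximum resonant set is resonant also attains the maximum forcing
  -- number.
  c , (K , (RK , clar) , refl) , (M , pm , forcing-set , lower) , upper
  where
  open Decisions G
  open MinMaxBounds G
  clar : ∀ K′ → ResonantSet G (Whole G) (FinFace G) K′ → length K′ ≤ c
  clar K′ RK′ = maximal _ (K′ , RK′ , refl)
  lower : ∀ S → Forcing G M S → c ≤ length S
  lower = forcing-lower-bound {K = K} pm disjoint res
  forcing-set : ∃ λ S → Forcing G M S × length S ≡ c
  -- A forcing set of size at most `c` exists only under a double negation. The lower bound makes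
  -- its size exactly `c`, and for a fixed size the search is finite.
  forcing-set = decidable-stable (any-list? c (forcing? M)) λ ¬S →
    forcing-upper-bound bip hyp clar pm λ (S , F , S≤c) → ¬S (S , F , ℕₚ.≤-antisym S≤c (lower S F))
  upper : ∀ M′ j → IsPM G (Whole G) M′ → IsForcingNum G M′ j → j ≤ c
  upper M′ j pm′ (_ , least-size) = decidable-stable (j ℕₚ.≤? c) λ j≰c →
    forcing-upper-bound bip hyp clar pm′ λ (S , F , S≤c) → j≰c (ℕₚ.≤-trans (least-size S F) S≤c)
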